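{- Let $s=s(n)\ge n$ be an integer, write $k=s/n$, and set $$c(k)=2k\left(1-(k-1)\log\left(\frac{k}{k-1}\right)\right).$$ Let $M$ be a random perfect matching of $K_{n,n}$ and let $X_M$ be the indicator variable of the event that $M$ is rainbow. (1) If the edge-coloring of $K_{n,n}$ is chosen at random in the uniform random model with $s\ge n$ colors, then $$\Pr(X_M=1)=e^{ -c(k)\mu},$$ where $\mu\sim\frac{n^2}{2s}$. (2) If the edge-coloring of $K_{n,n}$ is chosen at random in the regular random model with $s\ge n$ colors, then $$\Pr(X_M=1)=e^{ -(c(k)+o(1))\mu},$$ where again $\mu\sim\frac{n^2}{2s}$.
   Context: $K_{n,n}$ is the complete bipartite graph with $n$ vertices on each side. A perfect matching of an edge-colored $K_{n,n}$ is rainbow if no two of its edges have the same color. In the uniform random model with $s$ colors, each edge of $K_{n,n}$ is given one of the $s$ colors independently and uniformly at random. In the regular random model with $s$ colors, where $s$ divides $n^2$, the coloring is chosen uniformly at random among all edge-colorings of $K_{n,n}$ with $s$ colors in which every color class has exactly $n^2/s=n/k$ edges. Probabilities are over the random coloring and the uniformly random perfect matching $M$, chosen independently of the coloring (by symmetry the value is the same for any fixed $M$). At $k=1$ the expression $(k-1)\log(k/(k-1))$ is interpreted as its limit $0$, so $c(1)=2$. $a\sim b$ means $a/b\to1$ as $n\to\infty$, and $o(1)$ is as $n\to\infty$.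
   Formalization: Part (2) is proved under the added condition that n²/s → ∞ (along n with s dividing n²); without it the claim fails, e.g. for s = n² every edge has its own color, so Pr = 1, while the formula would give a limit of e^{ -1/2}. -}

module Defs where

open import Data.Nat.Base as ℕ using (ℕ; zero; suc; _!)
import Data.Nat.Properties as ℕₚ
open import Data.Integer.Base using (+_)
import Data.Integer.Base as ℤ
import Data.Integer.Properties as ℤₚ
open import Data.Rational as ℚ using (ℚ; 0ℚ; 1ℚ; ½; _/_) hiding (module ℚ)
import Data.Rational.Properties as ℚₚ
import Data.Rational.Unnormalised as ℚᵘ
import Data.Rational.Unnormalised.Properties as ℚᵘₚ
open import Data.Rational.Solver using (module +-*-Solver)
open import Algebra.Definitions.RawSemiring ℚ.+-*-rawSemiring using (_^_)
open import Data.Fin.Base using (Fin)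
open import Data.Fin.Properties using (_≟_; all?)
open import Data.List.Base using (List; []; _∷_; length; filter; allFin; cartesianProduct; cartesianProductWith)
open import Data.Vec.Base as Vec using (Vec; []; _∷_; lookup; zipWith; concat; count)
open import Data.Vec.Relation.Unary.AllPairs using (allPairs?)
open import Data.Vec.Relation.Unary.Unique.Propositional using (Unique)
open import Data.Product using (Σ; Σ-syntax; ∃-syntax; _×_; _,_; proj₁; proj₂; uncurry)
open import Data.Sum using (_⊎_; inj₁; inj₂)
open import Relation.Binary.PropositionalEquality using (_≡_; refl; sym; trans; cong; cong₂; subst; subst₂)
open import Relation.Nullary using (Dec; yes; no)
open import Relation.Nullary.Decidable using (¬?)
open import Relation.Unary using (Pred; Decidable)
open import Level using (0ℓ)

module Sequence where

  open ℚ using (_+_; _*_; -_; _-_; _≤_; _<_; ∣_∣)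

  IsCauchy : (ℕ → ℚ) → Set
  IsCauchy x = ∀ ε → 0ℚ < ε → ∃[ N ] (∀ m n → N ℕ.≤ m → N ℕ.≤ n → ∣ x m - x n ∣ ≤ ε)

  sum : (ℕ → ℚ) → ℕ → ℚ
  sum t zero    = 0ℚ
  sum t (suc n) = sum t n + t n

  expTerm : ℚ → ℕ → ℚ
  expTerm x j = x ^ j * (+ 1 / (j !)) {{j ℕₚ.!≢0}}

  artanhTerm : ℚ → ℕ → ℚ
  artanhTerm z j = z ^ (1 ℕ.+ 2 ℕ.* j) * (+ 1 / (1 ℕ.+ 2 ℕ.* j))

  open +-*-Solver using (_:=_; _:+_; _:*_; _:-_; :-_; con) renaming (solve to solveᵗ)

  fromNat : ℕ → ℚ
  fromNat n = + n / 1

  /-toℚᵘ : ∀ p n .{{_ : ℕ.NonZero n}} → ℚ.toℚᵘ (p / n) ℚᵘ.≃ (p ℚᵘ./ n)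
  /-toℚᵘ p (suc n) = ℚₚ.toℚᵘ-fromℚᵘ (ℚᵘ.mkℚᵘ p n)

  fromNat-suc : ∀ n → fromNat (suc n) ≡ 1ℚ + fromNat n
  fromNat-suc n = ℚₚ.toℚᵘ-injective (begin
    ℚ.toℚᵘ (fromNat (suc n))             ≈⟨ /-toℚᵘ (+ suc n) 1 ⟩
    + suc n ℚᵘ./ 1                       ≈⟨ ℚᵘ.*≡* (cong (ℤ._* + 1) (cong (ℤ._+_ (+ 1)) (sym (ℤₚ.*-identityʳ (+ n))))) ⟩
    ℚᵘ.1ℚᵘ ℚᵘ.+ (+ n ℚᵘ./ 1)             ≈⟨ ℚᵘₚ.+-congʳ ℚᵘ.1ℚᵘ (/-toℚᵘ (+ n) 1) ⟨
    ℚᵘ.1ℚᵘ ℚᵘ.+ ℚ.toℚᵘ (fromNat n)       ≈⟨ ℚₚ.toℚᵘ-homo-+ 1ℚ (fromNat n) ⟨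
    ℚ.toℚᵘ (1ℚ + fromNat n)              ∎)
    where open ℚᵘₚ.≃-Reasoning

  fromNat-* : ∀ n → fromNat (suc n) * (+ 1 / suc n) ≡ 1ℚ
  fromNat-* n = ℚₚ.toℚᵘ-injective (begin
    ℚ.toℚᵘ (fromNat (suc n) * (+ 1 / suc n))             ≈⟨ ℚₚ.toℚᵘ-homo-* (fromNat (suc n)) (+ 1 / suc n) ⟩
    ℚ.toℚᵘ (fromNat (suc n)) ℚᵘ.* ℚ.toℚᵘ (+ 1 / suc n)   ≈⟨ ℚᵘₚ.*-cong (/-toℚᵘ (+ suc n) 1) (/-toℚᵘ (+ 1) (suc n)) ⟩
    (+ suc n ℚᵘ./ 1) ℚᵘ.* (+ 1 ℚᵘ./ suc n)               ≈⟨ ℚᵘ.*≡* (cong (λ a → + suc a) (trans (ℕₚ.*-identityʳ (n ℕ.* 1)) (trans (ℕₚ.*-identityʳ n) (sym (trans (ℕₚ.+-identityʳ (n ℕ.+ 0)) (ℕₚ.+-identityʳ n)))))) ⟩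
    ℚᵘ.1ℚᵘ                                               ∎)
    where open ℚᵘₚ.≃-Reasoning

  /-* : ∀ m n .{{_ : ℕ.NonZero m}} .{{_ : ℕ.NonZero n}} .{{_ : ℕ.NonZero (m ℕ.* n)}} →
        + 1 / (m ℕ.* n) ≡ (+ 1 / m) * (+ 1 / n)
  /-* (suc m) (suc n) = ℚₚ.toℚᵘ-injective (begin
    ℚ.toℚᵘ (+ 1 / (suc m ℕ.* suc n))                   ≈⟨ /-toℚᵘ (+ 1) (suc m ℕ.* suc n) ⟩
    + 1 ℚᵘ./ (suc m ℕ.* suc n)                         ≈⟨ ℚᵘₚ.≃-refl ⟩
    (+ 1 ℚᵘ./ suc m) ℚᵘ.* (+ 1 ℚᵘ./ suc n)             ≈⟨ ℚᵘₚ.*-cong (/-toℚᵘ (+ 1) (suc m)) (/-toℚᵘ (+ 1) (suc n)) ⟨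
    ℚ.toℚᵘ (+ 1 / suc m) ℚᵘ.* ℚ.toℚᵘ (+ 1 / suc n)     ≈⟨ ℚₚ.toℚᵘ-homo-* (+ 1 / suc m) (+ 1 / suc n) ⟨
    ℚ.toℚᵘ ((+ 1 / suc m) * (+ 1 / suc n))             ∎)
    where open ℚᵘₚ.≃-Reasoning

  archimedean : ∀ p → ∃[ i ] p ≤ fromNat i
  archimedean p = i , ℚₚ.toℚᵘ-cancel-≤ (ℚᵘₚ.≤-respʳ-≃ (ℚᵘₚ.≃-sym (/-toℚᵘ (+ i) 1)) (lemma p))
    where
    i = ℤ.∣ (ℚ.↥ p) ∣
    lemma : ∀ p → ℚ.toℚᵘ p ℚᵘ.≤ (+ ℤ.∣ (ℚ.↥ p) ∣ ℚᵘ./ 1)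
    lemma (ℚ.mkℚ (+ a) d _)      = ℚᵘ.*≤* (subst₂ ℤ._≤_ (ℤₚ.pos-* a 1) (ℤₚ.pos-* a (suc d)) (ℤ.+≤+ (ℕₚ.*-monoʳ-≤ a (ℕ.s≤s ℕ.z≤n))))
    lemma (ℚ.mkℚ (ℤ.-[1+ a ]) d _) = ℚᵘ.*≤* ℤ.-≤+

  0≤1/ : ∀ n .{{_ : ℕ.NonZero n}} → 0ℚ ≤ + 1 / n
  0≤1/ n = ℚₚ.nonNegative⁻¹ (+ 1 / n) {{ℚₚ.normalize-nonNeg 1 n}}

  fromNat≥0 : ∀ n → 0ℚ ≤ fromNat n
  fromNat≥0 n = ℚₚ.nonNegative⁻¹ (fromNat n) {{ℚₚ.normalize-nonNeg n 1}}

  *-monoˡ : ∀ {r p q} → 0ℚ ≤ r → p ≤ q → r * p ≤ r * q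
  *-monoˡ {r} 0≤r = ℚₚ.*-monoˡ-≤-nonNeg r {{ℚ.nonNegative 0≤r}}

  *-monoʳ : ∀ {r p q} → 0ℚ ≤ r → p ≤ q → p * r ≤ q * r
  *-monoʳ {r} 0≤r = ℚₚ.*-monoʳ-≤-nonNeg r {{ℚ.nonNegative 0≤r}}

  *-mono : ∀ {p q r s} → 0ℚ ≤ p → 0ℚ ≤ s → p ≤ q → r ≤ s → p * r ≤ q * s
  *-mono 0≤p 0≤s p≤q r≤s = ℚₚ.≤-trans (*-monoˡ 0≤p r≤s) (*-monoʳ 0≤s p≤q)

  0≤* : ∀ {p q} → 0ℚ ≤ p → 0ℚ ≤ q → 0ℚ ≤ p * q
  0≤* {p} {q} 0≤p 0≤q = subst (_≤ p * q) (ℚₚ.*-zeroʳ p) (*-monoˡ 0≤p 0≤q)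

  0<* : ∀ {p q} → 0ℚ < p → 0ℚ < q → 0ℚ < p * q
  0<* {p} {q} 0<p 0<q = subst (_< p * q) (ℚₚ.*-zeroʳ p) (ℚₚ.*-monoʳ-<-pos p {{ℚ.positive 0<p}} 0<q)

  reciprocal : ∀ p → 0ℚ < p → ∃[ r ] (0ℚ < r × p * r ≡ 1ℚ)
  reciprocal p 0<p = ℚ.1/ p , ℚₚ.positive⁻¹ (ℚ.1/ p) {{ℚₚ.1/pos⇒pos p}} , ℚₚ.*-inverseʳ p
    where instance
      p⁺ = ℚ.positive 0<p
      p≢0 = ℚₚ.pos⇒nonZero p

  0<½ : 0ℚ < ½
  0<½ = ℚₚ.positive⁻¹ ½

  0<1 : 0ℚ < 1ℚ
  0<1 = ℚₚ.positive⁻¹ 1ℚ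

  ½+½ : ∀ ε → ½ * ε + ½ * ε ≡ ε
  ½+½ = solveᵗ 1 (λ e → con ½ :* e :+ con ½ :* e := e) refl

  ∣-∣-sym : ∀ p q → ∣ p - q ∣ ≡ ∣ q - p ∣
  ∣-∣-sym p q = trans (cong ∣_∣ (solveᵗ 2 (λ p q → p :- q := :- (q :- p)) refl p q)) (ℚₚ.∣-p∣≡∣p∣ (q - p))

  ∣-∣-triangle : ∀ p q r → ∣ p - r ∣ ≤ ∣ p - q ∣ + ∣ q - r ∣
  ∣-∣-triangle p q r = subst (λ a → ∣ a ∣ ≤ ∣ p - q ∣ + ∣ q - r ∣)
    (solveᵗ 3 (λ p q r → (p :- q) :+ (q :- r) := p :- r) refl p q r)
    (ℚₚ.∣p+q∣≤∣p∣+∣q∣ (p - q) (q - r))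

  p≤∣p∣ : ∀ p → p ≤ ∣ p ∣
  p≤∣p∣ p with ℚₚ.≤-total 0ℚ p
  ... | inj₁ 0≤p = ℚₚ.≤-reflexive (sym (ℚₚ.0≤p⇒∣p∣≡p 0≤p))
  ... | inj₂ p≤0 = ℚₚ.≤-trans p≤0 (ℚₚ.0≤∣p∣ p)

  dominated : ∀ x y f → IsCauchy x → IsCauchy y → ∀ K → 0ℚ < K → ∀ M →
              (∀ m n → M ℕ.≤ m → M ℕ.≤ n → ∣ f m - f n ∣ ≤ K * (∣ x m - x n ∣ + ∣ y m - y n ∣)) →
              IsCauchy f
  dominated x y f cx cy K 0<K M f≤ ε 0<ε = N , λ m n N≤m N≤n → begin
    ∣ f m - f n ∣                           ≤⟨ f≤ m n (ℕₚ.≤-trans M≤N N≤m) (ℕₚ.≤-trans M≤N N≤n) ⟩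
    K * (∣ x m - x n ∣ + ∣ y m - y n ∣)     ≤⟨ *-monoˡ (ℚₚ.<⇒≤ 0<K) (ℚₚ.+-mono-≤
                                                 (proj₂ ex m n (ℕₚ.≤-trans x≤N N≤m) (ℕₚ.≤-trans x≤N N≤n))
                                                 (proj₂ ey m n (ℕₚ.≤-trans y≤N N≤m) (ℕₚ.≤-trans y≤N N≤n))) ⟩
    K * (½ * (r * ε) + ½ * (r * ε))         ≡⟨ cong (K *_) (½+½ (r * ε)) ⟩
    K * (r * ε)                             ≡⟨ ℚₚ.*-assoc K r ε ⟨
    (K * r) * ε                             ≡⟨ cong (_* ε) Kr≡1 ⟩
    1ℚ * ε                                  ≡⟨ ℚₚ.*-identityˡ ε ⟩
    ε                                       ∎
    where
    open ℚₚ.≤-Reasoning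
    r = proj₁ (reciprocal K 0<K)
    Kr≡1 = proj₂ (proj₂ (reciprocal K 0<K))
    0<δ : 0ℚ < ½ * (r * ε)
    0<δ = 0<* 0<½ (0<* (proj₁ (proj₂ (reciprocal K 0<K))) 0<ε)
    ex = cx (½ * (r * ε)) 0<δ
    ey = cy (½ * (r * ε)) 0<δ
    N = M ℕ.⊔ (proj₁ ex ℕ.⊔ proj₁ ey)
    M≤N = ℕₚ.m≤m⊔n M (proj₁ ex ℕ.⊔ proj₁ ey)
    x≤N = ℕₚ.≤-trans (ℕₚ.m≤m⊔n (proj₁ ex) (proj₁ ey)) (ℕₚ.m≤n⊔m M (proj₁ ex ℕ.⊔ proj₁ ey))
    y≤N = ℕₚ.≤-trans (ℕₚ.m≤n⊔m (proj₁ ex) (proj₁ ey)) (ℕₚ.m≤n⊔m M (proj₁ ex ℕ.⊔ proj₁ ey))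

  bounded : ∀ x → IsCauchy x → ∃[ b ] ∃[ N ] (∀ n → N ℕ.≤ n → ∣ x n ∣ ≤ fromNat b)
  bounded x cx = proj₁ arch , N , λ n N≤n → begin
    ∣ x n ∣                     ≡⟨ cong ∣_∣ (solveᵗ 2 (λ p q → p := (p :- q) :+ q) refl (x n) (x N)) ⟩
    ∣ (x n - x N) + x N ∣       ≤⟨ ℚₚ.∣p+q∣≤∣p∣+∣q∣ (x n - x N) (x N) ⟩
    ∣ x n - x N ∣ + ∣ x N ∣     ≤⟨ ℚₚ.+-monoˡ-≤ ∣ x N ∣ (proj₂ e n N N≤n ℕₚ.≤-refl) ⟩
    1ℚ + ∣ x N ∣                ≤⟨ proj₂ arch ⟩
    fromNat (proj₁ arch)        ∎
    where
    open ℚₚ.≤-Reasoning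
    e = cx 1ℚ 0<1
    N = proj₁ e
    arch = archimedean (1ℚ + ∣ x N ∣)

  fromNat-mono : ∀ {m n} → m ℕ.≤ n → fromNat m ≤ fromNat n
  fromNat-mono {n = n} ℕ.z≤n = fromNat≥0 n
  fromNat-mono {suc m} {suc n} (ℕ.s≤s m≤n) =
    subst₂ _≤_ (sym (fromNat-suc m)) (sym (fromNat-suc n)) (ℚₚ.+-monoʳ-≤ 1ℚ (fromNat-mono m≤n))

  module Geometric (u : ℕ → ℚ) (M : ℕ) (d : ℚ) (0<d : 0ℚ < d) (d≤1 : d ≤ 1ℚ) (0≤u : ∀ j → 0ℚ ≤ u j)
                   (u-suc : ∀ j → M ℕ.≤ j → u (suc j) ≤ (1ℚ - d) * u j) where

    open ℚₚ.≤-Reasoning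

    decay : ∀ i → u (i ℕ.+ M) * (1ℚ + fromNat i * d) ≤ u M
    decay zero = ℚₚ.≤-reflexive (solveᵗ 2 (λ u d → u :* (con 1ℚ :+ con 0ℚ :* d) := u) refl (u M) d)
    decay (suc i) = begin
      u (suc (i ℕ.+ M)) * (1ℚ + fromNat (suc i) * d)   ≤⟨ *-monoʳ 0≤f (u-suc (i ℕ.+ M) (ℕₚ.m≤n+m M i)) ⟩
      ((1ℚ - d) * v) * (1ℚ + fromNat (suc i) * d)      ≡⟨ cong (λ a → ((1ℚ - d) * v) * (1ℚ + a * d)) (fromNat-suc i) ⟩
      ((1ℚ - d) * v) * (1ℚ + (1ℚ + fromNat i) * d)     ≡⟨ solveᵗ 3 (λ v d i → ((con 1ℚ :- d) :* v) :* (con 1ℚ :+ (con 1ℚ :+ i) :* d)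
                                                               := v :* (con 1ℚ :+ i :* d) :- (con 1ℚ :+ i) :* d :* d :* v) refl v d (fromNat i) ⟩
      v * (1ℚ + fromNat i * d) - (1ℚ + fromNat i) * d * d * v   ≤⟨ ℚₚ.+-monoʳ-≤ (v * (1ℚ + fromNat i * d)) (ℚₚ.neg-antimono-≤ 0≤g) ⟩
      v * (1ℚ + fromNat i * d) - 0ℚ                    ≡⟨ ℚₚ.+-identityʳ (v * (1ℚ + fromNat i * d)) ⟩
      v * (1ℚ + fromNat i * d)                         ≤⟨ decay i ⟩
      u M                                              ∎
      where
      v = u (i ℕ.+ M)
      0≤d = ℚₚ.<⇒≤ 0<d
      0≤f : 0ℚ ≤ 1ℚ + fromNat (suc i) * d
      0≤f = ℚₚ.+-mono-≤ (ℚₚ.<⇒≤ 0<1) (0≤* (fromNat≥0 (suc i)) 0≤d)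
      0≤g : 0ℚ ≤ (1ℚ + fromNat i) * d * d * v
      0≤g = 0≤* (0≤* (0≤* (ℚₚ.+-mono-≤ (ℚₚ.<⇒≤ 0<1) (fromNat≥0 i)) 0≤d) 0≤d) (0≤u (i ℕ.+ M))

    small : ∀ ε → 0ℚ < ε → ∃[ i ] u (i ℕ.+ M) ≤ ε
    small ε 0<ε = i , ℚₚ.*-cancelʳ-≤-pos (1ℚ + fromNat i * d) {{ℚ.positive 0<f}} (begin
      u (i ℕ.+ M) * (1ℚ + fromNat i * d)   ≤⟨ decay i ⟩
      u M                                  ≡⟨ ℚₚ.*-identityʳ (u M) ⟨
      u M * 1ℚ                             ≡⟨ cong (u M *_) (proj₂ (proj₂ rec)) ⟨
      u M * ((ε * d) * r)                  ≡⟨ solveᵗ 4 (λ u e d r → u :* ((e :* d) :* r) := e :* ((u :* r) :* d)) refl (u M) ε d r ⟩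
      ε * ((u M * r) * d)                  ≤⟨ *-monoˡ (ℚₚ.<⇒≤ 0<ε) (*-monoʳ (ℚₚ.<⇒≤ 0<d) (proj₂ arch)) ⟩
      ε * (fromNat i * d)                  ≤⟨ *-monoˡ (ℚₚ.<⇒≤ 0<ε) (begin
        fromNat i * d                        ≡⟨ ℚₚ.+-identityˡ (fromNat i * d) ⟨
        0ℚ + fromNat i * d                   ≤⟨ ℚₚ.+-monoˡ-≤ (fromNat i * d) (ℚₚ.<⇒≤ 0<1) ⟩
        1ℚ + fromNat i * d                   ∎) ⟩
      ε * (1ℚ + fromNat i * d)             ∎)
      where
      rec = reciprocal (ε * d) (0<* 0<ε 0<d)
      r = proj₁ rec
      arch = archimedean (u M * r)
      i = proj₁ arch
      0<f : 0ℚ < 1ℚ + fromNat i * d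
      0<f = ℚₚ.+-mono-<-≤ 0<1 (0≤* (fromNat≥0 i) (ℚₚ.<⇒≤ 0<d))

    module _ (t : ℕ → ℚ) (C : ℚ) (0<C : 0ℚ < C)
             (t≤ : ∀ j → M ℕ.≤ j → ∣ t j ∣ ≤ C * (u j - u (suc j))) where

      tail : ∀ n k → M ℕ.≤ n → ∣ sum t (k ℕ.+ n) - sum t n ∣ ≤ C * (u n - u (k ℕ.+ n))
      tail n zero M≤n = ℚₚ.≤-reflexive (trans
        (cong ∣_∣ (ℚₚ.+-inverseʳ (sum t n)))
        (solveᵗ 2 (λ c u → con 0ℚ := c :* (u :- u)) refl C (u n)))
      tail n (suc k) M≤n = begin
        ∣ (sum t (k ℕ.+ n) + t (k ℕ.+ n)) - sum t n ∣      ≡⟨ cong ∣_∣ (solveᵗ 3 (λ a b c → (a :+ b) :- c := b :+ (a :- c)) refl (sum t (k ℕ.+ n)) (t (k ℕ.+ n)) (sum t n)) ⟩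
        ∣ t (k ℕ.+ n) + (sum t (k ℕ.+ n) - sum t n) ∣      ≤⟨ ℚₚ.∣p+q∣≤∣p∣+∣q∣ (t (k ℕ.+ n)) (sum t (k ℕ.+ n) - sum t n) ⟩
        ∣ t (k ℕ.+ n) ∣ + ∣ sum t (k ℕ.+ n) - sum t n ∣    ≤⟨ ℚₚ.+-mono-≤ (t≤ (k ℕ.+ n) (ℕₚ.≤-trans M≤n (ℕₚ.m≤n+m n k))) (tail n k M≤n) ⟩
        C * (u (k ℕ.+ n) - u (suc (k ℕ.+ n))) + C * (u n - u (k ℕ.+ n))
                                                           ≡⟨ solveᵗ 4 (λ c x y z → c :* (x :- y) :+ c :* (z :- x) := c :* (z :- y)) refl C (u (k ℕ.+ n)) (u (suc (k ℕ.+ n))) (u n) ⟩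
        C * (u n - u (suc (k ℕ.+ n)))                      ∎

      tail′ : ∀ {n m} → M ℕ.≤ n → n ℕ.≤ m → ∣ sum t m - sum t n ∣ ≤ C * u n
      tail′ {n} {m} M≤n n≤m = begin
        ∣ sum t m - sum t n ∣       ≡⟨ cong (λ a → ∣ sum t a - sum t n ∣) m≡ ⟨
        ∣ sum t (k ℕ.+ n) - sum t n ∣   ≤⟨ tail n k M≤n ⟩
        C * (u n - u (k ℕ.+ n))     ≤⟨ *-monoˡ (ℚₚ.<⇒≤ 0<C) (ℚₚ.+-monoʳ-≤ (u n) (ℚₚ.neg-antimono-≤ (0≤u (k ℕ.+ n)))) ⟩
        C * (u n - 0ℚ)              ≡⟨ cong (C *_) (ℚₚ.+-identityʳ (u n)) ⟩
        C * u n                     ∎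
        where
        k = m ℕ.∸ n
        m≡ = ℕₚ.m∸n+n≡m n≤m

      series-cauchy : IsCauchy (sum t)
      series-cauchy ε 0<ε = N , λ m n N≤m N≤n → begin
        ∣ sum t m - sum t n ∣                                 ≤⟨ ∣-∣-triangle (sum t m) (sum t N) (sum t n) ⟩
        ∣ sum t m - sum t N ∣ + ∣ sum t N - sum t n ∣         ≤⟨ ℚₚ.+-mono-≤ (tail′ M≤N N≤m) (subst (_≤ C * u N) (∣-∣-sym (sum t n) (sum t N)) (tail′ M≤N N≤n)) ⟩
        C * u N + C * u N                                     ≤⟨ ℚₚ.+-mono-≤ Cu≤ Cu≤ ⟩
        ½ * ε + ½ * ε                                         ≡⟨ ½+½ ε ⟩
        ε                                                     ∎
        where
        rec = reciprocal C 0<C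
        r = proj₁ rec
        sm = small (½ * ε * r) (0<* (0<* 0<½ 0<ε) (proj₁ (proj₂ rec)))
        N = proj₁ sm ℕ.+ M
        M≤N = ℕₚ.m≤n+m M (proj₁ sm)
        Cu≤ : C * u N ≤ ½ * ε
        Cu≤ = begin
          C * u N              ≤⟨ *-monoˡ (ℚₚ.<⇒≤ 0<C) (proj₂ sm) ⟩
          C * (½ * ε * r)      ≡⟨ solveᵗ 3 (λ c e r → c :* (e :* r) := (c :* r) :* e) refl C (½ * ε) r ⟩
          (C * r) * (½ * ε)    ≡⟨ cong (_* (½ * ε)) (proj₂ (proj₂ rec)) ⟩
          1ℚ * (½ * ε)         ≡⟨ ℚₚ.*-identityˡ (½ * ε) ⟩
          ½ * ε                ∎

  const-cauchy : ∀ q → IsCauchy (λ _ → q)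
  const-cauchy q ε 0<ε = 0 , λ _ _ _ _ →
    ℚₚ.≤-trans (ℚₚ.≤-reflexive (cong ∣_∣ (ℚₚ.+-inverseʳ q))) (ℚₚ.<⇒≤ 0<ε)

  +-cauchy : ∀ x y → IsCauchy x → IsCauchy y → IsCauchy (λ n → x n + y n)
  +-cauchy x y cx cy = dominated x y (λ n → x n + y n) cx cy 1ℚ 0<1 0 λ m n _ _ → begin
    ∣ (x m + y m) - (x n + y n) ∣            ≡⟨ cong ∣_∣ (solveᵗ 4 (λ a b c d → (a :+ b) :- (c :+ d) := (a :- c) :+ (b :- d)) refl (x m) (y m) (x n) (y n)) ⟩
    ∣ (x m - x n) + (y m - y n) ∣            ≤⟨ ℚₚ.∣p+q∣≤∣p∣+∣q∣ (x m - x n) (y m - y n) ⟩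
    ∣ x m - x n ∣ + ∣ y m - y n ∣            ≡⟨ ℚₚ.*-identityˡ (∣ x m - x n ∣ + ∣ y m - y n ∣) ⟨
    1ℚ * (∣ x m - x n ∣ + ∣ y m - y n ∣)     ∎
    where open ℚₚ.≤-Reasoning

  dominated₁ : ∀ x f → IsCauchy x → (∀ m n → ∣ f m - f n ∣ ≤ ∣ x m - x n ∣) → IsCauchy f
  dominated₁ x f cx f≤ ε 0<ε = proj₁ (cx ε 0<ε) , λ m n N≤m N≤n →
    ℚₚ.≤-trans (f≤ m n) (proj₂ (cx ε 0<ε) m n N≤m N≤n)

  neg-cauchy : ∀ x → IsCauchy x → IsCauchy (λ n → - x n)
  neg-cauchy x cx = dominated₁ x (λ n → - x n) cx λ m n → ℚₚ.≤-reflexive (trans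
    (cong ∣_∣ (solveᵗ 2 (λ a b → (:- a) :- (:- b) := b :- a) refl (x m) (x n)))
    (∣-∣-sym (x n) (x m)))

  abs-cauchy : ∀ x → IsCauchy x → IsCauchy (λ n → ∣ x n ∣)
  abs-cauchy x cx = dominated₁ x (λ n → ∣ x n ∣) cx λ m n → reverse (x m) (x n)
    where
    open ℚₚ.≤-Reasoning
    half : ∀ p q → ∣ p ∣ - ∣ q ∣ ≤ ∣ p - q ∣
    half p q = begin
      ∣ p ∣ - ∣ q ∣                    ≡⟨ cong (λ a → ∣ a ∣ - ∣ q ∣) (solveᵗ 2 (λ p q → p := (p :- q) :+ q) refl p q) ⟩
      ∣ (p - q) + q ∣ - ∣ q ∣          ≤⟨ ℚₚ.+-monoˡ-≤ (- ∣ q ∣) (ℚₚ.∣p+q∣≤∣p∣+∣q∣ (p - q) q) ⟩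
      (∣ p - q ∣ + ∣ q ∣) - ∣ q ∣      ≡⟨ solveᵗ 2 (λ a b → (a :+ b) :- b := a) refl ∣ p - q ∣ ∣ q ∣ ⟩
      ∣ p - q ∣                        ∎
    reverse : ∀ p q → ∣ ∣ p ∣ - ∣ q ∣ ∣ ≤ ∣ p - q ∣
    reverse p q with ℚₚ.∣p∣≡p∨∣p∣≡-p (∣ p ∣ - ∣ q ∣)
    ... | inj₁ e = ℚₚ.≤-trans (ℚₚ.≤-reflexive e) (half p q)
    ... | inj₂ e = begin
      ∣ ∣ p ∣ - ∣ q ∣ ∣     ≡⟨ e ⟩
      - (∣ p ∣ - ∣ q ∣)     ≡⟨ solveᵗ 2 (λ a b → :- (a :- b) := b :- a) refl ∣ p ∣ ∣ q ∣ ⟩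
      ∣ q ∣ - ∣ p ∣         ≤⟨ half q p ⟩
      ∣ q - p ∣             ≡⟨ ∣-∣-sym q p ⟩
      ∣ p - q ∣             ∎

  *-cauchy : ∀ x y → IsCauchy x → IsCauchy y → IsCauchy (λ n → x n * y n)
  *-cauchy x y cx cy = dominated x y (λ n → x n * y n) cx cy B 0<B M λ m n M≤m M≤n → begin
    ∣ x m * y m - x n * y n ∣                            ≡⟨ cong ∣_∣ (solveᵗ 4 (λ a b c d → a :* b :- c :* d := b :* (a :- c) :+ c :* (b :- d)) refl (x m) (y m) (x n) (y n)) ⟩
    ∣ y m * (x m - x n) + x n * (y m - y n) ∣            ≤⟨ ℚₚ.∣p+q∣≤∣p∣+∣q∣ (y m * (x m - x n)) (x n * (y m - y n)) ⟩
    ∣ y m * (x m - x n) ∣ + ∣ x n * (y m - y n) ∣        ≡⟨ cong₂ _+_ (ℚₚ.∣p*q∣≡∣p∣*∣q∣ (y m) (x m - x n)) (ℚₚ.∣p*q∣≡∣p∣*∣q∣ (x n) (y m - y n)) ⟩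
    ∣ y m ∣ * ∣ x m - x n ∣ + ∣ x n ∣ * ∣ y m - y n ∣    ≤⟨ ℚₚ.+-mono-≤
                                                              (*-monoʳ (ℚₚ.0≤∣p∣ (x m - x n)) (ℚₚ.≤-trans (proj₂ (proj₂ by) m (ℕₚ.≤-trans y≤M M≤m)) yB))
                                                              (*-monoʳ (ℚₚ.0≤∣p∣ (y m - y n)) (ℚₚ.≤-trans (proj₂ (proj₂ bx) n (ℕₚ.≤-trans x≤M M≤n)) xB)) ⟩
    B * ∣ x m - x n ∣ + B * ∣ y m - y n ∣                ≡⟨ ℚₚ.*-distribˡ-+ B ∣ x m - x n ∣ ∣ y m - y n ∣ ⟨
    B * (∣ x m - x n ∣ + ∣ y m - y n ∣)                  ∎
    where
    open ℚₚ.≤-Reasoning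
    bx = bounded x cx
    by = bounded y cy
    b = suc (proj₁ bx ℕ.+ proj₁ by)
    B = fromNat b
    xB : fromNat (proj₁ bx) ≤ B
    xB = fromNat-mono (ℕₚ.≤-trans (ℕₚ.m≤m+n (proj₁ bx) (proj₁ by)) (ℕₚ.n≤1+n (proj₁ bx ℕ.+ proj₁ by)))
    yB : fromNat (proj₁ by) ≤ B
    yB = fromNat-mono (ℕₚ.≤-trans (ℕₚ.m≤n+m (proj₁ by) (proj₁ bx)) (ℕₚ.n≤1+n (proj₁ bx ℕ.+ proj₁ by)))
    0<B : 0ℚ < B
    0<B = subst (0ℚ <_) (sym (fromNat-suc (proj₁ bx ℕ.+ proj₁ by))) (ℚₚ.+-mono-<-≤ 0<1 (fromNat≥0 (proj₁ bx ℕ.+ proj₁ by)))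
    M = proj₁ (proj₂ bx) ℕ.⊔ proj₁ (proj₂ by)
    x≤M = ℕₚ.m≤m⊔n (proj₁ (proj₂ bx)) (proj₁ (proj₂ by))
    y≤M = ℕₚ.m≤n⊔m (proj₁ (proj₂ bx)) (proj₁ (proj₂ by))

  expTerm-suc : ∀ x j → expTerm x (suc j) ≡ x * (+ 1 / suc j) * expTerm x j
  expTerm-suc x j = trans
    (cong ((x * x ^ j) *_) (/-* (suc j) (j !) {{_}} {{j ℕₚ.!≢0}} {{(suc j) ℕₚ.!≢0}}))
    (solveᵗ 4 (λ x p a b → (x :* p) :* (a :* b) := x :* a :* (p :* b)) refl x (x ^ j) (+ 1 / suc j) ((+ 1 / (j !)) {{j ℕₚ.!≢0}}))

  expTerm≥0 : ∀ {x} → 0ℚ ≤ x → ∀ j → 0ℚ ≤ expTerm x j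
  expTerm≥0 0≤x zero = 0≤* (ℚₚ.<⇒≤ 0<1) (0≤1/ 1)
  expTerm≥0 {x} 0≤x (suc j) = subst (0ℚ ≤_) (sym (expTerm-suc x j)) (0≤* (0≤* 0≤x (0≤1/ (suc j))) (expTerm≥0 0≤x j))

  module Exp (b : ℕ) where

    open ℚₚ.≤-Reasoning

    B = fromNat b

    0≤B : 0ℚ ≤ B
    0≤B = fromNat≥0 b

    M = b ℕ.+ b

    B≤ : ∀ j → M ℕ.≤ j → B * (+ 1 / suc j) ≤ ½
    B≤ j M≤j = begin
      B * i                                 ≡⟨ cong (_* i) (½+½ B) ⟨
      (½ * B + ½ * B) * i                   ≡⟨ cong (_* i) (ℚₚ.*-distribˡ-+ ½ B B) ⟨
      (½ * (B + B)) * i                     ≤⟨ *-monoʳ (0≤1/ (suc j)) (*-monoˡ (ℚₚ.<⇒≤ 0<½) (B+B≤ b j M≤j)) ⟩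
      (½ * fromNat (suc j)) * i             ≡⟨ ℚₚ.*-assoc ½ (fromNat (suc j)) i ⟩
      ½ * (fromNat (suc j) * i)             ≡⟨ cong (½ *_) (fromNat-* j) ⟩
      ½ * 1ℚ                                ≡⟨ ℚₚ.*-identityʳ ½ ⟩
      ½                                     ∎
      where
      i = + 1 / suc j
      fromNat-+ : ∀ m n → fromNat m + fromNat n ≡ fromNat (m ℕ.+ n)
      fromNat-+ zero n = ℚₚ.+-identityˡ (fromNat n)
      fromNat-+ (suc m) n = trans (cong (_+ fromNat n) (fromNat-suc m))
        (trans (ℚₚ.+-assoc 1ℚ (fromNat m) (fromNat n))
        (trans (cong (λ a → 1ℚ + a) (fromNat-+ m n)) (sym (fromNat-suc (m ℕ.+ n)))))
      B+B≤ : ∀ b j → b ℕ.+ b ℕ.≤ j → fromNat b + fromNat b ≤ fromNat (suc j)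
      B+B≤ b j le = subst (_≤ fromNat (suc j)) (sym (fromNat-+ b b)) (fromNat-mono (ℕₚ.≤-trans le (ℕₚ.n≤1+n j)))

    T = expTerm B

    0≤T : ∀ j → 0ℚ ≤ T j
    0≤T = expTerm≥0 0≤B

    T-suc : ∀ j → M ℕ.≤ j → T (suc j) ≤ ½ * T j
    T-suc j M≤j = begin
      T (suc j)                       ≡⟨ expTerm-suc B j ⟩
      B * (+ 1 / suc j) * T j         ≤⟨ *-monoʳ (0≤T j) (B≤ j M≤j) ⟩
      ½ * T j                         ∎

    module G = Geometric T M ½ 0<½ (ℚₚ.≤ᵇ⇒≤ _) 0≤T T-suc

    E = sum T

    E-cauchy : IsCauchy E
    E-cauchy = G.series-cauchy T (1ℚ + 1ℚ) (ℚₚ.+-mono-< 0<1 0<1) λ j M≤j → begin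
      ∣ T j ∣                                    ≡⟨ ℚₚ.0≤p⇒∣p∣≡p (0≤T j) ⟩
      T j                                        ≡⟨ solveᵗ 1 (λ t → t := (con 1ℚ :+ con 1ℚ) :* (t :- con ½ :* t)) refl (T j) ⟩
      (1ℚ + 1ℚ) * (T j - ½ * T j)                ≤⟨ *-monoˡ (ℚₚ.<⇒≤ (ℚₚ.+-mono-< 0<1 0<1)) (ℚₚ.+-monoʳ-≤ (T j) (ℚₚ.neg-antimono-≤ (T-suc j M≤j))) ⟩
      (1ℚ + 1ℚ) * (T j - T (suc j))              ∎

    module _ {x y : ℚ} (x≤B : ∣ x ∣ ≤ B) (y≤B : ∣ y ∣ ≤ B) where

      term≤ : ∀ j → ∣ expTerm y j ∣ ≤ T j
      term≤ zero = ℚₚ.≤-reflexive (ℚₚ.0≤p⇒∣p∣≡p (0≤* (ℚₚ.<⇒≤ 0<1) (0≤1/ 1)))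
      term≤ (suc j) = begin
        ∣ expTerm y (suc j) ∣                 ≡⟨ cong ∣_∣ (expTerm-suc y j) ⟩
        ∣ y * i * expTerm y j ∣               ≡⟨ ℚₚ.∣p*q∣≡∣p∣*∣q∣ (y * i) (expTerm y j) ⟩
        ∣ y * i ∣ * ∣ expTerm y j ∣           ≡⟨ cong (_* ∣ expTerm y j ∣) (ℚₚ.∣p*q∣≡∣p∣*∣q∣ y i) ⟩
        ∣ y ∣ * ∣ i ∣ * ∣ expTerm y j ∣       ≡⟨ cong (λ a → ∣ y ∣ * a * ∣ expTerm y j ∣) (ℚₚ.0≤p⇒∣p∣≡p (0≤1/ (suc j))) ⟩
        ∣ y ∣ * i * ∣ expTerm y j ∣           ≤⟨ *-mono (0≤* (ℚₚ.0≤∣p∣ y) (0≤1/ (suc j))) (0≤T j) (*-monoʳ (0≤1/ (suc j)) y≤B) (term≤ j) ⟩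
        B * i * T j                           ≡⟨ expTerm-suc B j ⟨
        T (suc j)                             ∎
        where i = + 1 / suc j

      D = ∣ x - y ∣

      0≤D : 0ℚ ≤ D
      0≤D = ℚₚ.0≤∣p∣ (x - y)

      BT : ∀ j → B * T j ≡ fromNat (suc j) * T (suc j)
      BT j = sym (trans (cong (fromNat (suc j) *_) (expTerm-suc B j))
        (trans (solveᵗ 4 (λ n b i t → n :* (b :* i :* t) := (n :* i) :* (b :* t)) refl (fromNat (suc j)) B (+ 1 / suc j) (T j))
        (trans (cong (_* (B * T j)) (fromNat-* j)) (ℚₚ.*-identityˡ (B * T j)))))

      step : ∀ j {e} → ∣ expTerm x j - expTerm y j ∣ ≤ e →
             ∣ expTerm x (suc j) - expTerm y (suc j) ∣ ≤ (+ 1 / suc j) * (B * e + D * T j)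
      step j {e} h = begin
        ∣ expTerm x (suc j) - expTerm y (suc j) ∣     ≡⟨ cong ∣_∣ (cong₂ _-_ (expTerm-suc x j) (expTerm-suc y j)) ⟩
        ∣ x * i * p - y * i * q ∣                     ≡⟨ cong ∣_∣ (solveᵗ 5 (λ x y i p q → x :* i :* p :- y :* i :* q := i :* (x :* (p :- q) :+ (x :- y) :* q)) refl x y i p q) ⟩
        ∣ i * (x * (p - q) + (x - y) * q) ∣           ≡⟨ ℚₚ.∣p*q∣≡∣p∣*∣q∣ i (x * (p - q) + (x - y) * q) ⟩
        ∣ i ∣ * ∣ x * (p - q) + (x - y) * q ∣         ≡⟨ cong (_* ∣ x * (p - q) + (x - y) * q ∣) (ℚₚ.0≤p⇒∣p∣≡p (0≤1/ (suc j))) ⟩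
        i * ∣ x * (p - q) + (x - y) * q ∣             ≤⟨ *-monoˡ (0≤1/ (suc j)) (ℚₚ.∣p+q∣≤∣p∣+∣q∣ (x * (p - q)) ((x - y) * q)) ⟩
        i * (∣ x * (p - q) ∣ + ∣ (x - y) * q ∣)       ≡⟨ cong (i *_) (cong₂ _+_ (ℚₚ.∣p*q∣≡∣p∣*∣q∣ x (p - q)) (ℚₚ.∣p*q∣≡∣p∣*∣q∣ (x - y) q)) ⟩
        i * (∣ x ∣ * ∣ p - q ∣ + D * ∣ q ∣)           ≤⟨ *-monoˡ (0≤1/ (suc j)) (ℚₚ.+-mono-≤ (*-mono (ℚₚ.0≤∣p∣ x) 0≤e x≤B h) (*-monoˡ 0≤D (term≤ j))) ⟩
        i * (B * e + D * T j)                         ∎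
        where
        i = + 1 / suc j
        p = expTerm x j
        q = expTerm y j
        0≤e = ℚₚ.≤-trans (ℚₚ.0≤∣p∣ (p - q)) h

      diff : ∀ j → ∣ expTerm x (suc j) - expTerm y (suc j) ∣ ≤ D * T j
      diff zero = begin
        ∣ expTerm x 1 - expTerm y 1 ∣     ≤⟨ step 0 {0ℚ} (ℚₚ.≤-reflexive (cong ∣_∣ (ℚₚ.+-inverseʳ (expTerm x 0)))) ⟩
        1ℚ * (B * 0ℚ + D * T 0)           ≡⟨ solveᵗ 2 (λ b d → con 1ℚ :* (b :* con 0ℚ :+ d) := d) refl B (D * T 0) ⟩
        D * T 0                           ∎
      diff (suc j) = begin
        ∣ expTerm x (suc (suc j)) - expTerm y (suc (suc j)) ∣       ≤⟨ step (suc j) (diff j) ⟩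
        i * (B * (D * T j) + D * T (suc j))                         ≡⟨ solveᵗ 5 (λ i b d t u → i :* (b :* (d :* t) :+ d :* u) := i :* (d :* (b :* t :+ u))) refl i B D (T j) (T (suc j)) ⟩
        i * (D * (B * T j + T (suc j)))                             ≡⟨ cong (λ a → i * (D * (a + T (suc j)))) (BT j) ⟩
        i * (D * (n * T (suc j) + T (suc j)))                       ≡⟨ solveᵗ 4 (λ i d n u → i :* (d :* (n :* u :+ u)) := ((con 1ℚ :+ n) :* i) :* (d :* u)) refl i D n (T (suc j)) ⟩
        ((1ℚ + n) * i) * (D * T (suc j))                            ≡⟨ cong (λ a → (a * i) * (D * T (suc j))) (fromNat-suc (suc j)) ⟨
        (fromNat (suc (suc j)) * i) * (D * T (suc j))               ≡⟨ cong (_* (D * T (suc j))) (fromNat-* (suc j)) ⟩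
        1ℚ * (D * T (suc j))                                        ≡⟨ ℚₚ.*-identityˡ (D * T (suc j)) ⟩
        D * T (suc j)                                               ∎
        where
        i = + 1 / suc (suc j)
        n = fromNat (suc j)

      lipschitz : ∀ m → ∣ sum (expTerm x) (suc m) - sum (expTerm y) (suc m) ∣ ≤ D * E m
      lipschitz zero = ℚₚ.≤-reflexive (trans (cong ∣_∣ (ℚₚ.+-inverseʳ (0ℚ + expTerm x 0))) (sym (ℚₚ.*-zeroʳ D)))
      lipschitz (suc m) = begin
        ∣ (X + p) - (Y + q) ∣         ≡⟨ cong ∣_∣ (solveᵗ 4 (λ a b c d → (a :+ b) :- (c :+ d) := (a :- c) :+ (b :- d)) refl X p Y q) ⟩
        ∣ (X - Y) + (p - q) ∣         ≤⟨ ℚₚ.∣p+q∣≤∣p∣+∣q∣ (X - Y) (p - q) ⟩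
        ∣ X - Y ∣ + ∣ p - q ∣         ≤⟨ ℚₚ.+-mono-≤ (lipschitz m) (diff m) ⟩
        D * E m + D * T m             ≡⟨ ℚₚ.*-distribˡ-+ D (E m) (T m) ⟨
        D * (E m + T m)               ∎
        where
        X = sum (expTerm x) (suc m)
        Y = sum (expTerm y) (suc m)
        p = expTerm x (suc m)
        q = expTerm y (suc m)

      tail≤ : ∀ n k → ∣ sum (expTerm y) (k ℕ.+ n) - sum (expTerm y) n ∣ ≤ E (k ℕ.+ n) - E n
      tail≤ n zero = ℚₚ.≤-reflexive (trans (cong ∣_∣ (ℚₚ.+-inverseʳ (sum (expTerm y) n))) (sym (ℚₚ.+-inverseʳ (E n))))
      tail≤ n (suc k) = begin
        ∣ (S + q) - S₀ ∣              ≡⟨ cong ∣_∣ (solveᵗ 3 (λ a b c → (a :+ b) :- c := (a :- c) :+ b) refl S q S₀) ⟩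
        ∣ (S - S₀) + q ∣              ≤⟨ ℚₚ.∣p+q∣≤∣p∣+∣q∣ (S - S₀) q ⟩
        ∣ S - S₀ ∣ + ∣ q ∣            ≤⟨ ℚₚ.+-mono-≤ (tail≤ n k) (term≤ (k ℕ.+ n)) ⟩
        (E (k ℕ.+ n) - E n) + T (k ℕ.+ n)   ≡⟨ solveᵗ 3 (λ a b c → (a :- c) :+ b := (a :+ b) :- c) refl (E (k ℕ.+ n)) (T (k ℕ.+ n)) (E n) ⟩
        (E (k ℕ.+ n) + T (k ℕ.+ n)) - E n   ∎
        where
        S = sum (expTerm y) (k ℕ.+ n)
        S₀ = sum (expTerm y) n
        q = expTerm y (k ℕ.+ n)

    module Combine (x : ℕ → ℚ) (K : ℚ) (0≤K : 0ℚ ≤ K) (M₁ M₂ : ℕ)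
                   (x≤B : ∀ n → M₁ ℕ.≤ n → ∣ x n ∣ ≤ B) (E≤K : ∀ n → M₂ ℕ.≤ n → ∣ E n ∣ ≤ K) where

      e : ℕ → ℚ → ℚ
      e n q = sum (expTerm q) n

      weaken : ∀ a b → 0ℚ ≤ a → 0ℚ ≤ b → K * a + b ≤ (K + 1ℚ) * (a + b)
      weaken a b 0≤a 0≤b = begin
        K * a + b                          ≡⟨ ℚₚ.+-identityʳ (K * a + b) ⟨
        K * a + b + 0ℚ                     ≤⟨ ℚₚ.+-monoʳ-≤ (K * a + b) (ℚₚ.+-mono-≤ (0≤* 0≤K 0≤b) 0≤a) ⟩
        K * a + b + (K * b + a)            ≡⟨ solveᵗ 3 (λ k a b → k :* a :+ b :+ (k :* b :+ a) := (k :+ con 1ℚ) :* (a :+ b)) refl K a b ⟩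
        (K + 1ℚ) * (a + b)                 ∎

      second : ∀ {m n} → M₁ ℕ.≤ n → m ℕ.≤ n → ∣ e m (x n) - e n (x n) ∣ ≤ ∣ E m - E n ∣
      second {m} {n} M₁≤n m≤n = begin
        ∣ e m (x n) - e n (x n) ∣              ≡⟨ ∣-∣-sym (e m (x n)) (e n (x n)) ⟩
        ∣ e n (x n) - e m (x n) ∣              ≡⟨ cong (λ a → ∣ e a (x n) - e m (x n) ∣) n≡ ⟨
        ∣ e (k ℕ.+ m) (x n) - e m (x n) ∣      ≤⟨ tail≤ (x≤B n M₁≤n) (x≤B n M₁≤n) m k ⟩
        E (k ℕ.+ m) - E m                      ≡⟨ cong (λ a → E a - E m) n≡ ⟩
        E n - E m                              ≤⟨ p≤∣p∣ (E n - E m) ⟩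
        ∣ E n - E m ∣                          ≡⟨ ∣-∣-sym (E n) (E m) ⟩
        ∣ E m - E n ∣                          ∎
        where
        k = n ℕ.∸ m
        n≡ = ℕₚ.m∸n+n≡m m≤n

      first : ∀ {m n} → M₁ ℕ.≤ suc m → M₂ ℕ.≤ m → M₁ ℕ.≤ n →
              ∣ e (suc m) (x (suc m)) - e (suc m) (x n) ∣ ≤ K * ∣ x (suc m) - x n ∣
      first {m} {n} M₁≤m M₂≤m M₁≤n = begin
        ∣ e (suc m) (x (suc m)) - e (suc m) (x n) ∣     ≤⟨ lipschitz (x≤B (suc m) M₁≤m) (x≤B n M₁≤n) m ⟩
        d * E m                                         ≤⟨ *-monoˡ (ℚₚ.0≤∣p∣ (x (suc m) - x n)) (ℚₚ.≤-trans (p≤∣p∣ (E m)) (E≤K m M₂≤m)) ⟩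
        d * K                                           ≡⟨ ℚₚ.*-comm d K ⟩
        K * d                                           ∎
        where d = ∣ x (suc m) - x n ∣

      M₀ = suc (M₁ ℕ.⊔ M₂)

      ordered : ∀ {m n} → M₀ ℕ.≤ m → m ℕ.≤ n →
                ∣ e m (x m) - e n (x n) ∣ ≤ (K + 1ℚ) * (∣ x m - x n ∣ + ∣ E m - E n ∣)
      ordered {suc m} {n} (ℕ.s≤s M≤m) m≤n = begin
        ∣ e (suc m) (x (suc m)) - e n (x n) ∣
          ≤⟨ ∣-∣-triangle (e (suc m) (x (suc m))) (e (suc m) (x n)) (e n (x n)) ⟩
        ∣ e (suc m) (x (suc m)) - e (suc m) (x n) ∣ + ∣ e (suc m) (x n) - e n (x n) ∣
          ≤⟨ ℚₚ.+-mono-≤ (first M₁≤m (ℕₚ.≤-trans (ℕₚ.m≤n⊔m M₁ M₂) M≤m) M₁≤n) (second M₁≤n m≤n) ⟩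
        K * ∣ x (suc m) - x n ∣ + ∣ E (suc m) - E n ∣
          ≤⟨ weaken ∣ x (suc m) - x n ∣ ∣ E (suc m) - E n ∣ (ℚₚ.0≤∣p∣ (x (suc m) - x n)) (ℚₚ.0≤∣p∣ (E (suc m) - E n)) ⟩
        (K + 1ℚ) * (∣ x (suc m) - x n ∣ + ∣ E (suc m) - E n ∣)
          ∎
        where
        M₁≤m = ℕₚ.≤-trans (ℕₚ.m≤m⊔n M₁ M₂) (ℕₚ.≤-trans M≤m (ℕₚ.n≤1+n m))
        M₁≤n = ℕₚ.≤-trans M₁≤m m≤n

      main : ∀ m n → M₀ ℕ.≤ m → M₀ ℕ.≤ n →
             ∣ e m (x m) - e n (x n) ∣ ≤ (K + 1ℚ) * (∣ x m - x n ∣ + ∣ E m - E n ∣)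
      main m n M≤m M≤n with ℕₚ.≤-total m n
      ... | inj₁ m≤n = ordered M≤m m≤n
      ... | inj₂ n≤m = subst₂ _≤_ (∣-∣-sym (e n (x n)) (e m (x m)))
        (cong ((K + 1ℚ) *_) (cong₂ _+_ (∣-∣-sym (x n) (x m)) (∣-∣-sym (E n) (E m))))
        (ordered M≤n n≤m)

      e-cauchy : IsCauchy x → IsCauchy (λ n → e n (x n))
      e-cauchy cx = dominated x E (λ n → e n (x n)) cx E-cauchy (K + 1ℚ) (ℚₚ.+-mono-≤-< 0≤K 0<1) M₀ main

  exp-cauchy : ∀ x → IsCauchy x → IsCauchy (λ n → sum (expTerm (x n)) n)
  exp-cauchy x cx = from-bound (bounded x cx)
    where
    from-bound : (∃[ b ] ∃[ M ] (∀ n → M ℕ.≤ n → ∣ x n ∣ ≤ fromNat b)) → IsCauchy (λ n → sum (expTerm (x n)) n)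
    from-bound (b , M₁ , x≤B) = from-bounds (bounded (Exp.E b) (Exp.E-cauchy b))
      where
      from-bounds : (∃[ c ] ∃[ M ] (∀ n → M ℕ.≤ n → ∣ Exp.E b n ∣ ≤ fromNat c)) → IsCauchy (λ n → sum (expTerm (x n)) n)
      from-bounds (c , M₂ , E≤K) = Exp.Combine.e-cauchy b x (fromNat c) (fromNat≥0 c) M₁ M₂ x≤B E≤K cx

  artanh-cauchy : ∀ z → z * z < 1ℚ → IsCauchy (sum (artanhTerm z))
  artanh-cauchy z zz<1 = G.series-cauchy (artanhTerm z) C 0<C λ j _ → begin
    ∣ artanhTerm z j ∣                              ≡⟨ ℚₚ.∣p*q∣≡∣p∣*∣q∣ (z ^ (1 ℕ.+ 2 ℕ.* j)) (i j) ⟩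
    ∣ z ^ (1 ℕ.+ 2 ℕ.* j) ∣ * ∣ i j ∣               ≡⟨ cong₂ _*_ (∣odd∣ j) (ℚₚ.0≤p⇒∣p∣≡p (0≤1/ (1 ℕ.+ 2 ℕ.* j))) ⟩
    (∣ z ∣ * w ^ j) * i j                           ≤⟨ *-monoˡ (0≤* (ℚₚ.0≤∣p∣ z) (0≤w^ j)) (i≤1 j) ⟩
    (∣ z ∣ * w ^ j) * 1ℚ                            ≤⟨ ℚₚ.≤-reflexive (ℚₚ.*-identityʳ (∣ z ∣ * w ^ j)) ⟩
    ∣ z ∣ * w ^ j                                   ≤⟨ *-monoʳ (0≤w^ j) ∣z∣≤ ⟩
    (∣ z ∣ + 1ℚ) * w ^ j                            ≡⟨ ℚₚ.*-identityʳ ((∣ z ∣ + 1ℚ) * w ^ j) ⟨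
    ((∣ z ∣ + 1ℚ) * w ^ j) * 1ℚ                     ≡⟨ cong (((∣ z ∣ + 1ℚ) * w ^ j) *_) dr≡1 ⟨
    ((∣ z ∣ + 1ℚ) * w ^ j) * ((1ℚ - w) * r)         ≡⟨ solveᵗ 4 (λ a u w r → (a :* u) :* ((con 1ℚ :- w) :* r) := (a :* r) :* (u :- w :* u)) refl (∣ z ∣ + 1ℚ) (w ^ j) w r ⟩
    C * (w ^ j - w ^ suc j)                         ∎
    where
    open ℚₚ.≤-Reasoning
    w = z * z
    i : ℕ → ℚ
    i j = + 1 / (1 ℕ.+ 2 ℕ.* j)
    0≤w : 0ℚ ≤ w
    0≤w = subst (0ℚ ≤_) (∣zz∣ (ℚₚ.∣p∣≡p∨∣p∣≡-p z)) (0≤* (ℚₚ.0≤∣p∣ z) (ℚₚ.0≤∣p∣ z))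
      where
      ∣zz∣ : ∣ z ∣ ≡ z ⊎ ∣ z ∣ ≡ - z → ∣ z ∣ * ∣ z ∣ ≡ z * z
      ∣zz∣ (inj₁ e) = cong₂ _*_ e e
      ∣zz∣ (inj₂ e) = trans (cong₂ _*_ e e) (solveᵗ 1 (λ z → (:- z) :* (:- z) := z :* z) refl z)
    0<d : 0ℚ < 1ℚ - w
    0<d = subst (_< 1ℚ - w) (ℚₚ.+-inverseʳ w) (ℚₚ.+-monoˡ-< (- w) zz<1)
    d≤1 : 1ℚ - w ≤ 1ℚ
    d≤1 = subst (1ℚ - w ≤_) (ℚₚ.+-identityʳ 1ℚ) (ℚₚ.+-monoʳ-≤ 1ℚ (ℚₚ.neg-antimono-≤ 0≤w))
    0≤w^ : ∀ j → 0ℚ ≤ w ^ j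
    0≤w^ zero = ℚₚ.<⇒≤ 0<1
    0≤w^ (suc j) = 0≤* 0≤w (0≤w^ j)
    module G = Geometric (w ^_) 0 (1ℚ - w) 0<d d≤1 0≤w^
      (λ j _ → ℚₚ.≤-reflexive (solveᵗ 2 (λ w u → w :* u := (con 1ℚ :- (con 1ℚ :- w)) :* u) refl w (w ^ j)))
    rec = reciprocal (1ℚ - w) 0<d
    r = proj₁ rec
    dr≡1 = proj₂ (proj₂ rec)
    C = (∣ z ∣ + 1ℚ) * r
    0<C : 0ℚ < C
    0<C = 0<* (ℚₚ.+-mono-≤-< (ℚₚ.0≤∣p∣ z) 0<1) (proj₁ (proj₂ rec))
    ∣z∣≤ : ∣ z ∣ ≤ ∣ z ∣ + 1ℚ
    ∣z∣≤ = subst (_≤ ∣ z ∣ + 1ℚ) (ℚₚ.+-identityʳ ∣ z ∣) (ℚₚ.+-monoʳ-≤ ∣ z ∣ (ℚₚ.<⇒≤ 0<1))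
    ∣odd∣ : ∀ j → ∣ z ^ (1 ℕ.+ 2 ℕ.* j) ∣ ≡ ∣ z ∣ * w ^ j
    ∣odd∣ j = trans (ℚₚ.∣p*q∣≡∣p∣*∣q∣ z (z ^ (2 ℕ.* j))) (cong (∣ z ∣ *_)
      (trans (cong ∣_∣ (even j)) (ℚₚ.0≤p⇒∣p∣≡p (0≤w^ j))))
      where
      even : ∀ j → z ^ (2 ℕ.* j) ≡ w ^ j
      even zero = refl
      even (suc j) = trans (cong (z ^_) (ℕₚ.*-suc 2 j)) (trans (sym (ℚₚ.*-assoc z z (z ^ (2 ℕ.* j)))) (cong (w *_) (even j)))
    i≤1 : ∀ j → i j ≤ 1ℚ
    i≤1 j = subst₂ _≤_ (ℚₚ.*-identityˡ (i j)) (fromNat-* (2 ℕ.* j))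
      (*-monoʳ (0≤1/ (1 ℕ.+ 2 ℕ.* j)) (fromNat-mono {1} {suc (2 ℕ.* j)} (ℕ.s≤s ℕ.z≤n)))

  mobius : (q : ℚ) .{{_ : ℚ.Positive q}} → ℚ
  mobius q = ((q - 1ℚ) ℚ.÷ (q + 1ℚ)) {{ℚₚ.pos⇒nonZero (q + 1ℚ) {{ℚₚ.pos+pos⇒pos q 1ℚ}}}}

  square<1 : ∀ q r → 0ℚ < q → 0ℚ < r → (q + 1ℚ) * r ≡ 1ℚ → ((q - 1ℚ) * r) * ((q - 1ℚ) * r) < 1ℚ
  square<1 q r 0<q 0<r qr≡1 = subst₂ _<_ (ℚₚ.+-identityʳ (z * z)) eq (ℚₚ.+-monoʳ-< (z * z) 0<gap)
    where
    z = (q - 1ℚ) * r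
    gap = (q + q + q + q) * (r * r)
    0<gap : 0ℚ < gap
    0<gap = 0<* (ℚₚ.+-mono-< (ℚₚ.+-mono-< (ℚₚ.+-mono-< 0<q 0<q) 0<q) 0<q) (0<* 0<r 0<r)
    eq : z * z + gap ≡ 1ℚ
    eq = trans (solveᵗ 2 (λ q r → ((q :- con 1ℚ) :* r) :* ((q :- con 1ℚ) :* r) :+ (q :+ q :+ q :+ q) :* (r :* r)
                := ((q :+ con 1ℚ) :* r) :* ((q :+ con 1ℚ) :* r)) refl q r)
         (cong₂ _*_ qr≡1 qr≡1)

  mobius²<1 : ∀ q .{{_ : ℚ.Positive q}} → mobius q * mobius q < 1ℚ
  mobius²<1 q = square<1 q (ℚ.1/ p) (ℚₚ.positive⁻¹ q) (ℚₚ.positive⁻¹ (ℚ.1/ p) {{ℚₚ.1/pos⇒pos p}}) (ℚₚ.*-inverseʳ p)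
    where
    p = q + 1ℚ
    instance
      p⁺ = ℚₚ.pos+pos⇒pos q 1ℚ
      p≢0 = ℚₚ.pos⇒nonZero p

-- Real numbers are Cauchy sequences of rationals, compared by _≃_.

record ℝ : Set where
  constructor real
  field
    seq      : ℕ → ℚ
    isCauchy : Sequence.IsCauchy seq

open ℝ public

infix  4 _≃_ _≤_
infixl 6 _+_ _-_
infixl 7 _*_
infix  8 -_

_≃_ : ℝ → ℝ → Set
x ≃ y = ∀ ε → 0ℚ ℚ.< ε → ∃[ N ] (∀ n → N ℕ.≤ n → ℚ.∣ seq x n ℚ.- seq y n ∣ ℚ.≤ ε)

_≤_ : ℝ → ℝ → Set
x ≤ y = ∀ ε → 0ℚ ℚ.< ε → ∃[ N ] (∀ n → N ℕ.≤ n → seq x n ℚ.≤ seq y n ℚ.+ ε)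

fromℚ : ℚ → ℝ
fromℚ q = real (λ _ → q) (Sequence.const-cauchy q)

_+_ : ℝ → ℝ → ℝ
x + y = real (λ n → seq x n ℚ.+ seq y n) (Sequence.+-cauchy (seq x) (seq y) (isCauchy x) (isCauchy y))

_*_ : ℝ → ℝ → ℝ
x * y = real (λ n → seq x n ℚ.* seq y n) (Sequence.*-cauchy (seq x) (seq y) (isCauchy x) (isCauchy y))

-_ : ℝ → ℝ
- x = real (λ n → ℚ.- seq x n) (Sequence.neg-cauchy (seq x) (isCauchy x))

_-_ : ℝ → ℝ → ℝ
x - y = x + - y

∣_∣ : ℝ → ℝ
∣ x ∣ = real (λ n → ℚ.∣ seq x n ∣) (Sequence.abs-cauchy (seq x) (isCauchy x))

-- Diagonal: the n-th approximation is the first n terms of Σ x^j / j! at seq x n.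
exp : ℝ → ℝ
exp x = real (λ n → Sequence.sum (Sequence.expTerm (seq x n)) n) (Sequence.exp-cauchy (seq x) (isCauchy x))

-- log q = 2 artanh ((q - 1) / (q + 1)); the series converges for every q > 0.
log : (q : ℚ) .{{_ : ℚ.Positive q}} → ℝ
log q = fromℚ (+ 2 / 1) * real (Sequence.sum (Sequence.artanhTerm z)) (Sequence.artanh-cauchy z (Sequence.mobius²<1 q))
  where z = Sequence.mobius q

infix 4 _⟶_ _∼_

_⟶_ : (ℕ → ℝ) → ℝ → Set
a ⟶ ℓ = ∀ ε → 0ℚ ℚ.< ε → ∃[ N ] (∀ n → N ℕ.≤ n → ∣ a n - ℓ ∣ ≤ fromℚ ε)

-- a n / b n tends to 1, over positive n.
_∼_ : (ℕ → ℝ) → ((n : ℕ) .{{_ : ℕ.NonZero n}} → ℚ) → Set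
a ∼ b = ∀ ε → 0ℚ ℚ.< ε → ∃[ N ] (∀ n .{{_ : ℕ.NonZero n}} → N ℕ.≤ n →
  Σ[ b≢0 ∈ ℚ.NonZero (b n) ] ∣ a n * fromℚ ((ℚ.1/ b n) {{b≢0}}) - fromℚ 1ℚ ∣ ≤ fromℚ ε)

-- c k = 2k (1 - (k - 1) log (k / (k - 1))) for k > 1, extended by its limit
-- c 1 = 2. The value for k < 1 is irrelevant.
c : ℚ → ℝ
c k with 1ℚ ℚₚ.<? k
... | no  _   = fromℚ (+ 2 / 1)
... | yes 1<k = fromℚ (+ 2 / 1 ℚ.* k) * (fromℚ 1ℚ - fromℚ (k ℚ.- 1ℚ) * log (k ℚ.÷ (k ℚ.- 1ℚ)))
  where
  instance
    k⁺ : ℚ.Positive k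
    k⁺ = ℚ.positive (ℚₚ.<-trans (ℚₚ.positive⁻¹ 1ℚ) 1<k)
    k-1⁺ : ℚ.Positive (k ℚ.- 1ℚ)
    k-1⁺ = ℚ.positive (subst (ℚ._< k ℚ.- 1ℚ) (ℚₚ.+-inverseʳ 1ℚ) (ℚₚ.+-monoˡ-< (ℚ.- 1ℚ) 1<k))
    k-1≢0 : ℚ.NonZero (k ℚ.- 1ℚ)
    k-1≢0 = ℚₚ.pos⇒nonZero (k ℚ.- 1ℚ)
    1/k-1⁺ : ℚ.Positive (ℚ.1/ (k ℚ.- 1ℚ))
    1/k-1⁺ = ℚₚ.1/pos⇒pos (k ℚ.- 1ℚ)
    quotient⁺ : ℚ.Positive (k ℚ.÷ (k ℚ.- 1ℚ))
    quotient⁺ = ℚₚ.pos*pos⇒pos k (ℚ.1/ (k ℚ.- 1ℚ))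

n²/2s : (s : ℕ → ℕ) → (∀ n → n ℕ.≤ s n) → (n : ℕ) .{{_ : ℕ.NonZero n}} → ℚ
n²/2s s n≤s n = (+ (n ℕ.* n) / (2 ℕ.* s n)) {{ℕₚ.m*n≢0 2 (s n) {{_}} {{s≢0}}}}
  where
  s≢0 : ℕ.NonZero (s n)
  s≢0 = ℕ.>-nonZero (ℕₚ.<-≤-trans (ℕ.>-nonZero⁻¹ n) (n≤s n))

-- Entry (i , j) is the color of the edge joining left vertex i to right vertex j.
Coloring : ℕ → ℕ → Set
Coloring n s = Vec (Vec (Fin s) n) n

-- Entry i is the right vertex matched to left vertex i. A matching is perfect
-- when its entries are distinct, since an injection Fin n → Fin n is a bijection.
Matching : ℕ → Set
Matching n = Vec (Fin n) n

Rainbow : ∀ {n s} → Coloring n s → Matching n → Set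
Rainbow χ σ = Unique (zipWith lookup χ σ)

unique? : ∀ {m n} → Decidable (Unique {A = Fin m} {n})
unique? = allPairs? (λ i j → ¬? (i ≟ j))

rainbow? : ∀ {n s} → Decidable (uncurry (Rainbow {n} {s}))
rainbow? (χ , σ) = unique? (zipWith lookup χ σ)

classSize : ∀ {n s} → Coloring n s → Fin s → ℕ
classSize χ i = count (i ≟_) (concat χ)

-- Every class has exactly n² / s edges; unsatisfiable for n > 0 unless s divides n².
Regular : ∀ {n s} → Coloring n s → Set
Regular {n} {s} χ = ∀ i → classSize χ i ℕ.* s ≡ n ℕ.* n

regular? : ∀ {n s} → Decidable (Regular {n} {s})
regular? {n} {s} χ = all? (λ i → classSize χ i ℕ.* s ℕₚ.≟ n ℕ.* n)

vectors : ∀ {A : Set} → List A → ∀ n → List (Vec A n)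
vectors xs zero    = [] ∷ []
vectors xs (suc n) = cartesianProductWith _∷_ xs (vectors xs n)

colorings : ∀ n s → List (Coloring n s)
colorings n s = vectors (vectors (allFin s) n) n

regularColorings : ∀ n s → List (Coloring n s)
regularColorings n s = filter regular? (colorings n s)

perfectMatchings : ∀ n → List (Matching n)
perfectMatchings n = filter unique? (vectors (allFin n) n)

-- Probability of P under the uniform distribution on a list without
-- repetitions, set to 0 on the empty list.
Pr : ∀ {A : Set} {P : Pred A 0ℓ} → List A → Decidable P → ℚ
Pr Ω P? with length Ω
... | zero  = 0ℚ
... | suc m = + length (filter P? Ω) / suc m

-- A uniform coloring and an independent uniform perfect matching are together
-- uniform on the product.
uniformPr : ℕ → ℕ → ℚ
uniformPr n s = Pr (cartesianProduct (colorings n s) (perfectMatchings n)) rainbow?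

regularPr : ℕ → ℕ → ℚ
regularPr n s = Pr (cartesianProduct (regularColorings n s) (perfectMatchings n)) rainbow?

module Submission where

import Defs
open import Data.Bool.Base using (true; false; _∧_; if_then_else_)
open import Data.Empty using (⊥-elim)
open import Data.Fin.Base using (Fin)
open import Data.Fin.Properties using (_≟_; all?)
import Data.Integer.Base as ℤ
import Data.Integer.Properties as ℤₚ
open import Data.List.Base using (List; []; _∷_; length; filter; map; allFin; cartesianProductWith; cartesianProduct) renaming (_++_ to _++ˡ_)
open import Data.List.Properties using (length-tabulate; map-tabulate)
open import Data.Nat.Base as ℕ using (ℕ; zero; suc; _!) hiding (module ℕ)
open import Data.Nat.Divisibility using (_∣_; divides; _∣?_)
import Data.Nat.Properties as ℕₚ
open import Data.Nat.Solver using () renaming (module +-*-Solver to ℕ-Solver)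
open import Data.Product using (∃-syntax; _×_; _,_; proj₁; proj₂)
open import Data.Rational as ℚ using (ℚ; 0ℚ; 1ℚ; ½; _/_) hiding (module ℚ)
import Data.Rational.Properties as ℚₚ
open import Data.Rational.Solver using (module +-*-Solver)
import Data.Rational.Unnormalised as ℚᵘ
import Data.Rational.Unnormalised.Properties as ℚᵘₚ
open import Data.Sum using (_⊎_; inj₁; inj₂)
open import Data.Vec.Base as Vec using (Vec; []; _∷_; lookup; zipWith; concat; count; insertAt; _++_)
open import Data.Vec.Properties using (insertAt-lookup)
open import Data.Vec.Relation.Unary.All as All using (All; []; _∷_)
open import Data.Vec.Relation.Unary.AllPairs using ([]; _∷_)
open import Data.Vec.Relation.Unary.Unique.Propositional using (Unique)
open import Function.Base using (_∘_; id)
open import Level using (0ℓ)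
open import Relation.Binary.PropositionalEquality using (_≡_; _≢_; refl; sym; trans; cong; cong₂; subst; subst₂; module ≡-Reasoning)
open import Relation.Nullary using (Dec; yes; no; does; ¬_)
open import Relation.Nullary.Decidable using (¬?)
open import Relation.Unary using (Pred; Decidable)

-- For a fixed matching the rainbow probability is Π_{i<n} (s - i) / s in the
-- uniform model, and this times Π_{i<n} n² / (n² - i) in the regular model.
-- Since log (s / (s - i)) = - log (1 - i / s), minus the logarithm of the first
-- product is a left Riemann sum S of - log (1 - x / s) over 0 ≤ x ≤ n, whose
-- integral I is exactly c(k) n² / 2s. Comparing one step of the sum with one
-- step of the closed form of the integral gives
--   0 ≤ I - S ≤ Σ_{i<n} 1 / (s - i) ≤ (n / s) (1 + 1/2 + ⋯ + 1/n),
-- which is o(n² / s) uniformly in s ≥ n because the harmonic sum is O(√n).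
-- Part (1) takes μ = S / c(k); part (2) takes μ = n² / 2s and absorbs I - S and
-- the logarithm of the second product, which is at most 1, into δ.
--
-- Analytically only two facts about Cauchy reals are needed, both obtained from
-- partial sums: (p - q) / p ≤ log p - log q ≤ (p - q) / q for 1 ≤ q ≤ p, and the
-- quadratic Taylor bound for exp.

-- Part (1) asserts an equality, so the whole approximation error has to be stored in `μ`. That
-- forces a division by the real number c(k), although the order of Cauchy reals is undecidable:
-- `inv` truncates below ¼, and a bound c(k) ≥ ½ shows that the truncation is harmless.
--
-- In part (2) the second product changes the exponent by a bounded amount, which is negligible
-- against `μ` only if n² / s grows; this is the growth hypothesis of the regular model, taken along
-- those n for which s divides n². Some such condition is necessary: for s = n² every regular
-- coloring is rainbow, so the probability is 1, whereas c(k) n² / 2s tends to ½.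
--
-- The product of n factors becomes a single exponential by absorbing one factor at a time into an
-- exponent that keeps a free real summand. The same free summand later yields the quotient of the
-- two products.

-- Inequalities between rationals and the splitting of small errors.

module Rational where

  open ℚ using (_+_; _*_; -_; _-_; _≤_; _<_; ∣_∣)
  open Defs.Sequence using (0<*; reciprocal; 0<½; 0<1; *-monoˡ)
  open +-*-Solver

  ≤-by : ∀ {p q} d → 0ℚ ≤ d → q - p ≡ d → p ≤ q
  ≤-by {p} {q} d 0≤d eq = subst₂ _≤_ (ℚₚ.+-identityʳ p) (trans (cong (λ e → p + e) (sym eq)) (solve 2 (λ p q → p :+ (q :- p) := q) refl p q))
    (ℚₚ.+-monoʳ-≤ p 0≤d)

  0≤q-p : ∀ {p q} → p ≤ q → 0ℚ ≤ q - p
  0≤q-p {p} {q} p≤q = subst (_≤ q - p) (ℚₚ.+-inverseʳ p) (ℚₚ.+-monoˡ-≤ (- p) p≤q)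

  0<q-p : ∀ {p q} → p < q → 0ℚ < q - p
  0<q-p {p} {q} p<q = subst (_< q - p) (ℚₚ.+-inverseʳ p) (ℚₚ.+-monoˡ-< (- p) p<q)

  0≤+ : ∀ {p q} → 0ℚ ≤ p → 0ℚ ≤ q → 0ℚ ≤ p + q
  0≤+ = ℚₚ.+-mono-≤

  0≤1 : 0ℚ ≤ 1ℚ
  0≤1 = ℚₚ.<⇒≤ 0<1

  ½* : ∀ {ε} → 0ℚ < ε → 0ℚ < ½ * ε
  ½* = 0<* 0<½

  cancelˡ-≤ : ∀ {r p q} → 0ℚ < r → r * p ≤ r * q → p ≤ q
  cancelˡ-≤ {r} 0<r = ℚₚ.*-cancelˡ-≤-pos r {{ℚ.positive 0<r}}

  cancelˡ-≡ : ∀ {r p q} → 0ℚ < r → r * p ≡ r * q → p ≡ q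
  cancelˡ-≡ 0<r eq = ℚₚ.≤-antisym (cancelˡ-≤ 0<r (ℚₚ.≤-reflexive eq)) (cancelˡ-≤ 0<r (ℚₚ.≤-reflexive (sym eq)))

  ∣∣≤ : ∀ {p q} → p ≤ q → - p ≤ q → ∣ p ∣ ≤ q
  ∣∣≤ {p} p≤q -p≤q with ℚₚ.∣p∣≡p∨∣p∣≡-p p
  ... | inj₁ e = ℚₚ.≤-trans (ℚₚ.≤-reflexive e) p≤q
  ... | inj₂ e = ℚₚ.≤-trans (ℚₚ.≤-reflexive e) -p≤q

  -- Take δ = min (ε, 1) / (K + 1). The bound δ ≤ 1 gives δ² ≤ δ, so an error term quadratic in δ
  -- still drops below ε once K collects all its coefficients.
  shrink : ∀ K → 0ℚ ≤ K → ∀ ε → 0ℚ < ε → ∃[ δ ] (0ℚ < δ × δ ≤ 1ℚ × K * δ ≤ ε)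
  shrink K 0≤K ε 0<ε with reciprocal (K + 1ℚ) (ℚₚ.+-mono-≤-< 0≤K 0<1)
  ... | r , 0<r , eq = δ , 0<* 0<m 0<r , δ≤1 , Kδ≤ε
    where
    m = ε ℚ.⊓ 1ℚ
    0<m : 0ℚ < m
    0<m with ℚₚ.⊓-sel ε 1ℚ
    ... | inj₁ e = subst (0ℚ <_) (sym e) 0<ε
    ... | inj₂ e = subst (0ℚ <_) (sym e) 0<1
    δ = m * r
    Kr+r : K * r + r ≡ 1ℚ
    Kr+r = trans (solve 2 (λ K r → K :* r :+ r := (K :+ con 1ℚ) :* r) refl K r) eq
    0≤Kr = Defs.Sequence.0≤* 0≤K (ℚₚ.<⇒≤ 0<r)
    r≤1 : r ≤ 1ℚ
    r≤1 = ≤-by (K * r) 0≤Kr (trans (cong (_- r) (sym Kr+r)) (solve 2 (λ a r → (a :+ r) :- r := a) refl (K * r) r))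
    Kr≤1 : K * r ≤ 1ℚ
    Kr≤1 = ≤-by r (ℚₚ.<⇒≤ 0<r) (trans (cong (_- (K * r)) (sym Kr+r)) (solve 2 (λ a r → (a :+ r) :- a := r) refl (K * r) r))
    δ≤1 : δ ≤ 1ℚ
    δ≤1 = Defs.Sequence.*-mono (ℚₚ.<⇒≤ 0<m) 0≤1 (ℚₚ.p⊓q≤q ε 1ℚ) r≤1
    Kδ≤ε : K * δ ≤ ε
    Kδ≤ε = begin
      K * (m * r)   ≡⟨ solve 3 (λ K m r → K :* (m :* r) := m :* (K :* r)) refl K m r ⟩
      m * (K * r)   ≤⟨ *-monoˡ (ℚₚ.<⇒≤ 0<m) Kr≤1 ⟩
      m * 1ℚ        ≡⟨ ℚₚ.*-identityʳ m ⟩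
      m             ≤⟨ ℚₚ.p⊓q≤p ε 1ℚ ⟩
      ε             ∎
      where open ℚₚ.≤-Reasoning

-- Order, equality and error bounds for Cauchy reals.

module Real where

  open Rational
  open ℚ using (_+_; _*_; -_; _-_; _≤_; _<_; ∣_∣)
  open Defs.Sequence using (reciprocal; ½+½; *-monoˡ; *-mono; p≤∣p∣)
  open Defs using (ℝ; real; seq; isCauchy; fromℚ; _≃_; exp) renaming
    (_≤_ to _≤ᴿ_; _+_ to _+ᴿ_; _*_ to _*ᴿ_; -_ to -ᴿ_; _-_ to _-ᴿ_; ∣_∣ to ∣_∣ᴿ) public
  open +-*-Solver

  infix 4 _⊢≤_

  Eventually : (ℕ → Set) → Set
  Eventually P = ∃[ N ] (∀ n → N ℕ.≤ n → P n)

  eventually-map : ∀ {P Q : ℕ → Set} → (∀ n → P n → Q n) → Eventually P → Eventually Q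
  eventually-map f (N , p) = N , λ n N≤n → f n (p n N≤n)

  eventually-zip : ∀ {P Q R : ℕ → Set} → (∀ n → P n → Q n → R n) → Eventually P → Eventually Q → Eventually R
  eventually-zip f (M , p) (N , q) = M ℕ.⊔ N , λ n M⊔N≤n →
    f n (p n (ℕₚ.m⊔n≤o⇒m≤o M N M⊔N≤n)) (q n (ℕₚ.m⊔n≤o⇒n≤o M N M⊔N≤n))

  -- The order on ℝ leaves a slack ε on a tail, so such a bound restrains the limit and not the
  -- single approximations. `_∼_` and `_⟶_` are stated in exactly this form.
  _⊢≤_ : ℝ → ℚ → Set
  x ⊢≤ q = ∣ x ∣ᴿ ≤ᴿ fromℚ q

  ≃-pointwise : ∀ {x y} → (∀ n → seq x n ≡ seq y n) → x ≃ y
  ≃-pointwise {x} {y} eq ε 0<ε = 0 , λ n _ → ℚₚ.≤-trans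
    (ℚₚ.≤-reflexive (cong ∣_∣ (trans (cong (_- seq y n) (eq n)) (ℚₚ.+-inverseʳ (seq y n))))) (ℚₚ.<⇒≤ 0<ε)

  ≤-pointwise : ∀ {x y} → (∀ n → seq x n ≤ seq y n) → x ≤ᴿ y
  ≤-pointwise {x} {y} le ε 0<ε = 0 , λ n _ → ℚₚ.≤-trans (le n)
    (≤-by ε (ℚₚ.<⇒≤ 0<ε) (solve 2 (λ y ε → (y :+ ε) :- y := ε) refl (seq y n) ε))

  ≃-sym : ∀ {x y} → x ≃ y → y ≃ x
  ≃-sym {x} {y} x≃y ε 0<ε = eventually-map
    (λ n → subst (_≤ ε) (Defs.Sequence.∣-∣-sym (seq x n) (seq y n))) (x≃y ε 0<ε)

  ≃-trans : ∀ {x y z} → x ≃ y → y ≃ z → x ≃ z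
  ≃-trans {x} {y} {z} x≃y y≃z ε 0<ε = eventually-zip
    (λ n a b → ℚₚ.≤-trans (Defs.Sequence.∣-∣-triangle (seq x n) (seq y n) (seq z n))
       (ℚₚ.≤-trans (ℚₚ.+-mono-≤ a b) (ℚₚ.≤-reflexive (½+½ ε))))
    (x≃y (½ * ε) (½* 0<ε)) (y≃z (½ * ε) (½* 0<ε))

  ≤-trans : ∀ {x y z} → x ≤ᴿ y → y ≤ᴿ z → x ≤ᴿ z
  ≤-trans {x} {y} {z} x≤y y≤z ε 0<ε = eventually-zip
    (λ n a b → ℚₚ.≤-trans a (ℚₚ.≤-trans (ℚₚ.+-monoˡ-≤ (½ * ε) b)
      (ℚₚ.≤-reflexive (solve 2 (λ z ε → (z :+ con ½ :* ε) :+ con ½ :* ε := z :+ ε) refl (seq z n) ε))))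
    (x≤y (½ * ε) (½* 0<ε)) (y≤z (½ * ε) (½* 0<ε))

  fromℚ-mono : ∀ {p q} → p ≤ q → fromℚ p ≤ᴿ fromℚ q
  fromℚ-mono {p} {q} p≤q = ≤-pointwise {fromℚ p} {fromℚ q} λ _ → p≤q

  +-mono : ∀ {x y u v} → x ≤ᴿ y → u ≤ᴿ v → x +ᴿ u ≤ᴿ y +ᴿ v
  +-mono {x} {y} {u} {v} x≤y u≤v ε 0<ε = eventually-zip
    (λ n a b → ℚₚ.≤-trans (ℚₚ.+-mono-≤ a b) (ℚₚ.≤-reflexive
      (solve 3 (λ y v ε → (y :+ con ½ :* ε) :+ (v :+ con ½ :* ε) := (y :+ v) :+ ε) refl (seq y n) (seq v n) ε)))
    (x≤y (½ * ε) (½* 0<ε)) (u≤v (½ * ε) (½* 0<ε))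

  -- An inequality depends only on the difference of its sides. Comparing differences approximation
  -- by approximation hands all algebra on reals to the ring solver for rationals.
  ≤-rearrange : ∀ {x y u v} → x ≤ᴿ y → (∀ n → seq v n - seq u n ≡ seq y n - seq x n) → u ≤ᴿ v
  ≤-rearrange {x} {y} {u} {v} x≤y eq ε 0<ε = eventually-map
    (λ n a → ≤-by ((seq y n + ε) - seq x n) (0≤q-p a)
      (trans (solve 3 (λ u v ε → (v :+ ε) :- u := (v :- u) :+ ε) refl (seq u n) (seq v n) ε)
      (trans (cong (_+ ε) (eq n)) (solve 3 (λ x y ε → (y :- x) :+ ε := (y :+ ε) :- x) refl (seq x n) (seq y n) ε))))
    (x≤y ε 0<ε)

  scale-mono : ∀ {q x y} → 0ℚ ≤ q → x ≤ᴿ y → fromℚ q *ᴿ x ≤ᴿ fromℚ q *ᴿ y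
  scale-mono {q} {x} {y} 0≤q x≤y ε 0<ε = let (δ , 0<δ , _ , qδ≤ε) = shrink q 0≤q ε 0<ε in eventually-map
    (λ n a → ℚₚ.≤-trans (*-monoˡ 0≤q a) (ℚₚ.≤-trans (ℚₚ.≤-reflexive (ℚₚ.*-distribˡ-+ q (seq y n) δ))
      (ℚₚ.+-monoʳ-≤ (q * seq y n) qδ≤ε)))
    (x≤y δ 0<δ)

  scale-cong : ∀ q {x y} → x ≃ y → fromℚ q *ᴿ x ≃ fromℚ q *ᴿ y
  scale-cong q {x} {y} x≃y ε 0<ε = let (δ , 0<δ , _ , qδ≤ε) = shrink ∣ q ∣ (ℚₚ.0≤∣p∣ q) ε 0<ε in eventually-map
    (λ n a → ℚₚ.≤-trans (ℚₚ.≤-reflexive (trans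
        (cong ∣_∣ (solve 3 (λ q x y → q :* x :- q :* y := q :* (x :- y)) refl q (seq x n) (seq y n)))
        (ℚₚ.∣p*q∣≡∣p∣*∣q∣ q (seq x n - seq y n))))
      (ℚₚ.≤-trans (*-monoˡ (ℚₚ.0≤∣p∣ q) a) qδ≤ε))
    (x≃y δ 0<δ)

  scale-cancel : ∀ {q x y} → 0ℚ < q → fromℚ q *ᴿ x ≃ fromℚ q *ᴿ y → x ≃ y
  scale-cancel {q} {x} {y} 0<q eq = ≃-trans {x} {fromℚ r *ᴿ (fromℚ q *ᴿ x)} {y} (≃-pointwise {x} {fromℚ r *ᴿ (fromℚ q *ᴿ x)} (λ n → sym (undo (seq x n))))
      (≃-trans {fromℚ r *ᴿ (fromℚ q *ᴿ x)} {fromℚ r *ᴿ (fromℚ q *ᴿ y)} {y} (scale-cong r {fromℚ q *ᴿ x} {fromℚ q *ᴿ y} eq)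
        (≃-pointwise {fromℚ r *ᴿ (fromℚ q *ᴿ y)} {y} (λ n → undo (seq y n))))
    where
    r = proj₁ (reciprocal q 0<q)
    qr≡1 = proj₂ (proj₂ (reciprocal q 0<q))
    undo : ∀ a → r * (q * a) ≡ a
    undo a = trans (solve 3 (λ r q a → r :* (q :* a) := (q :* r) :* a) refl r q a)
      (trans (cong (_* a) qr≡1) (ℚₚ.*-identityˡ a))

  ⊢≤-pointwise : ∀ {x q} → (∀ n → ∣ seq x n ∣ ≤ q) → x ⊢≤ q
  ⊢≤-pointwise {x} {q} = ≤-pointwise {∣ x ∣ᴿ} {fromℚ q}

  ⊢≤-weaken : ∀ {x p q} → p ≤ q → x ⊢≤ p → x ⊢≤ q
  ⊢≤-weaken {x} {p} {q} p≤q x≤p = ≤-trans {∣ x ∣ᴿ} {fromℚ p} {fromℚ q} x≤p (fromℚ-mono p≤q)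

  ⊢≤-resp : ∀ {x y q} → x ≃ y → x ⊢≤ q → y ⊢≤ q
  ⊢≤-resp {x} {y} {q} x≃y x≤q ε 0<ε = eventually-zip
    (λ n a b → begin
      ∣ seq y n ∣                         ≡⟨ cong ∣_∣ (solve 2 (λ x y → y := x :- (x :- y)) refl (seq x n) (seq y n)) ⟩
      ∣ seq x n - (seq x n - seq y n) ∣   ≤⟨ ℚₚ.∣p-q∣≤∣p∣+∣q∣ (seq x n) (seq x n - seq y n) ⟩
      ∣ seq x n ∣ + ∣ seq x n - seq y n ∣ ≤⟨ ℚₚ.+-mono-≤ a b ⟩
      (q + ½ * ε) + ½ * ε                 ≡⟨ solve 2 (λ z ε → (z :+ con ½ :* ε) :+ con ½ :* ε := z :+ ε) refl q ε ⟩
      q + ε                               ∎)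
    (x≤q (½ * ε) (½* 0<ε)) (x≃y (½ * ε) (½* 0<ε))
    where open ℚₚ.≤-Reasoning

  ⊢≤-intro : ∀ {x q} → x ≤ᴿ fromℚ q → fromℚ (- q) ≤ᴿ x → x ⊢≤ q
  ⊢≤-intro {x} {q} x≤q -q≤x ε 0<ε = eventually-zip
    (λ n a b → ∣∣≤ a (≤-by ((seq x n + ε) - - q) (0≤q-p b)
      (solve 3 (λ q x ε → (q :+ ε) :- :- x := (x :+ ε) :- :- q) refl q (seq x n) ε)))
    (x≤q ε 0<ε) (-q≤x ε 0<ε)

  ⊢≤-+ : ∀ {x y p q} → x ⊢≤ p → y ⊢≤ q → x +ᴿ y ⊢≤ p + q
  ⊢≤-+ {x} {y} {p} {q} x≤p y≤q = ≤-trans {∣ x +ᴿ y ∣ᴿ} {∣ x ∣ᴿ +ᴿ ∣ y ∣ᴿ} {fromℚ (p + q)}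
    (≤-pointwise {∣ x +ᴿ y ∣ᴿ} {∣ x ∣ᴿ +ᴿ ∣ y ∣ᴿ} (λ n → ℚₚ.∣p+q∣≤∣p∣+∣q∣ (seq x n) (seq y n)))
    (+-mono {∣ x ∣ᴿ} {fromℚ p} {∣ y ∣ᴿ} {fromℚ q} x≤p y≤q)

  ⊢≤-* : ∀ {x y p q} → 0ℚ ≤ p → 0ℚ ≤ q → x ⊢≤ p → y ⊢≤ q → x *ᴿ y ⊢≤ p * q
  ⊢≤-* {x} {y} {p} {q} 0≤p 0≤q x≤p y≤q ε 0<ε = let (δ , 0<δ , δ≤1 , Kδ≤ε) = shrink (p + q + 1ℚ) (0≤+ (0≤+ 0≤p 0≤q) 0≤1) ε 0<ε in eventually-zip
    (λ n a b → begin
      ∣ seq x n * seq y n ∣            ≡⟨ ℚₚ.∣p*q∣≡∣p∣*∣q∣ (seq x n) (seq y n) ⟩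
      ∣ seq x n ∣ * ∣ seq y n ∣        ≤⟨ *-mono (ℚₚ.0≤∣p∣ (seq x n)) (0≤+ 0≤q (ℚₚ.<⇒≤ 0<δ)) a b ⟩
      (p + δ) * (q + δ)                ≡⟨ solve 3 (λ p q δ → (p :+ δ) :* (q :+ δ) := p :* q :+ (p :+ q :+ δ) :* δ) refl p q δ ⟩
      p * q + (p + q + δ) * δ          ≤⟨ ℚₚ.+-monoʳ-≤ (p * q) (Defs.Sequence.*-monoʳ (ℚₚ.<⇒≤ 0<δ) (ℚₚ.+-monoʳ-≤ (p + q) δ≤1)) ⟩
      p * q + (p + q + 1ℚ) * δ         ≤⟨ ℚₚ.+-monoʳ-≤ (p * q) Kδ≤ε ⟩
      p * q + ε                        ∎)
    (x≤p δ 0<δ) (y≤q δ 0<δ)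
    where open ℚₚ.≤-Reasoning

  ≃-limit : ∀ {x y} → (∀ ε → 0ℚ < ε → x -ᴿ y ⊢≤ ε) → x ≃ y
  ≃-limit {x} {y} h ε 0<ε = eventually-map
    (λ n a → ℚₚ.≤-trans a (ℚₚ.≤-reflexive (½+½ ε)))
    (h (½ * ε) (½* 0<ε) (½ * ε) (½* 0<ε))

-- The quadratic Taylor bound for exp and its continuity.

module Exponential where

  open ℤ using (+_)
  open Rational
  open Real
  open ℚ using (_+_; _*_; -_; _-_; _≤_; _<_; ∣_∣)
  open Defs.Sequence using (0≤*; *-monoˡ; *-monoʳ; *-mono; p≤∣p∣; bounded; fromNat; fromNat≥0; fromNat-*; fromNat-suc; 0≤1/; expTerm; expTerm-suc; sum)
  open +-*-Solver

  module Bounds (b : ℕ) where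

    open Defs.Sequence.Exp b using (B; T; 0≤T; E; E-cauchy; BT; term≤)
    open ℚₚ.≤-Reasoning

    private
      E-bound = bounded E E-cauchy

    abstract
      -- One constant for all arguments of absolute value at most b: it eventually dominates the
      -- partial sums of the series of e^b, hence bounds `exp` and also its second-order error.
      K : ℚ
      K = fromNat (proj₁ E-bound)

      0≤K : 0ℚ ≤ K
      0≤K = fromNat≥0 (proj₁ E-bound)

      E≤K : Eventually (λ n → E n ≤ K)
      E≤K = proj₁ (proj₂ E-bound) , λ n N≤n → ℚₚ.≤-trans (p≤∣p∣ (E n)) (proj₂ (proj₂ E-bound) n N≤n)

    Bounded : ℝ → Set
    Bounded x = Eventually (λ n → ∣ seq x n ∣ ≤ B)

    module _ {x : ℚ} (x≤B : ∣ x ∣ ≤ B) where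

      sum≤ : ∀ n → ∣ sum (expTerm x) n ∣ ≤ E n
      sum≤ zero = ℚₚ.≤-refl
      sum≤ (suc n) = ℚₚ.≤-trans (ℚₚ.∣p+q∣≤∣p∣+∣q∣ (sum (expTerm x) n) (expTerm x n))
        (ℚₚ.+-mono-≤ (sum≤ n) (term≤ x≤B x≤B n))

    module _ {x y : ℚ} (x≤B : ∣ x ∣ ≤ B) (y≤B : ∣ y ∣ ≤ B) where

      D = ∣ y - x ∣

      -- Since the derivative of x^(j+1) / (j+1)! is x^j / j!, this is the first-order Taylor
      -- remainder of the term of index j + 1.
      remainder : ℕ → ℚ
      remainder j = expTerm y (suc j) - expTerm x (suc j) - (y - x) * expTerm x j

      -- Replacing (j + 1) x^(j+1) / (j+1)! by x · x^j / j! leaves y times the previous remainder;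
      -- there (y - x) x^j / j! carries the factor y instead of x, and this mismatch supplies the
      -- second factor y - x.
      remainder-suc : ∀ j → remainder (suc j) ≡ (+ 1 / suc (suc j)) * (y * remainder j + (y - x) * (y - x) * expTerm x j)
      remainder-suc j = trans
        (cong₂ (λ a c → a - c - (y - x) * P) (expTerm-suc y (suc j)) (expTerm-suc x (suc j)))
        (trans (cong (λ a → y * i * P′ - x * i * P - (y - x) * a) (trans (sym (ℚₚ.*-identityˡ P)) (cong (_* P) (sym i·))))
        (trans (solve 6 (λ x y i n P P′ → y :* i :* P′ :- x :* i :* P :- (y :- x) :* ((con 1ℚ :+ n) :* i :* P)
                   := i :* (y :* (P′ :- P) :- (y :- x) :* (n :* P))) refl x y i n P P′)
        (trans (cong (λ a → i * (y * (P′ - P) - (y - x) * a)) nP)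
          (solve 6 (λ x y i R P P′ → i :* (y :* (P′ :- P) :- (y :- x) :* (x :* R))
                   := i :* (y :* (P′ :- P :- (y :- x) :* R) :+ (y :- x) :* (y :- x) :* R)) refl x y i R P P′))))
        where
        i = + 1 / suc (suc j)
        n = fromNat (suc j)
        P = expTerm x (suc j)
        P′ = expTerm y (suc j)
        R = expTerm x j
        i· : (1ℚ + n) * i ≡ 1ℚ
        i· = trans (cong (_* i) (sym (fromNat-suc (suc j)))) (fromNat-* (suc j))
        nP : n * P ≡ x * R
        nP = trans (cong (n *_) (expTerm-suc x j))
          (trans (solve 4 (λ n x k R → n :* (x :* k :* R) := (n :* k) :* (x :* R)) refl n x (+ 1 / suc j) R)
          (trans (cong (_* (x * R)) (fromNat-* j)) (ℚₚ.*-identityˡ (x * R))))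

      remainder-zero : remainder 0 ≡ 0ℚ
      remainder-zero = solve 2 (λ x y → (y :* con 1ℚ) :* con 1ℚ :- (x :* con 1ℚ) :* con 1ℚ :- (y :- x) :* (con 1ℚ :* con 1ℚ) := con 0ℚ) refl x y

      remainder-step : ∀ j {e} → ∣ remainder j ∣ ≤ e → ∣ remainder (suc j) ∣ ≤ (+ 1 / suc (suc j)) * (B * e + D * D * T j)
      remainder-step j {e} h = begin
        ∣ remainder (suc j) ∣                               ≡⟨ cong ∣_∣ (remainder-suc j) ⟩
        ∣ i * (y * remainder j + d * d * R) ∣               ≡⟨ ℚₚ.∣p*q∣≡∣p∣*∣q∣ i (y * remainder j + d * d * R) ⟩
        ∣ i ∣ * ∣ y * remainder j + d * d * R ∣             ≡⟨ cong (_* ∣ y * remainder j + d * d * R ∣) (ℚₚ.0≤p⇒∣p∣≡p (0≤1/ (suc (suc j)))) ⟩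
        i * ∣ y * remainder j + d * d * R ∣                 ≤⟨ *-monoˡ (0≤1/ (suc (suc j))) (ℚₚ.∣p+q∣≤∣p∣+∣q∣ (y * remainder j) (d * d * R)) ⟩
        i * (∣ y * remainder j ∣ + ∣ d * d * R ∣)           ≡⟨ cong (i *_) (cong₂ _+_ (ℚₚ.∣p*q∣≡∣p∣*∣q∣ y (remainder j))
                                                               (trans (ℚₚ.∣p*q∣≡∣p∣*∣q∣ (d * d) R) (cong (_* ∣ R ∣) (ℚₚ.∣p*q∣≡∣p∣*∣q∣ d d)))) ⟩
        i * (∣ y ∣ * ∣ remainder j ∣ + D * D * ∣ R ∣)       ≤⟨ *-monoˡ (0≤1/ (suc (suc j))) (ℚₚ.+-mono-≤
                                                               (*-mono (ℚₚ.0≤∣p∣ y) (ℚₚ.≤-trans (ℚₚ.0≤∣p∣ (remainder j)) h) y≤B h)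
                                                               (*-monoˡ (0≤* (ℚₚ.0≤∣p∣ d) (ℚₚ.0≤∣p∣ d)) (term≤ x≤B x≤B j))) ⟩
        i * (B * e + D * D * T j)                           ∎
        where
        i = + 1 / suc (suc j)
        d = y - x
        R = expTerm x j

      -- With T j = b^j / j! one has b T j + T (j + 1) = (j + 2) T (j + 1), and the factor 1 / (j +
      -- 3) of the recursion absorbs j + 2. So the bound reproduces itself.
      remainder≤ : ∀ j → ∣ remainder (suc j) ∣ ≤ D * D * T j
      remainder≤ zero = begin
        ∣ remainder 1 ∣                             ≤⟨ remainder-step 0 (ℚₚ.≤-reflexive (cong ∣_∣ remainder-zero)) ⟩
        ½ * (B * 0ℚ + D * D * T 0)                  ≡⟨ solve 2 (λ b d → con ½ :* (b :* con 0ℚ :+ d) := con ½ :* d) refl B (D * D * T 0) ⟩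
        ½ * (D * D * T 0)                           ≤⟨ *-monoʳ 0≤DDT (ℚₚ.≤ᵇ⇒≤ {½} {1ℚ} _) ⟩
        1ℚ * (D * D * T 0)                          ≡⟨ ℚₚ.*-identityˡ (D * D * T 0) ⟩
        D * D * T 0                                 ∎
        where
        0≤DDT : 0ℚ ≤ D * D * T 0
        0≤DDT = 0≤* (0≤* (ℚₚ.0≤∣p∣ (y - x)) (ℚₚ.0≤∣p∣ (y - x))) (0≤T 0)
      remainder≤ (suc j) = begin
        ∣ remainder (suc (suc j)) ∣                        ≤⟨ remainder-step (suc j) (remainder≤ j) ⟩
        i * (B * (D * D * T j) + D * D * T (suc j))        ≡⟨ solve 5 (λ i b d t u → i :* (b :* (d :* t) :+ d :* u) := i :* (d :* (b :* t :+ u))) refl i B (D * D) (T j) (T (suc j)) ⟩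
        i * (D * D * (B * T j + T (suc j)))                ≡⟨ cong (λ a → i * (D * D * (a + T (suc j)))) (BT {x} {y} x≤B y≤B j) ⟩
        i * (D * D * (n * T (suc j) + T (suc j)))          ≡⟨ solve 4 (λ i d n u → i :* (d :* (n :* u :+ u)) := ((con 1ℚ :+ n) :* i) :* (d :* u)) refl i (D * D) n (T (suc j)) ⟩
        ((1ℚ + n) * i) * (D * D * T (suc j))               ≤⟨ *-monoʳ (0≤* (0≤* (ℚₚ.0≤∣p∣ (y - x)) (ℚₚ.0≤∣p∣ (y - x))) (0≤T (suc j))) n·i≤1 ⟩
        1ℚ * (D * D * T (suc j))                           ≡⟨ ℚₚ.*-identityˡ (D * D * T (suc j)) ⟩
        D * D * T (suc j)                                  ∎
        where
        i = + 1 / suc (suc (suc j))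
        n = fromNat (suc j)
        n·i≤1 : (1ℚ + n) * i ≤ 1ℚ
        n·i≤1 = subst₂ _≤_ (cong (_* i) (fromNat-suc (suc j))) (fromNat-* (suc (suc j)))
          (*-monoʳ (0≤1/ (suc (suc (suc j)))) (Defs.Sequence.fromNat-mono (ℕₚ.n≤1+n (suc (suc j)))))

      -- Differentiation shifts the series by one: m + 2 terms at both arguments go with m + 1 terms
      -- of the derivative. What is left are the remainders of the terms of index 2 to m + 1,
      -- bounded by T 0 to T (m - 1).
      taylorSum : ∀ m → ∣ sum (expTerm y) (suc (suc m)) - sum (expTerm x) (suc (suc m)) - (y - x) * sum (expTerm x) (suc m) ∣ ≤ D * D * E m
      taylorSum zero = ℚₚ.≤-reflexive (trans
        (cong ∣_∣ (solve 2 (λ x y → (con 0ℚ :+ con 1ℚ :+ (y :* con 1ℚ) :* con 1ℚ) :- (con 0ℚ :+ con 1ℚ :+ (x :* con 1ℚ) :* con 1ℚ)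
           :- (y :- x) :* (con 0ℚ :+ con 1ℚ) := con 0ℚ) refl x y))
        (sym (ℚₚ.*-zeroʳ (D * D))))
      taylorSum (suc m) = begin
        ∣ (Y + p) - (X + q) - (y - x) * (X′ + q′) ∣   ≡⟨ cong ∣_∣ (solve 7 (λ Y p X q d X′ q′ → (Y :+ p) :- (X :+ q) :- d :* (X′ :+ q′)
                                                           := (Y :- X :- d :* X′) :+ (p :- q :- d :* q′)) refl Y p X q (y - x) X′ q′) ⟩
        ∣ (Y - X - (y - x) * X′) + (p - q - (y - x) * q′) ∣   ≤⟨ ℚₚ.∣p+q∣≤∣p∣+∣q∣ (Y - X - (y - x) * X′) (p - q - (y - x) * q′) ⟩
        ∣ Y - X - (y - x) * X′ ∣ + ∣ p - q - (y - x) * q′ ∣   ≤⟨ ℚₚ.+-mono-≤ (taylorSum m) (remainder≤ m) ⟩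
        D * D * E m + D * D * T m                     ≡⟨ ℚₚ.*-distribˡ-+ (D * D) (E m) (T m) ⟨
        D * D * (E m + T m)                           ∎
        where
        Y = sum (expTerm y) (suc (suc m))
        X = sum (expTerm x) (suc (suc m))
        X′ = sum (expTerm x) (suc m)
        p = expTerm y (suc (suc m))
        q = expTerm x (suc (suc m))
        q′ = expTerm x (suc m)

    exp-bounded : ∀ {x} → Bounded x → exp x ⊢≤ K
    exp-bounded {x} x≤B ε 0<ε = eventually-zip
      (λ n a e → ℚₚ.≤-trans (sum≤ a n) (ℚₚ.≤-trans e (≤-by ε (ℚₚ.<⇒≤ 0<ε) (solve 2 (λ K ε → (K :+ ε) :- K := ε) refl K ε))))
      x≤B E≤K

    -- The terms are differences of consecutive partial sums of a Cauchy sequence.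
    T-small : ∀ δ → 0ℚ < δ → Eventually (λ n → T n ≤ δ)
    T-small δ 0<δ = proj₁ (E-cauchy δ 0<δ) , λ n N≤n → begin
      T n                   ≡⟨ solve 2 (λ e t → t := (e :+ t) :- e) refl (E n) (T n) ⟩
      E (suc n) - E n       ≤⟨ p≤∣p∣ (E (suc n) - E n) ⟩
      ∣ E (suc n) - E n ∣   ≤⟨ proj₂ (E-cauchy δ 0<δ) (suc n) n (ℕₚ.m≤n⇒m≤1+n N≤n) N≤n ⟩
      δ                     ∎

    private
      -- `exp` takes the same number of terms in all three places, so the sum acting as derivative
      -- has one term t more than in `taylorSum`; that term is at most δ. Expanding K (d + δ)² + (d
      -- + δ) δ with δ ≤ 1 gives the coefficient of δ.
      stage : ∀ {x y d δ} → 0ℚ ≤ d → 0ℚ < δ → δ ≤ 1ℚ → ∣ x ∣ ≤ B → ∣ y ∣ ≤ B → ∣ y - x ∣ ≤ d + δ → ∀ m → E m ≤ K → T (suc m) ≤ δ →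
        ∣ sum (expTerm y) (suc (suc m)) - sum (expTerm x) (suc (suc m)) - (y - x) * sum (expTerm x) (suc (suc m)) ∣
          ≤ K * (d * d) + (K * d + K * d + K + d + 1ℚ) * δ
      stage {x} {y} {d} {δ} 0≤d 0<δ δ≤1 x≤B y≤B D≤ m E≤ T≤ = begin
        ∣ Y - X - (y - x) * (X′ + t) ∣                ≡⟨ cong ∣_∣ (solve 5 (λ Y X d X′ t → Y :- X :- d :* (X′ :+ t) := (Y :- X :- d :* X′) :- d :* t) refl Y X (y - x) X′ t) ⟩
        ∣ (Y - X - (y - x) * X′) - (y - x) * t ∣      ≤⟨ ℚₚ.∣p-q∣≤∣p∣+∣q∣ (Y - X - (y - x) * X′) ((y - x) * t) ⟩
        ∣ Y - X - (y - x) * X′ ∣ + ∣ (y - x) * t ∣    ≤⟨ ℚₚ.+-mono-≤ (ℚₚ.≤-trans (taylorSum x≤B y≤B m)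
                                                            (*-mono (0≤* (ℚₚ.0≤∣p∣ (y - x)) (ℚₚ.0≤∣p∣ (y - x))) 0≤K
                                                              (*-mono (ℚₚ.0≤∣p∣ (y - x)) 0≤dδ D≤ D≤) E≤))
                                                         (ℚₚ.≤-trans (ℚₚ.≤-reflexive (ℚₚ.∣p*q∣≡∣p∣*∣q∣ (y - x) t))
                                                            (*-mono (ℚₚ.0≤∣p∣ (y - x)) (ℚₚ.<⇒≤ 0<δ) D≤ (ℚₚ.≤-trans (term≤ x≤B x≤B (suc m)) T≤))) ⟩
        (d + δ) * (d + δ) * K + (d + δ) * δ           ≡⟨ solve 3 (λ d δ K → (d :+ δ) :* (d :+ δ) :* K :+ (d :+ δ) :* δ
                                                            := K :* (d :* d) :+ (K :* d :+ K :* d :+ K :* δ :+ d :+ δ) :* δ) refl d δ K ⟩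
        K * (d * d) + (K * d + K * d + K * δ + d + δ) * δ   ≤⟨ ℚₚ.+-monoʳ-≤ (K * (d * d)) (*-monoʳ (ℚₚ.<⇒≤ 0<δ)
                                                            (ℚₚ.+-mono-≤ (ℚₚ.+-monoˡ-≤ d (ℚₚ.+-monoʳ-≤ (K * d + K * d)
                                                              (ℚₚ.≤-trans (*-monoˡ 0≤K δ≤1) (ℚₚ.≤-reflexive (ℚₚ.*-identityʳ K))))) δ≤1)) ⟩
        K * (d * d) + (K * d + K * d + K + d + 1ℚ) * δ      ∎
        where
        Y = sum (expTerm y) (suc (suc m))
        X = sum (expTerm x) (suc (suc m))
        X′ = sum (expTerm x) (suc m)
        t = expTerm x (suc m)
        0≤dδ : 0ℚ ≤ d + δ
        0≤dδ = 0≤+ 0≤d (ℚₚ.<⇒≤ 0<δ)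

    taylor : ∀ {x y d} → 0ℚ ≤ d → Bounded x → Bounded y → y -ᴿ x ⊢≤ d →
             exp y -ᴿ exp x -ᴿ (y -ᴿ x) *ᴿ exp x ⊢≤ K * (d * d)
    taylor {x} {y} {d} 0≤d x≤B y≤B y-x≤d ε 0<ε =
      let (δ , 0<δ , δ≤1 , Cδ≤ε) = shrink (K * d + K * d + K + d + 1ℚ)
                                   (0≤+ (0≤+ (0≤+ (0≤+ (0≤* 0≤K 0≤d) (0≤* 0≤K 0≤d)) 0≤K) 0≤d) 0≤1) ε 0<ε
          (N , h) = eventually-zip (λ _ → _,_) (eventually-zip (λ _ → _,_) x≤B y≤B)
                      (eventually-zip (λ _ → _,_) (y-x≤d δ 0<δ) (eventually-zip (λ _ → _,_) E≤K (T-small δ 0<δ)))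
      -- The approximation of index m + 2 uses the bound on `E` at m and the bound on `T` at m + 1,
      -- hence the shift by two.
      in suc (suc N) , λ where
        (suc (suc m)) (ℕ.s≤s (ℕ.s≤s N≤m)) →
          let N≤1+m = ℕₚ.m≤n⇒m≤1+n N≤m
              ((x≤ , y≤) , (D≤ , _)) = h (suc (suc m)) (ℕₚ.m≤n⇒m≤1+n N≤1+m)
              (_ , (_ , (E≤ , _))) = h m N≤m
              (_ , (_ , (_ , T≤))) = h (suc m) N≤1+m
          in ℚₚ.≤-trans (stage 0≤d 0<δ δ≤1 x≤ y≤ D≤ m E≤ T≤) (ℚₚ.+-monoʳ-≤ (K * (d * d)) Cδ≤ε)

  bounded-by : ∀ x → ∃[ b ] Bounds.Bounded b x
  bounded-by x = bounded (seq x) (isCauchy x)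

  Bounded-mono : ∀ {b b′} x → b ℕ.≤ b′ → Bounds.Bounded b x → Bounds.Bounded b′ x
  Bounded-mono x b≤b′ = eventually-map λ n x≤ → ℚₚ.≤-trans x≤ (Defs.Sequence.fromNat-mono b≤b′)

  module _ {b : ℕ} where

    open Bounds b

    lipschitz : ∀ {x y d} → 0ℚ ≤ d → Bounded x → Bounded y → y -ᴿ x ⊢≤ d → exp y -ᴿ exp x ⊢≤ K * (d * d) + d * K
    lipschitz {x} {y} {d} 0≤d xB yB y-x≤d = ⊢≤-resp {r +ᴿ l} {exp y -ᴿ exp x} {K * (d * d) + d * K}
      (≃-pointwise {r +ᴿ l} {exp y -ᴿ exp x} (λ n →
        solve 2 (λ u v → (u :- v) :+ v := u) refl (seq (exp y -ᴿ exp x) n) (seq l n)))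
      (⊢≤-+ {r} {l} {K * (d * d)} {d * K} (taylor {x} {y} {d} 0≤d xB yB y-x≤d)
              (⊢≤-* {y -ᴿ x} {exp x} {d} {K} 0≤d 0≤K y-x≤d (exp-bounded {x} xB)))
      where
      l = (y -ᴿ x) *ᴿ exp x
      r = exp y -ᴿ exp x -ᴿ l

  -- `exp` evaluates its series at the n-th approximation, and equal reals may differ at every n. So
  -- congruence is a continuity statement; it follows from the Taylor bound, whose linear and
  -- quadratic parts are together at most 2 K d for d ≤ 1.
  exp-cong : ∀ {x y} → x ≃ y → exp x ≃ exp y
  exp-cong {x} {y} x≃y = ≃-sym {exp y} {exp x} (≃-limit {exp y} {exp x} close)
    where
    bx = bounded-by x
    by = bounded-by y
    b = proj₁ bx ℕ.+ proj₁ by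
    open Bounds b
    difference : ∀ d → 0ℚ ≤ d → y -ᴿ x ⊢≤ d
    difference d 0≤d ε 0<ε = eventually-map (λ n a → ℚₚ.≤-trans a (≤-by d 0≤d (solve 2 (λ d ε → (d :+ ε) :- ε := d) refl d ε)))
      (≃-sym {x} {y} x≃y ε 0<ε)
    close : ∀ ε → 0ℚ < ε → exp y -ᴿ exp x ⊢≤ ε
    close ε 0<ε =
      let (d , 0<d , d≤1 , Cd≤ε) = shrink (K + K) (0≤+ 0≤K 0≤K) ε 0<ε
          0≤d = ℚₚ.<⇒≤ 0<d
      in ⊢≤-weaken {exp y -ᴿ exp x} {K * (d * d) + d * K} {ε}
           (ℚₚ.≤-trans (≤-by (K * (d * (1ℚ - d))) (0≤* 0≤K (0≤* 0≤d (0≤q-p d≤1)))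
              (solve 2 (λ K d → (K :+ K) :* d :- (K :* (d :* d) :+ d :* K) := K :* (d :* (con 1ℚ :- d))) refl K d)) Cd≤ε)
           (lipschitz {b} {x} {y} {d} 0≤d (Bounded-mono x (ℕₚ.m≤m+n (proj₁ bx) (proj₁ by)) (proj₂ bx))
              (Bounded-mono y (ℕₚ.m≤n+m (proj₁ by) (proj₁ bx)) (proj₂ by)) (difference d 0≤d))

-- Bounds for the increments of the logarithm from the artanh series.

module Logarithm where

  open import Algebra.Definitions.RawSemiring ℚ.+-*-rawSemiring using (_^_)
  open ℤ using (+_)
  open Rational
  open Real
  open ℚ using (_+_; _*_; -_; _-_; _≤_; _<_; ∣_∣)
  open Defs using (log)
  open Defs.Sequence using (0<*; 0≤*; 0<1; *-monoˡ; *-monoʳ; *-mono; fromNat; fromNat-*; fromNat-suc; 0≤1/; artanhTerm; sum; mobius; mobius²<1; module Geometric)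
  open +-*-Solver

  module _ {z : ℚ} (0≤z : 0ℚ ≤ z) where

    ^-nonneg : ∀ m → 0ℚ ≤ z ^ m
    ^-nonneg zero = 0≤1
    ^-nonneg (suc m) = 0≤* 0≤z (^-nonneg m)

  ^-mono : ∀ {w z} → 0ℚ ≤ w → w ≤ z → ∀ m → w ^ m ≤ z ^ m
  ^-mono 0≤w w≤z zero = ℚₚ.≤-refl
  ^-mono 0≤w w≤z (suc m) = *-mono 0≤w (^-nonneg (ℚₚ.≤-trans 0≤w w≤z) m) w≤z (^-mono 0≤w w≤z m)

  ^-even : ∀ z j → z ^ (2 ℕ.* j) ≡ (z * z) ^ j
  ^-even z zero = refl
  ^-even z (suc j) = trans (cong (z ^_) (ℕₚ.*-suc 2 j)) (trans (sym (ℚₚ.*-assoc z z (z ^ (2 ℕ.* j)))) (cong (z * z *_) (^-even z j)))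

  module Difference {w z : ℚ} (0≤w : 0ℚ ≤ w) (w≤z : w ≤ z) where

    open ℚₚ.≤-Reasoning

    0≤z : 0ℚ ≤ z
    0≤z = ℚₚ.≤-trans 0≤w w≤z

    -- The mean value bound for powers, by induction. For m = 2j the factor 2j + 1 cancels the
    -- denominator of the artanh term and leaves a geometric series of ratio z².
    ^-upper : ∀ m → z ^ suc m - w ^ suc m ≤ fromNat (suc m) * ((z - w) * z ^ m)
    ^-upper zero = ℚₚ.≤-reflexive (solve 2 (λ z w → z :* con 1ℚ :- w :* con 1ℚ := con 1ℚ :* ((z :- w) :* con 1ℚ)) refl z w)
    ^-upper (suc m) = begin
      z * z ^ suc m - w * w ^ suc m                              ≡⟨ solve 4 (λ z w a b → z :* a :- w :* b := z :* (a :- b) :+ (z :- w) :* b) refl z w (z ^ suc m) (w ^ suc m) ⟩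
      z * (z ^ suc m - w ^ suc m) + (z - w) * w ^ suc m          ≤⟨ ℚₚ.+-mono-≤ (*-monoˡ 0≤z (^-upper m)) (*-monoˡ (0≤q-p w≤z) (^-mono 0≤w w≤z (suc m))) ⟩
      z * (n * ((z - w) * z ^ m)) + (z - w) * (z * z ^ m)        ≡⟨ solve 4 (λ z w n a → z :* (n :* ((z :- w) :* a)) :+ (z :- w) :* (z :* a)
                                                                      := (con 1ℚ :+ n) :* ((z :- w) :* (z :* a))) refl z w n (z ^ m) ⟩
      (1ℚ + n) * ((z - w) * z ^ suc m)                           ≡⟨ cong (_* ((z - w) * z ^ suc m)) (fromNat-suc (suc m)) ⟨
      fromNat (suc (suc m)) * ((z - w) * z ^ suc m)              ∎
      where n = fromNat (suc m)

    ^-lower : ∀ m → fromNat (suc m) * ((z - w) * w ^ m) ≤ z ^ suc m - w ^ suc m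
    ^-lower zero = ℚₚ.≤-reflexive (solve 2 (λ z w → con 1ℚ :* ((z :- w) :* con 1ℚ) := z :* con 1ℚ :- w :* con 1ℚ) refl z w)
    ^-lower (suc m) = begin
      fromNat (suc (suc m)) * ((z - w) * w ^ suc m)              ≡⟨ cong (_* ((z - w) * w ^ suc m)) (fromNat-suc (suc m)) ⟩
      (1ℚ + n) * ((z - w) * w ^ suc m)                           ≡⟨ solve 4 (λ z w n a → (con 1ℚ :+ n) :* ((z :- w) :* (w :* a))
                                                                      := w :* (n :* ((z :- w) :* a)) :+ (z :- w) :* (w :* a)) refl z w n (w ^ m) ⟩
      w * (n * ((z - w) * w ^ m)) + (z - w) * (w ^ suc m)        ≤⟨ ℚₚ.+-mono-≤ (*-monoˡ 0≤w (^-lower m)) (*-monoˡ (0≤q-p w≤z) (^-mono 0≤w w≤z (suc m))) ⟩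
      w * (z ^ suc m - w ^ suc m) + (z - w) * z ^ suc m          ≡⟨ solve 4 (λ z w a b → w :* (a :- b) :+ (z :- w) :* a := z :* a :- w :* b) refl z w (z ^ suc m) (w ^ suc m) ⟩
      z * z ^ suc m - w * w ^ suc m                              ∎
      where n = fromNat (suc m)

    private
      i : ℕ → ℚ
      i j = + 1 / suc (2 ℕ.* j)

      divide : ∀ j a → fromNat (suc (2 ℕ.* j)) * a * i j ≡ a
      divide j a = trans (solve 3 (λ n a i → n :* a :* i := (n :* i) :* a) refl (fromNat (suc (2 ℕ.* j))) a (i j))
        (trans (cong (_* a) (fromNat-* (2 ℕ.* j))) (ℚₚ.*-identityˡ a))

      distrib : ∀ j → artanhTerm z j - artanhTerm w j ≡ (z ^ suc (2 ℕ.* j) - w ^ suc (2 ℕ.* j)) * i j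
      distrib j = solve 3 (λ a b i → a :* i :- b :* i := (a :- b) :* i) refl (z ^ suc (2 ℕ.* j)) (w ^ suc (2 ℕ.* j)) (i j)

    term-upper : ∀ j → artanhTerm z j - artanhTerm w j ≤ (z - w) * (z * z) ^ j
    term-upper j = begin
      artanhTerm z j - artanhTerm w j                                ≡⟨ distrib j ⟩
      (z ^ suc (2 ℕ.* j) - w ^ suc (2 ℕ.* j)) * i j                  ≤⟨ *-monoʳ (0≤1/ (suc (2 ℕ.* j))) (^-upper (2 ℕ.* j)) ⟩
      fromNat (suc (2 ℕ.* j)) * ((z - w) * z ^ (2 ℕ.* j)) * i j      ≡⟨ divide j ((z - w) * z ^ (2 ℕ.* j)) ⟩
      (z - w) * z ^ (2 ℕ.* j)                                        ≡⟨ cong ((z - w) *_) (^-even z j) ⟩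
      (z - w) * (z * z) ^ j                                          ∎

    term-lower : ∀ j → (z - w) * (w * w) ^ j ≤ artanhTerm z j - artanhTerm w j
    term-lower j = begin
      (z - w) * (w * w) ^ j                                          ≡⟨ cong ((z - w) *_) (^-even w j) ⟨
      (z - w) * w ^ (2 ℕ.* j)                                        ≡⟨ divide j ((z - w) * w ^ (2 ℕ.* j)) ⟨
      fromNat (suc (2 ℕ.* j)) * ((z - w) * w ^ (2 ℕ.* j)) * i j      ≤⟨ *-monoʳ (0≤1/ (suc (2 ℕ.* j))) (^-lower (2 ℕ.* j)) ⟩
      (z ^ suc (2 ℕ.* j) - w ^ suc (2 ℕ.* j)) * i j                  ≡⟨ distrib j ⟨
      artanhTerm z j - artanhTerm w j                                ∎

    Δ : ℕ → ℚ
    Δ n = sum (artanhTerm z) n - sum (artanhTerm w) n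

    Δ-suc : ∀ n → Δ (suc n) ≡ Δ n + (artanhTerm z n - artanhTerm w n)
    Δ-suc n = solve 4 (λ a b c d → (a :+ b) :- (c :+ d) := (a :- c) :+ (b :- d)) refl
      (sum (artanhTerm z) n) (artanhTerm z n) (sum (artanhTerm w) n) (artanhTerm w n)

    Δ-nonneg : ∀ n → 0ℚ ≤ Δ n
    Δ-nonneg zero = ℚₚ.≤-refl
    Δ-nonneg (suc n) = subst (0ℚ ≤_) (sym (Δ-suc n)) (0≤+ (Δ-nonneg n)
      (ℚₚ.≤-trans (0≤* (0≤q-p w≤z) (^-nonneg (0≤* 0≤w 0≤w) n)) (term-lower n)))

    -- The bounds of the single terms form a geometric series of ratio z²; multiplication by 1 - z²
    -- telescopes it.
    sum-upper : z * z ≤ 1ℚ → ∀ n → Δ n * (1ℚ - z * z) ≤ (z - w) * (1ℚ - (z * z) ^ n)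
    sum-upper zz≤1 zero = ℚₚ.≤-reflexive (solve 2 (λ z w → (con 0ℚ :- con 0ℚ) :* (con 1ℚ :- z :* z) := (z :- w) :* (con 1ℚ :- con 1ℚ)) refl z w)
    sum-upper zz≤1 (suc n) = begin
      Δ (suc n) * (1ℚ - z * z)                                        ≡⟨ cong (_* (1ℚ - z * z)) (Δ-suc n) ⟩
      (Δ n + (artanhTerm z n - artanhTerm w n)) * (1ℚ - z * z)        ≡⟨ ℚₚ.*-distribʳ-+ (1ℚ - z * z) (Δ n) (artanhTerm z n - artanhTerm w n) ⟩
      Δ n * (1ℚ - z * z) + (artanhTerm z n - artanhTerm w n) * (1ℚ - z * z)   ≤⟨ ℚₚ.+-mono-≤ (sum-upper zz≤1 n) (*-monoʳ (0≤q-p zz≤1) (term-upper n)) ⟩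
      (z - w) * (1ℚ - (z * z) ^ n) + (z - w) * (z * z) ^ n * (1ℚ - z * z)     ≡⟨ solve 3 (λ d u v → d :* (con 1ℚ :- v) :+ d :* v :* (con 1ℚ :- u)
                                                                           := d :* (con 1ℚ :- u :* v)) refl (z - w) (z * z) ((z * z) ^ n) ⟩
      (z - w) * (1ℚ - (z * z) ^ suc n)                                ∎

    sum-lower : w * w ≤ 1ℚ → ∀ n → (z - w) * (1ℚ - (w * w) ^ n) ≤ Δ n * (1ℚ - w * w)
    sum-lower ww≤1 zero = ℚₚ.≤-reflexive (solve 2 (λ z w → (z :- w) :* (con 1ℚ :- con 1ℚ) := (con 0ℚ :- con 0ℚ) :* (con 1ℚ :- w :* w)) refl z w)
    sum-lower ww≤1 (suc n) = begin
      (z - w) * (1ℚ - (w * w) ^ suc n)                                ≡⟨ solve 3 (λ d u v → d :* (con 1ℚ :- u :* v)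
                                                                           := d :* (con 1ℚ :- v) :+ d :* v :* (con 1ℚ :- u)) refl (z - w) (w * w) ((w * w) ^ n) ⟩
      (z - w) * (1ℚ - (w * w) ^ n) + (z - w) * (w * w) ^ n * (1ℚ - w * w)     ≤⟨ ℚₚ.+-mono-≤ (sum-lower ww≤1 n) (*-monoʳ (0≤q-p ww≤1) (term-lower n)) ⟩
      Δ n * (1ℚ - w * w) + (artanhTerm z n - artanhTerm w n) * (1ℚ - w * w)   ≡⟨ ℚₚ.*-distribʳ-+ (1ℚ - w * w) (Δ n) (artanhTerm z n - artanhTerm w n) ⟨
      (Δ n + (artanhTerm z n - artanhTerm w n)) * (1ℚ - w * w)        ≡⟨ cong (_* (1ℚ - w * w)) (Δ-suc n) ⟨
      Δ (suc n) * (1ℚ - w * w)                                        ∎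

  2ℚ : ℚ
  2ℚ = + 2 / 1

  module Bracket {p q z w : ℚ} (1≤q : 1ℚ ≤ q) (q≤p : q ≤ p) (z· : z * (p + 1ℚ) ≡ p - 1ℚ) (w· : w * (q + 1ℚ) ≡ q - 1ℚ) where

    open ℚₚ.≤-Reasoning

    1≤p = ℚₚ.≤-trans 1≤q q≤p
    0<q = ℚₚ.<-≤-trans 0<1 1≤q
    0<p = ℚₚ.<-≤-trans 0<1 1≤p
    0<p+1 : 0ℚ < p + 1ℚ
    0<p+1 = ℚₚ.+-mono-< 0<p 0<1
    0<q+1 : 0ℚ < q + 1ℚ
    0<q+1 = ℚₚ.+-mono-< 0<q 0<1
    0≤p+1 = ℚₚ.<⇒≤ 0<p+1
    0≤q+1 = ℚₚ.<⇒≤ 0<q+1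
    0≤p = ℚₚ.<⇒≤ 0<p
    0≤q = ℚₚ.<⇒≤ 0<q

    0≤w : 0ℚ ≤ w
    0≤w = cancelˡ-≤ 0<q+1 (≤-by (q - 1ℚ) (0≤q-p 1≤q)
      (trans (cong (_- (q + 1ℚ) * 0ℚ) (trans (ℚₚ.*-comm (q + 1ℚ) w) w·)) (solve 1 (λ q → (q :- con 1ℚ) :- (q :+ con 1ℚ) :* con 0ℚ := q :- con 1ℚ) refl q)))

    z-w : (z - w) * ((p + 1ℚ) * (q + 1ℚ)) ≡ 2ℚ * (p - q)
    z-w = trans (solve 4 (λ z w p q → (z :- w) :* (p :* q) := (z :* p) :* q :- (w :* q) :* p) refl z w (p + 1ℚ) (q + 1ℚ))
      (trans (cong₂ (λ a b → a * (q + 1ℚ) - b * (p + 1ℚ)) z· w·)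
        (solve 2 (λ p q → (p :- con 1ℚ) :* (q :+ con 1ℚ) :- (q :- con 1ℚ) :* (p :+ con 1ℚ) := con 2ℚ :* (p :- q)) refl p q))

    w≤z : w ≤ z
    w≤z = cancelˡ-≤ (0<* 0<p+1 0<q+1) (≤-by (2ℚ * (p - q)) (0≤* (ℚₚ.≤ᵇ⇒≤ {0ℚ} {2ℚ} _) (0≤q-p q≤p))
      (trans (solve 3 (λ z w m → m :* z :- m :* w := (z :- w) :* m) refl z w ((p + 1ℚ) * (q + 1ℚ))) z-w))

    1-z² : ∀ {p z} → z * (p + 1ℚ) ≡ p - 1ℚ → (1ℚ - z * z) * ((p + 1ℚ) * (p + 1ℚ)) ≡ 2ℚ * 2ℚ * p
    1-z² {p} {z} z· = trans (solve 2 (λ z p → (con 1ℚ :- z :* z) :* (p :* p) := p :* p :- (z :* p) :* (z :* p)) refl z (p + 1ℚ))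
      (trans (cong (λ a → (p + 1ℚ) * (p + 1ℚ) - a * a) z·)
        (solve 1 (λ p → (p :+ con 1ℚ) :* (p :+ con 1ℚ) :- (p :- con 1ℚ) :* (p :- con 1ℚ) := con 2ℚ :* con 2ℚ :* p) refl p))

    open Difference 0≤w w≤z public

    0≤2 : 0ℚ ≤ 2ℚ
    0≤2 = ℚₚ.≤ᵇ⇒≤ _

    cross : q * (p + 1ℚ) ≤ p * (q + 1ℚ)
    cross = ≤-by (p - q) (0≤q-p q≤p) (solve 2 (λ p q → p :* (q :+ con 1ℚ) :- q :* (p :+ con 1ℚ) := p :- q) refl p q)

    -- Twice the geometric bound is 2 (z - w) / (1 - z²). Inserting z - w = 2 (p - q) / ((p + 1) (q
    -- + 1)) and 1 - z² = 4p / (p + 1)² turns it into (p - q) (p + 1) / (p (q + 1)), at most (p - q)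
    -- / q by `cross`. The chain clears denominators with the positive factor m.
    upper : z * z ≤ 1ℚ → ∀ n → q * (2ℚ * Δ n) ≤ p - q
    upper zz≤1 n = cancelˡ-≤ 0<m (begin
      m * (q * (2ℚ * Δ n))                                        ≡⟨ solve 4 (λ p q p′ D → (con 2ℚ :* p :* (p′ :* q)) :* D := D :* (con 2ℚ :* p) :* (p′ :* q)) refl p (q + 1ℚ) (p + 1ℚ) (q * (2ℚ * Δ n)) ⟩
      q * (2ℚ * Δ n) * (2ℚ * p) * ((p + 1ℚ) * (q + 1ℚ))           ≡⟨ solve 4 (λ p q q′ D → q :* (con 2ℚ :* D) :* (con 2ℚ :* p) :* ((p :+ con 1ℚ) :* q′)
                                                                       := (q :* (p :+ con 1ℚ) :* q′) :* (D :* (con 2ℚ :* con 2ℚ :* p))) refl p q (q + 1ℚ) (Δ n) ⟩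
      q * (p + 1ℚ) * (q + 1ℚ) * (Δ n * (2ℚ * 2ℚ * p))             ≡⟨ cong (λ a → q * (p + 1ℚ) * (q + 1ℚ) * (Δ n * a)) (1-z² {p} {z} z·) ⟨
      q * (p + 1ℚ) * (q + 1ℚ) * (Δ n * ((1ℚ - z * z) * ((p + 1ℚ) * (p + 1ℚ))))   ≡⟨ solve 5 (λ q p′ q′ D v → q :* p′ :* q′ :* (D :* (v :* (p′ :* p′)))
                                                                       := (q :* p′ :* q′ :* (p′ :* p′)) :* (D :* v)) refl q (p + 1ℚ) (q + 1ℚ) (Δ n) (1ℚ - z * z) ⟩
      q * (p + 1ℚ) * (q + 1ℚ) * ((p + 1ℚ) * (p + 1ℚ)) * (Δ n * (1ℚ - z * z))     ≤⟨ *-monoˡ (0≤* (0≤* (0≤* 0≤q 0≤p+1) 0≤q+1) (0≤* 0≤p+1 0≤p+1)) (ℚₚ.≤-trans (sum-upper zz≤1 n) drop) ⟩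
      q * (p + 1ℚ) * (q + 1ℚ) * ((p + 1ℚ) * (p + 1ℚ)) * (z - w)   ≡⟨ solve 4 (λ q p′ q′ d → q :* p′ :* q′ :* (p′ :* p′) :* d
                                                                       := q :* p′ :* p′ :* (d :* (p′ :* q′))) refl q (p + 1ℚ) (q + 1ℚ) (z - w) ⟩
      q * (p + 1ℚ) * (p + 1ℚ) * ((z - w) * ((p + 1ℚ) * (q + 1ℚ)))  ≡⟨ cong (q * (p + 1ℚ) * (p + 1ℚ) *_) z-w ⟩
      q * (p + 1ℚ) * (p + 1ℚ) * (2ℚ * (p - q))                    ≤⟨ *-monoʳ (0≤* 0≤2 (0≤q-p q≤p)) (*-monoʳ 0≤p+1 cross) ⟩
      p * (q + 1ℚ) * (p + 1ℚ) * (2ℚ * (p - q))                    ≡⟨ solve 4 (λ p q′ p′ d → p :* q′ :* p′ :* (con 2ℚ :* d) := (con 2ℚ :* p :* (p′ :* q′)) :* d) refl p (q + 1ℚ) (p + 1ℚ) (p - q) ⟩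
      m * (p - q)                                                 ∎)
      where
      m = 2ℚ * p * ((p + 1ℚ) * (q + 1ℚ))
      0<m : 0ℚ < m
      0<m = 0<* (0<* (ℚₚ.positive⁻¹ 2ℚ) 0<p) (0<* 0<p+1 0<q+1)
      drop : (z - w) * (1ℚ - (z * z) ^ n) ≤ z - w
      drop = ≤-by ((z - w) * (z * z) ^ n) (0≤* (0≤q-p w≤z) (^-nonneg (0≤* 0≤z 0≤z) n))
        (solve 2 (λ d v → d :- d :* (con 1ℚ :- v) := d :* v) refl (z - w) ((z * z) ^ n))

    -- Mirror image of `upper` with 1 - w² = 4q / (q + 1)²: the full geometric series gives (p - q)
    -- (q + 1) / (q (p + 1)) ≥ (p - q) / p. Its first n terms reach only the fraction 1 - w^(2n) of
    -- that.
    lower : w * w ≤ 1ℚ → ∀ n → (w * w) ^ n ≤ 1ℚ → (p - q) * (1ℚ - (w * w) ^ n) ≤ p * (2ℚ * Δ n)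
    lower ww≤1 n wn≤1 = cancelˡ-≤ 0<m (begin
      m * ((p - q) * e)                                           ≡⟨ solve 5 (λ q q′ p′ d e → (con 2ℚ :* q :* (p′ :* q′)) :* (d :* e) := (q :* p′) :* (q′ :* (con 2ℚ :* d) :* e)) refl q (q + 1ℚ) (p + 1ℚ) (p - q) e ⟩
      q * (p + 1ℚ) * ((q + 1ℚ) * (2ℚ * (p - q)) * e)              ≤⟨ *-monoʳ (0≤* (0≤* 0≤q+1 (0≤* 0≤2 (0≤q-p q≤p))) (0≤q-p wn≤1)) cross ⟩
      p * (q + 1ℚ) * ((q + 1ℚ) * (2ℚ * (p - q)) * e)              ≡⟨ cong (λ a → p * (q + 1ℚ) * ((q + 1ℚ) * a * e)) z-w ⟨
      p * (q + 1ℚ) * ((q + 1ℚ) * ((z - w) * ((p + 1ℚ) * (q + 1ℚ))) * e)   ≡⟨ solve 5 (λ p q′ p′ d e → p :* q′ :* (q′ :* (d :* (p′ :* q′)) :* e)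
                                                                       := p :* q′ :* (q′ :* (p′ :* q′)) :* (d :* e)) refl p (q + 1ℚ) (p + 1ℚ) (z - w) e ⟩
      p * (q + 1ℚ) * ((q + 1ℚ) * ((p + 1ℚ) * (q + 1ℚ))) * ((z - w) * e)   ≤⟨ *-monoˡ (0≤* (0≤* 0≤p 0≤q+1) (0≤* 0≤q+1 (0≤* 0≤p+1 0≤q+1))) (sum-lower ww≤1 n) ⟩
      p * (q + 1ℚ) * ((q + 1ℚ) * ((p + 1ℚ) * (q + 1ℚ))) * (Δ n * (1ℚ - w * w))   ≡⟨ solve 5 (λ p q′ p′ D v → p :* q′ :* (q′ :* (p′ :* q′)) :* (D :* v)
                                                                       := p :* D :* (p′ :* q′) :* (v :* (q′ :* q′))) refl p (q + 1ℚ) (p + 1ℚ) (Δ n) (1ℚ - w * w) ⟩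
      p * Δ n * ((p + 1ℚ) * (q + 1ℚ)) * ((1ℚ - w * w) * ((q + 1ℚ) * (q + 1ℚ)))   ≡⟨ cong (p * Δ n * ((p + 1ℚ) * (q + 1ℚ)) *_) (1-z² {q} {w} w·) ⟩
      p * Δ n * ((p + 1ℚ) * (q + 1ℚ)) * (2ℚ * 2ℚ * q)             ≡⟨ solve 4 (λ p q m D → p :* D :* m :* (con 2ℚ :* con 2ℚ :* q) := (con 2ℚ :* q :* m) :* (p :* (con 2ℚ :* D))) refl p q ((p + 1ℚ) * (q + 1ℚ)) (Δ n) ⟩
      m * (p * (2ℚ * Δ n))                                        ∎)
      where
      e = 1ℚ - (w * w) ^ n
      m = 2ℚ * q * ((p + 1ℚ) * (q + 1ℚ))
      0<m : 0ℚ < m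
      0<m = 0<* (0<* (ℚₚ.positive⁻¹ 2ℚ) 0<q) (0<* 0<p+1 0<q+1)

  ^-small : ∀ {u} → 0ℚ ≤ u → u < 1ℚ → ∀ ε → 0ℚ < ε → Eventually (λ n → u ^ n ≤ ε)
  ^-small {u} 0≤u u<1 ε 0<ε = N , λ n N≤n → ℚₚ.≤-trans (antitone {N} {n} N≤n) (proj₂ small)
    where
    small = Geometric.small (u ^_) 0 (1ℚ - u) (0<q-p u<1)
      (≤-by u 0≤u (solve 1 (λ u → con 1ℚ :- (con 1ℚ :- u) := u) refl u)) (^-nonneg 0≤u)
      (λ j _ → ℚₚ.≤-reflexive (solve 2 (λ u v → u :* v := (con 1ℚ :- (con 1ℚ :- u)) :* v) refl u (u ^ j))) ε 0<ε
    N = proj₁ small ℕ.+ 0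
    step : ∀ n → u ^ suc n ≤ u ^ n
    step n = ℚₚ.≤-trans (*-monoʳ (^-nonneg 0≤u n) (ℚₚ.<⇒≤ u<1)) (ℚₚ.≤-reflexive (ℚₚ.*-identityˡ (u ^ n)))
    antitone′ : ∀ {m n} → m ℕ.≤′ n → u ^ n ≤ u ^ m
    antitone′ {m} ℕ.≤′-refl = ℚₚ.≤-refl
    antitone′ {m} {suc n} (ℕ.≤′-step m≤n) = ℚₚ.≤-trans (step n) (antitone′ {m} {n} m≤n)
    antitone : ∀ {m n} → m ℕ.≤ n → u ^ n ≤ u ^ m
    antitone {m} {n} m≤n = antitone′ {m} {n} (ℕₚ.≤⇒≤′ m≤n)

  1⊔-positive : ∀ q → ℚ.Positive (1ℚ ℚ.⊔ q)
  1⊔-positive q = ℚ.positive (ℚₚ.<-≤-trans 0<1 (ℚₚ.p≤p⊔q 1ℚ q))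

  private
    Z : ℚ → ℚ
    Z q = mobius (1ℚ ℚ.⊔ q) {{1⊔-positive q}}

    Z²<1 : ∀ q → Z q * Z q < 1ℚ
    Z²<1 q = mobius²<1 (1ℚ ℚ.⊔ q) {{1⊔-positive q}}

    Z-eq : ∀ {q} → 1ℚ ≤ q → Z q * (q + 1ℚ) ≡ q - 1ℚ
    Z-eq {q} 1≤q = subst (λ r → Z q * (r + 1ℚ) ≡ r - 1ℚ) (ℚₚ.p≤q⇒p⊔q≡q 1≤q)
      (trans (ℚₚ.*-assoc (m - 1ℚ) (ℚ.1/ (m + 1ℚ)) (m + 1ℚ))
        (trans (cong ((m - 1ℚ) *_) (ℚₚ.*-inverseˡ (m + 1ℚ))) (ℚₚ.*-identityʳ (m - 1ℚ))))
      where
      m = 1ℚ ℚ.⊔ q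
      instance
        m⁺ = 1⊔-positive q
        m+1⁺ = ℚₚ.pos+pos⇒pos m 1ℚ
        m+1≢0 = ℚₚ.pos⇒nonZero (m + 1ℚ)

  mobius-cong : ∀ p q .{{_ : ℚ.Positive p}} .{{_ : ℚ.Positive q}} → p ≡ q → mobius p ≡ mobius q
  mobius-cong p .p refl = refl

  abstract
    -- log extended to all of ℚ by the junk value log 1 = 0 below 1.
    ln : ℚ → ℝ
    ln q = log (1ℚ ℚ.⊔ q) {{1⊔-positive q}}

    seq-ln : ∀ q n → seq (ln q) n ≡ 2ℚ * sum (artanhTerm (Z q)) n
    seq-ln q n = refl

  ln≃log : ∀ {q} .{{_ : ℚ.Positive q}} → 1ℚ ≤ q → ∀ n → seq (ln q) n ≡ seq (log q) n
  ln≃log {q} 1≤q n = trans (seq-ln q n) (cong (λ z → 2ℚ * sum (artanhTerm z) n)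
    (mobius-cong (1ℚ ℚ.⊔ q) q {{1⊔-positive q}} (ℚₚ.p≤q⇒p⊔q≡q 1≤q)))

  ln-1 : ∀ n → seq (ln 1ℚ) n ≡ 0ℚ
  ln-1 n = trans (seq-ln 1ℚ n) (trans (cong (2ℚ *_) (zeros n)) (ℚₚ.*-zeroʳ 2ℚ))
    where
    zeros : ∀ n → sum (artanhTerm 0ℚ) n ≡ 0ℚ
    zeros zero = refl
    zeros (suc n) = trans (cong₂ _+_ (zeros n) (trans (cong (_* (+ 1 / suc (2 ℕ.* n))) (ℚₚ.*-zeroˡ (0ℚ ^ (2 ℕ.* n)))) (ℚₚ.*-zeroˡ (+ 1 / suc (2 ℕ.* n))))) refl

  module _ {p q : ℚ} (1≤q : 1ℚ ≤ q) (q≤p : q ≤ p) where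

    private
      module B = Bracket {p} {q} {Z p} {Z q} 1≤q q≤p (Z-eq (ℚₚ.≤-trans 1≤q q≤p)) (Z-eq 1≤q)

      ln-Δ : ∀ n → seq (ln p) n - seq (ln q) n ≡ 2ℚ * B.Δ n
      ln-Δ n = trans (cong₂ _-_ (seq-ln p n) (seq-ln q n)) (solve 3 (λ t a b → t :* a :- t :* b := t :* (a :- b)) refl 2ℚ (sum (artanhTerm (Z p)) n) (sum (artanhTerm (Z q)) n))

    ln-mono : ∀ n → 0ℚ ≤ seq (ln p) n - seq (ln q) n
    ln-mono n = subst (0ℚ ≤_) (sym (ln-Δ n)) (0≤* B.0≤2 (B.Δ-nonneg n))

    ln-upper : ∀ n → q * (seq (ln p) n - seq (ln q) n) ≤ p - q
    ln-upper n = subst (λ a → q * a ≤ p - q) (sym (ln-Δ n)) (B.upper (ℚₚ.<⇒≤ (Z²<1 p)) n)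

    -- Unlike `ln-upper` this can fail for single approximations, which may miss p - q by (p - q)
    -- times the n-th power of `Z q` squared. The loss tends to 0 and disappears in the order on ℝ.
    ln-lower : fromℚ (p - q) ≤ᴿ fromℚ p *ᴿ (ln p -ᴿ ln q)
    ln-lower ε 0<ε =
      let (δ , 0<δ , δ≤1 , Kδ≤ε) = shrink (p - q) (0≤q-p q≤p) ε 0<ε
      in eventually-map (λ n a → step n (ℚₚ.≤-trans a δ≤1) (ℚₚ.≤-trans (*-monoˡ (0≤q-p q≤p) a) Kδ≤ε))
           (^-small (0≤* B.0≤w B.0≤w) (Z²<1 q) δ 0<δ)
      where
      step : ∀ n → (Z q * Z q) ^ n ≤ 1ℚ → (p - q) * (Z q * Z q) ^ n ≤ ε → p - q ≤ p * (seq (ln p) n - seq (ln q) n) + ε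
      step n u≤1 du≤ε = begin
        p - q                                 ≡⟨ solve 2 (λ d u → d := d :* (con 1ℚ :- u) :+ d :* u) refl (p - q) u ⟩
        (p - q) * (1ℚ - u) + (p - q) * u      ≤⟨ ℚₚ.+-mono-≤ (B.lower (ℚₚ.<⇒≤ (Z²<1 q)) n u≤1) du≤ε ⟩
        p * (2ℚ * B.Δ n) + ε                  ≡⟨ cong (λ a → p * a + ε) (ln-Δ n) ⟨
        p * (seq (ln p) n - seq (ln q) n) + ε ∎
        where
        open ℚₚ.≤-Reasoning
        u = (Z q * Z q) ^ n

-- The logarithm as an inverse of exp.

module ExpLog where

  open ℤ using (+_)
  open Rational
  open Real
  open Exponential
  open Logarithm using (ln; ln-1; ln-mono; ln-upper; ln-lower)
  open ℚ using (_+_; _*_; -_; _-_; _≤_; _<_; ∣_∣)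
  open Defs.Sequence using (0≤*; *-monoˡ; *-monoʳ; fromNat; fromNat≥0; fromNat-*; fromNat-suc; fromNat-mono; 0≤1/; archimedean; reciprocal)
  open +-*-Solver

  -- A function whose increments are quadratically small is constant: subdivide.
  module Constancy (f : ℚ → ℝ) {p C : ℚ} (1≤p : 1ℚ ≤ p) (0≤C : 0ℚ ≤ C)
    (quadratic : ∀ s t → 1ℚ ≤ s → s ≤ t → t ≤ p → f t -ᴿ f s ⊢≤ C * ((t - s) * (t - s))) where

    module Subdivide (i : ℕ) where

      N : ℕ
      N = suc i

      h : ℚ
      h = (p - 1ℚ) * (+ 1 / N)

      0≤h : 0ℚ ≤ h
      0≤h = 0≤* (0≤q-p 1≤p) (0≤1/ N)

      t : ℕ → ℚ
      t j = 1ℚ + fromNat j * h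

      Nh : fromNat N * h ≡ p - 1ℚ
      Nh = trans (solve 3 (λ n d i → n :* (d :* i) := d :* (n :* i)) refl (fromNat N) (p - 1ℚ) (+ 1 / N))
        (trans (cong ((p - 1ℚ) *_) (fromNat-* i)) (ℚₚ.*-identityʳ (p - 1ℚ)))

      t-suc : ∀ j → t (suc j) - t j ≡ h
      t-suc j = trans (cong (λ a → (1ℚ + a * h) - t j) (fromNat-suc j))
        (solve 2 (λ n h → (con 1ℚ :+ (con 1ℚ :+ n) :* h) :- (con 1ℚ :+ n :* h) := h) refl (fromNat j) h)

      1≤t : ∀ j → 1ℚ ≤ t j
      1≤t j = ≤-by (fromNat j * h) (0≤* (fromNat≥0 j) 0≤h) (solve 1 (λ a → (con 1ℚ :+ a) :- con 1ℚ := a) refl (fromNat j * h))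

      t-end : t N ≡ p
      t-end = trans (cong (λ a → 1ℚ + a) Nh) (solve 1 (λ p → con 1ℚ :+ (p :- con 1ℚ) := p) refl p)

      t≤p : ∀ {j} → j ℕ.≤ N → t j ≤ p
      t≤p {j} j≤N = subst (t j ≤_) t-end (ℚₚ.+-monoʳ-≤ 1ℚ (*-monoʳ 0≤h (fromNat-mono j≤N)))

      walk : ∀ j → j ℕ.≤ N → f (t j) -ᴿ f 1ℚ ⊢≤ fromNat j * (C * (h * h))
      walk zero _ = ⊢≤-pointwise {f (t 0) -ᴿ f 1ℚ} {0ℚ * (C * (h * h))} (λ n → ℚₚ.≤-reflexive (trans
        (cong ∣_∣ (trans (cong (λ a → seq (f a) n - seq (f 1ℚ) n) (solve 1 (λ h → con 1ℚ :+ con 0ℚ :* h := con 1ℚ) refl h)) (ℚₚ.+-inverseʳ (seq (f 1ℚ) n))))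
        (sym (ℚₚ.*-zeroˡ (C * (h * h))))))
      walk (suc j) j<N = ⊢≤-weaken {f (t (suc j)) -ᴿ f 1ℚ} {C * (h * h) + fromNat j * (C * (h * h))}
        (ℚₚ.≤-reflexive (trans (solve 2 (λ n d → d :+ n :* d := (con 1ℚ :+ n) :* d) refl (fromNat j) (C * (h * h)))
          (cong (_* (C * (h * h))) (sym (fromNat-suc j)))))
        (⊢≤-resp {(f (t (suc j)) -ᴿ f (t j)) +ᴿ (f (t j) -ᴿ f 1ℚ)} {f (t (suc j)) -ᴿ f 1ℚ} {C * (h * h) + fromNat j * (C * (h * h))}
          (≃-pointwise {(f (t (suc j)) -ᴿ f (t j)) +ᴿ (f (t j) -ᴿ f 1ℚ)} {f (t (suc j)) -ᴿ f 1ℚ} (λ n →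
            solve 3 (λ a b c → (a :- b) :+ (b :- c) := a :- c) refl (seq (f (t (suc j))) n) (seq (f (t j)) n) (seq (f 1ℚ) n)))
          (⊢≤-+ {f (t (suc j)) -ᴿ f (t j)} {f (t j) -ᴿ f 1ℚ} {C * (h * h)} {fromNat j * (C * (h * h))}
            (subst (λ a → f (t (suc j)) -ᴿ f (t j) ⊢≤ C * (a * a)) (t-suc j)
              (quadratic (t j) (t (suc j)) (1≤t j) (≤-by h 0≤h (t-suc j)) (t≤p j<N)))
            (walk j (ℕₚ.<⇒≤ j<N))))

      total : f p -ᴿ f 1ℚ ⊢≤ C * ((p - 1ℚ) * (p - 1ℚ)) * (+ 1 / N)
      total = subst (λ a → f a -ᴿ f 1ℚ ⊢≤ C * ((p - 1ℚ) * (p - 1ℚ)) * (+ 1 / N)) t-end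
        (⊢≤-weaken {f (t N) -ᴿ f 1ℚ} {fromNat N * (C * (h * h))} {C * ((p - 1ℚ) * (p - 1ℚ)) * (+ 1 / N)} (ℚₚ.≤-reflexive (trans
          (solve 4 (λ n C d i → n :* (C :* ((d :* i) :* (d :* i))) := (C :* (d :* d) :* i) :* (n :* i)) refl (fromNat N) C (p - 1ℚ) (+ 1 / N))
          (trans (cong (C * ((p - 1ℚ) * (p - 1ℚ)) * (+ 1 / N) *_) (fromNat-* i)) (ℚₚ.*-identityʳ (C * ((p - 1ℚ) * (p - 1ℚ)) * (+ 1 / N))))))
        (walk N ℕₚ.≤-refl))

    constant : f p ≃ f 1ℚ
    constant = ≃-limit {f p} {f 1ℚ} λ ε 0<ε →
      let (r , 0<r , εr≡1) = reciprocal ε 0<ε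
          (i , le) = archimedean (M * r)
      in ⊢≤-weaken {f p -ᴿ f 1ℚ} {M * (+ 1 / suc i)} {ε} (small ε r i 0<ε εr≡1 le) (Subdivide.total i)
      where
      M = C * ((p - 1ℚ) * (p - 1ℚ))
      small : ∀ ε r i → 0ℚ < ε → ε * r ≡ 1ℚ → M * r ≤ fromNat i → M * (+ 1 / suc i) ≤ ε
      small ε r i 0<ε εr≡1 le = begin
        M * k                          ≡⟨ ℚₚ.*-identityˡ (M * k) ⟨
        1ℚ * (M * k)                   ≡⟨ cong (_* (M * k)) εr≡1 ⟨
        ε * r * (M * k)                ≡⟨ solve 4 (λ ε r M k → ε :* r :* (M :* k) := ε :* (M :* r :* k)) refl ε r M k ⟩
        ε * (M * r * k)                ≤⟨ *-monoˡ (ℚₚ.<⇒≤ 0<ε) (*-monoʳ (0≤1/ (suc i)) (ℚₚ.≤-trans le (fromNat-mono (ℕₚ.n≤1+n i)))) ⟩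
        ε * (fromNat (suc i) * k)      ≡⟨ cong (ε *_) (fromNat-* i) ⟩
        ε * 1ℚ                         ≡⟨ ℚₚ.*-identityʳ ε ⟩
        ε                              ∎
        where
        open ℚₚ.≤-Reasoning
        k = + 1 / suc i

  ln-nonneg : ∀ {t} → 1ℚ ≤ t → ∀ n → 0ℚ ≤ seq (ln t) n
  ln-nonneg {t} 1≤t n = subst (0ℚ ≤_)
    (trans (cong (λ a → seq (ln t) n - a) (ln-1 n)) (solve 1 (λ a → a :- con 0ℚ := a) refl (seq (ln t) n))) (ln-mono ℚₚ.≤-refl 1≤t n)

  ln≤t-1 : ∀ {t} → 1ℚ ≤ t → ∀ n → seq (ln t) n ≤ t - 1ℚ
  ln≤t-1 {t} 1≤t n = subst (_≤ t - 1ℚ)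
    (trans (cong (λ a → 1ℚ * (seq (ln t) n - a)) (ln-1 n)) (solve 1 (λ a → con 1ℚ :* (a :- con 0ℚ) := a) refl (seq (ln t) n))) (ln-upper ℚₚ.≤-refl 1≤t n)

  module _ (a : ℝ) where

    private
      ψ : ℚ → ℝ
      ψ t = -ᴿ (ln t +ᴿ a)

      F : ℚ → ℝ
      F t = fromℚ t *ᴿ exp (ψ t)

      module _ {p : ℚ} (1≤p : 1ℚ ≤ p) where

        ba = bounded-by a
        arch = archimedean ((p - 1ℚ) + fromNat (proj₁ ba))
        open Bounds (proj₁ arch)

        -- A bound uniform in t between 1 and p, so that one Taylor constant serves all points of
        -- the subdivision.
        ψ-bounded : ∀ {t} → 1ℚ ≤ t → t ≤ p → Bounded (ψ t)
        ψ-bounded {t} 1≤t t≤p = eventually-map (λ n a≤ → begin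
            ∣ - (seq (ln t) n + seq a n) ∣        ≡⟨ ℚₚ.∣-p∣≡∣p∣ (seq (ln t) n + seq a n) ⟩
            ∣ seq (ln t) n + seq a n ∣            ≤⟨ ℚₚ.∣p+q∣≤∣p∣+∣q∣ (seq (ln t) n) (seq a n) ⟩
            ∣ seq (ln t) n ∣ + ∣ seq a n ∣        ≡⟨ cong (_+ ∣ seq a n ∣) (ℚₚ.0≤p⇒∣p∣≡p (ln-nonneg 1≤t n)) ⟩
            seq (ln t) n + ∣ seq a n ∣            ≤⟨ ℚₚ.+-mono-≤ (ℚₚ.≤-trans (ln≤t-1 1≤t n) (ℚₚ.+-monoˡ-≤ (- 1ℚ) t≤p)) a≤ ⟩
            (p - 1ℚ) + fromNat (proj₁ ba)         ≤⟨ proj₂ arch ⟩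
            fromNat (proj₁ arch)                  ∎) (proj₂ ba)
          where open ℚₚ.≤-Reasoning

        C : ℚ
        C = p * K + K

        module _ (s t : ℚ) (1≤s : 1ℚ ≤ s) (s≤t : s ≤ t) (t≤p : t ≤ p) where

          d = t - s
          0≤d = 0≤q-p s≤t
          1≤t = ℚₚ.≤-trans 1≤s s≤t
          0≤t = ℚₚ.≤-trans 0≤1 1≤t

          x = ψ s
          y = ψ t

          λ≤d : ∀ n → seq (ln t) n - seq (ln s) n ≤ d
          λ≤d n = ℚₚ.≤-trans (ℚₚ.≤-trans (ℚₚ.≤-reflexive (sym (ℚₚ.*-identityˡ (seq (ln t) n - seq (ln s) n)))) (*-monoʳ (ln-mono 1≤s s≤t n) 1≤s)) (ln-upper 1≤s s≤t n)

          y-x : ∀ n → seq (y -ᴿ x) n ≡ - (seq (ln t) n - seq (ln s) n)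
          y-x n = solve 3 (λ t s a → (:- (t :+ a)) :- (:- (s :+ a)) := :- (t :- s)) refl (seq (ln t) n) (seq (ln s) n) (seq a n)

          y-x≤d : y -ᴿ x ⊢≤ d
          y-x≤d = ⊢≤-pointwise {y -ᴿ x} {d} (λ n → ℚₚ.≤-trans (ℚₚ.≤-reflexive (trans (cong ∣_∣ (y-x n))
            (trans (ℚₚ.∣-p∣≡∣p∣ (seq (ln t) n - seq (ln s) n)) (ℚₚ.0≤p⇒∣p∣≡p (ln-mono 1≤s s≤t n))))) (λ≤d n))

          -- The first-order change of t exp (ψ t) from s to t, divided by exp (ψ s): the growth d
          -- of the first factor and the decrease of ψ nearly cancel.
          linear : ℝ
          linear = fromℚ d +ᴿ fromℚ t *ᴿ (y -ᴿ x)

          -- Put l = ln t - ln s. Then d ≤ t l makes `linear` at most 0, and s l ≤ d together with l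
          -- ≤ d gives d - t l = (d - s l) - d l ≥ - d².
          linear≤ : linear ⊢≤ d * d
          linear≤ = ⊢≤-intro {linear} {d * d}
            (≤-trans {linear} {fromℚ 0ℚ} {fromℚ (d * d)}
              (≤-rearrange {fromℚ d} {fromℚ t *ᴿ (ln t -ᴿ ln s)} {linear} {fromℚ 0ℚ} (ln-lower 1≤s s≤t)
                (λ n → trans (cong (λ a → 0ℚ - (d + t * a)) (y-x n))
                  (solve 3 (λ d t l → con 0ℚ :- (d :+ t :* (:- l)) := t :* l :- d) refl d t (seq (ln t) n - seq (ln s) n))))
              (fromℚ-mono (0≤* 0≤d 0≤d)))
            (≤-pointwise {fromℚ (- (d * d))} {linear} (λ n → ≤-by
              ((d - s * (seq (ln t) n - seq (ln s) n)) + d * (d - (seq (ln t) n - seq (ln s) n)))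
              (0≤+ (0≤q-p (ln-upper 1≤s s≤t n)) (0≤* 0≤d (0≤q-p (λ≤d n))))
              (trans (cong (λ a → (d + t * a) - - (d * d)) (y-x n))
                (solve 3 (λ t s l → ((t :- s) :+ t :* (:- l)) :- :- ((t :- s) :* (t :- s))
                  := ((t :- s) :- s :* l) :+ (t :- s) :* ((t :- s) :- l)) refl t s (seq (ln t) n - seq (ln s) n)))))

          taylorError : ℝ
          taylorError = exp y -ᴿ exp x -ᴿ (y -ᴿ x) *ᴿ exp x

          -- F t - F s is exactly t times the Taylor error plus exp (ψ s) times `linear`, and both
          -- parts are of order d².
          quadratic : F t -ᴿ F s ⊢≤ C * (d * d)
          quadratic = ⊢≤-weaken {F t -ᴿ F s} {t * (K * (d * d)) + K * (d * d)} {C * (d * d)}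
            (ℚₚ.≤-trans (ℚₚ.+-monoˡ-≤ (K * (d * d)) (*-monoʳ (0≤* 0≤K (0≤* 0≤d 0≤d)) t≤p))
              (ℚₚ.≤-reflexive (solve 3 (λ p K d → p :* (K :* (d :* d)) :+ K :* (d :* d) := (p :* K :+ K) :* (d :* d)) refl p K d)))
            (⊢≤-resp {fromℚ t *ᴿ taylorError +ᴿ exp x *ᴿ linear} {F t -ᴿ F s} {t * (K * (d * d)) + K * (d * d)}
              (≃-pointwise {fromℚ t *ᴿ taylorError +ᴿ exp x *ᴿ linear} {F t -ᴿ F s} (λ n →
                solve 5 (λ t s ey ex l → t :* (ey :- ex :- l :* ex) :+ ex :* ((t :- s) :+ t :* l) := t :* ey :- s :* ex)
                  refl t s (seq (exp y) n) (seq (exp x) n) (seq (y -ᴿ x) n)))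
              (⊢≤-+ {fromℚ t *ᴿ taylorError} {exp x *ᴿ linear} {t * (K * (d * d))} {K * (d * d)}
                (⊢≤-* {fromℚ t} {taylorError} {t} {K * (d * d)} 0≤t (0≤* 0≤K (0≤* 0≤d 0≤d))
                  (⊢≤-pointwise {fromℚ t} {t} (λ _ → ℚₚ.≤-reflexive (ℚₚ.0≤p⇒∣p∣≡p 0≤t)))
                  (taylor {x} {y} {d} 0≤d (ψ-bounded 1≤s (ℚₚ.≤-trans s≤t t≤p)) (ψ-bounded 1≤t t≤p) y-x≤d))
                (⊢≤-* {exp x} {linear} {K} {d * d} 0≤K (0≤* 0≤d 0≤d) (exp-bounded {x} (ψ-bounded 1≤s (ℚₚ.≤-trans s≤t t≤p))) linear≤)))

        F-constant : F p ≃ F 1ℚ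
        F-constant = Constancy.constant F {p} {C} 1≤p (0≤+ (0≤* (ℚₚ.≤-trans 0≤1 1≤p) 0≤K) 0≤K) quadratic

    -- By the bounds on log increments and the Taylor bound for exp, the increments of
    -- t ↦ t exp (- (log t + a)) are quadratically small; no addition theorem is needed.
    exp-ln : ∀ {p} → 1ℚ ≤ p → fromℚ p *ᴿ exp (-ᴿ (ln p +ᴿ a)) ≃ exp (-ᴿ a)
    exp-ln {p} 1≤p = ≃-trans {F p} {F 1ℚ} {exp (-ᴿ a)} (F-constant 1≤p)
      (≃-trans {F 1ℚ} {exp (ψ 1ℚ)} {exp (-ᴿ a)} (≃-pointwise {F 1ℚ} {exp (ψ 1ℚ)} (λ n → ℚₚ.*-identityˡ (seq (exp (ψ 1ℚ)) n)))
        (exp-cong {ψ 1ℚ} { -ᴿ a} (≃-pointwise {ψ 1ℚ} { -ᴿ a} (λ n → cong -_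
          (trans (cong (_+ seq a n) (ln-1 n)) (ℚₚ.+-identityˡ (seq a n)))))))

-- Counting by sums over lists: injective words and words of given content.

module Counting where

  open Fin using (zero; suc)
  open ℕ using (_+_; _*_; _∸_; _^_; _≤_)
  open ℕ-Solver using (solve; _:=_; _:+_; _:*_; con)
  open ≡-Reasoning
  open Defs using (unique?; vectors)

  private
    variable
      A B C : Set
      P Q : Set

  -- Only the Boolean `does` enters, so the indicator of `unique? (x ∷ v)` reduces to a conjunction
  -- that `∧-*` factors.
  ⟦_⟧ : Dec P → ℕ
  ⟦ P? ⟧ = if does P? then 1 else 0

  ⟦⟧-cong : (P? : Dec P) (Q? : Dec Q) → (P → Q) → (Q → P) → ⟦ P? ⟧ ≡ ⟦ Q? ⟧
  ⟦⟧-cong (yes p) (yes q) _ _ = refl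
  ⟦⟧-cong (yes p) (no ¬q) f _ = ⊥-elim (¬q (f p))
  ⟦⟧-cong (no ¬p) (yes q) _ g = ⊥-elim (¬p (g q))
  ⟦⟧-cong (no ¬p) (no ¬q) _ _ = refl

  ⟦⟧-yes : (P? : Dec P) → P → ⟦ P? ⟧ ≡ 1
  ⟦⟧-yes (yes _) _ = refl
  ⟦⟧-yes (no ¬p) p = ⊥-elim (¬p p)

  ⟦⟧-no : (P? : Dec P) → ¬ P → ⟦ P? ⟧ ≡ 0
  ⟦⟧-no (yes p) ¬p = ⊥-elim (¬p p)
  ⟦⟧-no (no _) _ = refl

  ∧-* : ∀ a b → (if a ∧ b then 1 else 0) ≡ (if a then 1 else 0) * (if b then 1 else 0)
  ∧-* true b = sym (ℕₚ.+-identityʳ _)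
  ∧-* false b = refl

  ∑ : List A → (A → ℕ) → ℕ
  ∑ [] f = 0
  ∑ (x ∷ xs) f = f x + ∑ xs f

  ∑-cong : ∀ (xs : List A) {f g} → (∀ x → f x ≡ g x) → ∑ xs f ≡ ∑ xs g
  ∑-cong [] eq = refl
  ∑-cong (x ∷ xs) eq = cong₂ _+_ (eq x) (∑-cong xs eq)

  ∑-++ : ∀ (xs ys : List A) f → ∑ (xs ++ˡ ys) f ≡ ∑ xs f + ∑ ys f
  ∑-++ [] ys f = refl
  ∑-++ (x ∷ xs) ys f = trans (cong (f x +_) (∑-++ xs ys f)) (sym (ℕₚ.+-assoc (f x) (∑ xs f) (∑ ys f)))

  ∑-map : ∀ (g : A → B) xs f → ∑ (map g xs) f ≡ ∑ xs (f ∘ g)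
  ∑-map g [] f = refl
  ∑-map g (x ∷ xs) f = cong (f (g x) +_) (∑-map g xs f)

  ∑-+ : ∀ (xs : List A) f g → ∑ xs (λ x → f x + g x) ≡ ∑ xs f + ∑ xs g
  ∑-+ [] f g = refl
  ∑-+ (x ∷ xs) f g = trans (cong (f x + g x +_) (∑-+ xs f g))
    (solve 4 (λ a b c d → (a :+ b) :+ (c :+ d) := (a :+ c) :+ (b :+ d)) refl (f x) (g x) (∑ xs f) (∑ xs g))

  ∑-*ˡ : ∀ (xs : List A) c f → ∑ xs (λ x → c * f x) ≡ c * ∑ xs f
  ∑-*ˡ [] c f = sym (ℕₚ.*-zeroʳ c)
  ∑-*ˡ (x ∷ xs) c f = trans (cong (c * f x +_) (∑-*ˡ xs c f)) (sym (ℕₚ.*-distribˡ-+ c (f x) (∑ xs f)))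

  ∑-*ʳ : ∀ (xs : List A) c f → ∑ xs (λ x → f x * c) ≡ ∑ xs f * c
  ∑-*ʳ xs c f = trans (∑-cong xs (λ x → ℕₚ.*-comm (f x) c)) (trans (∑-*ˡ xs c f) (ℕₚ.*-comm c (∑ xs f)))

  ∑-zero : ∀ (xs : List A) → ∑ xs (λ _ → 0) ≡ 0
  ∑-zero [] = refl
  ∑-zero (x ∷ xs) = ∑-zero xs

  ∑-const : ∀ (xs : List A) c → ∑ xs (λ _ → c) ≡ length xs * c
  ∑-const [] c = refl
  ∑-const (x ∷ xs) c = cong (c +_) (∑-const xs c)

  ∑-swap : ∀ (xs : List A) (ys : List B) (f : A → B → ℕ) → ∑ xs (λ x → ∑ ys (f x)) ≡ ∑ ys (λ y → ∑ xs (λ x → f x y))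
  ∑-swap [] ys f = sym (∑-zero ys)
  ∑-swap (x ∷ xs) ys f = trans (cong (∑ ys (f x) +_) (∑-swap xs ys f)) (sym (∑-+ ys (f x) _))

  ∑-product : ∀ (g : A → B → C) xs ys f → ∑ (cartesianProductWith g xs ys) f ≡ ∑ xs (λ x → ∑ ys (λ y → f (g x y)))
  ∑-product g [] ys f = refl
  ∑-product g (x ∷ xs) ys f = trans (∑-++ (map (g x) ys) (cartesianProductWith g xs ys) f)
    (cong₂ _+_ (∑-map (g x) ys f) (∑-product g xs ys f))

  ∑-filter : ∀ {P : Pred A 0ℓ} (P? : Decidable P) xs f → ∑ (filter P? xs) f ≡ ∑ xs (λ x → ⟦ P? x ⟧ * f x)
  ∑-filter P? [] f = refl
  ∑-filter P? (x ∷ xs) f with does (P? x)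
  ... | true = cong₂ _+_ (sym (ℕₚ.+-identityʳ (f x))) (∑-filter P? xs f)
  ... | false = ∑-filter P? xs f

  length-∑ : ∀ (xs : List A) → length xs ≡ ∑ xs (λ _ → 1)
  length-∑ [] = refl
  length-∑ (x ∷ xs) = cong suc (length-∑ xs)

  length-filter-∑ : ∀ {P : Pred A 0ℓ} (P? : Decidable P) xs → length (filter P? xs) ≡ ∑ xs (λ x → ⟦ P? x ⟧)
  length-filter-∑ P? xs = trans (length-∑ (filter P? xs)) (trans (∑-filter P? xs (λ _ → 1))
    (∑-cong xs (λ x → ℕₚ.*-identityʳ ⟦ P? x ⟧)))

  ∑-vectors-++ : ∀ (xs : List A) m {k} (f : Vec A (m + k) → ℕ) →
    ∑ (vectors xs (m + k)) f ≡ ∑ (vectors xs m) (λ u → ∑ (vectors xs k) (λ w → f (u ++ w)))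
  ∑-vectors-++ xs zero f = sym (ℕₚ.+-identityʳ _)
  ∑-vectors-++ xs (suc m) {k} f = begin
    ∑ (vectors xs (suc m + k)) f
      ≡⟨ ∑-product _∷_ xs (vectors xs (m + k)) f ⟩
    ∑ xs (λ x → ∑ (vectors xs (m + k)) (λ v → f (x ∷ v)))
      ≡⟨ ∑-cong xs (λ x → ∑-vectors-++ xs m (λ v → f (x ∷ v))) ⟩
    ∑ xs (λ x → ∑ (vectors xs m) (λ u → ∑ (vectors xs k) (λ w → f (x ∷ u ++ w))))
      ≡⟨ ∑-product _∷_ xs (vectors xs m) (λ u → ∑ (vectors xs k) (λ w → f (u ++ w))) ⟨
    ∑ (vectors xs (suc m)) (λ u → ∑ (vectors xs k) (λ w → f (u ++ w)))
      ∎

  -- Gluing the rows of a coloring to one word brings it into the form counted by `multinomial`.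
  ∑-concat : ∀ (xs : List A) m r (f : Vec A (r * m) → ℕ) →
    ∑ (vectors (vectors xs m) r) (λ W → f (concat W)) ≡ ∑ (vectors xs (r * m)) f
  ∑-concat xs m zero f = refl
  ∑-concat xs m (suc r) f = begin
    ∑ (vectors (vectors xs m) (suc r)) (λ W → f (concat W))
      ≡⟨ ∑-product _∷_ (vectors xs m) (vectors (vectors xs m) r) (λ W → f (concat W)) ⟩
    ∑ (vectors xs m) (λ w → ∑ (vectors (vectors xs m) r) (λ W → f (w ++ concat W)))
      ≡⟨ ∑-cong (vectors xs m) (λ w → ∑-concat xs m r (λ u → f (w ++ u))) ⟩
    ∑ (vectors xs m) (λ w → ∑ (vectors xs (r * m)) (λ u → f (w ++ u)))
      ≡⟨ ∑-vectors-++ xs m f ⟨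
    ∑ (vectors xs (suc r * m)) f
      ∎

  -- Any coordinate of a word may be summed first: an exchange of two sums carries coordinate i past
  -- each coordinate before it.
  ∑-insertAt : ∀ (xs : List A) {m} (i : Fin (suc m)) (f : Vec A (suc m) → ℕ) →
    ∑ (vectors xs (suc m)) f ≡ ∑ xs (λ x → ∑ (vectors xs m) (λ w → f (insertAt w i x)))
  ∑-insertAt xs {m} zero f = ∑-product _∷_ xs (vectors xs m) f
  ∑-insertAt xs {suc m} (suc i) f = begin
    ∑ (vectors xs (suc (suc m))) f
      ≡⟨ ∑-product _∷_ xs (vectors xs (suc m)) f ⟩
    ∑ xs (λ y → ∑ (vectors xs (suc m)) (λ w → f (y ∷ w)))
      ≡⟨ ∑-cong xs (λ y → ∑-insertAt xs i (λ w → f (y ∷ w))) ⟩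
    ∑ xs (λ y → ∑ xs (λ x → ∑ (vectors xs m) (λ w → f (y ∷ insertAt w i x))))
      ≡⟨ ∑-swap xs xs _ ⟩
    ∑ xs (λ x → ∑ xs (λ y → ∑ (vectors xs m) (λ w → f (y ∷ insertAt w i x))))
      ≡⟨ ∑-cong xs (λ x → ∑-product _∷_ xs (vectors xs m) (λ w → f (insertAt w (suc i) x))) ⟨
    ∑ xs (λ x → ∑ (vectors xs (suc m)) (λ w → f (insertAt w (suc i) x)))
      ∎

  insertEach : ∀ {m r} → Vec (Vec A m) r → Vec (Fin (suc m)) r → Vec A r → Vec (Vec A (suc m)) r
  insertEach [] [] [] = []
  insertEach (w ∷ W) (i ∷ σ) (x ∷ v) = insertAt w i x ∷ insertEach W σ v

  lookup-insertEach : ∀ {m r} (W : Vec (Vec A m) r) σ v → zipWith lookup (insertEach W σ v) σ ≡ v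
  lookup-insertEach [] [] [] = refl
  lookup-insertEach (w ∷ W) (i ∷ σ) (x ∷ v) = cong₂ _∷_ (insertAt-lookup w i x) (lookup-insertEach W σ v)

  -- Only the entries of a colouring at the matched positions and the colour counts
  -- matter, so the matched entries v can be summed separately from the others.
  ∑-insertEach : ∀ (xs : List A) {m r} (σ : Vec (Fin (suc m)) r) (f : Vec (Vec A (suc m)) r → ℕ) →
    ∑ (vectors (vectors xs (suc m)) r) f ≡ ∑ (vectors xs r) (λ v → ∑ (vectors (vectors xs m) r) (λ W → f (insertEach W σ v)))
  ∑-insertEach xs [] f = sym (ℕₚ.+-identityʳ _)
  ∑-insertEach xs {m} {suc r} (i ∷ σ) f = begin
    ∑ (vectors (vectors xs (suc m)) (suc r)) f
      ≡⟨ ∑-product _∷_ (vectors xs (suc m)) (vectors (vectors xs (suc m)) r) f ⟩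
    ∑ (vectors xs (suc m)) (λ w → ∑ (vectors (vectors xs (suc m)) r) (λ W → f (w ∷ W)))
      ≡⟨ ∑-insertAt xs i _ ⟩
    ∑ xs (λ x → ∑ (vectors xs m) (λ w → ∑ (vectors (vectors xs (suc m)) r) (λ W → f (insertAt w i x ∷ W))))
      ≡⟨ ∑-cong xs (λ x → ∑-cong (vectors xs m) (λ w → ∑-insertEach xs σ (λ W → f (insertAt w i x ∷ W)))) ⟩
    ∑ xs (λ x → ∑ (vectors xs m) (λ w → ∑ (vectors xs r) (λ v → ∑ (vectors (vectors xs m) r) (λ W → f (insertAt w i x ∷ insertEach W σ v)))))
      ≡⟨ ∑-cong xs (λ x → ∑-swap (vectors xs m) (vectors xs r) _) ⟩
    ∑ xs (λ x → ∑ (vectors xs r) (λ v → ∑ (vectors xs m) (λ w → ∑ (vectors (vectors xs m) r) (λ W → f (insertAt w i x ∷ insertEach W σ v)))))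
      ≡⟨ ∑-cong xs (λ x → ∑-cong (vectors xs r) (λ v → ∑-product _∷_ (vectors xs m) (vectors (vectors xs m) r) (λ W → f (insertEach W (i ∷ σ) (x ∷ v))))) ⟨
    ∑ xs (λ x → ∑ (vectors xs r) (λ v → ∑ (vectors (vectors xs m) (suc r)) (λ W → f (insertEach W (i ∷ σ) (x ∷ v)))))
      ≡⟨ ∑-product _∷_ xs (vectors xs r) (λ v → ∑ (vectors (vectors xs m) (suc r)) (λ W → f (insertEach W (i ∷ σ) v))) ⟨
    ∑ (vectors xs (suc r)) (λ v → ∑ (vectors (vectors xs m) (suc r)) (λ W → f (insertEach W (i ∷ σ) v)))
      ∎

  ∑-allFin-suc : ∀ {s} (f : Fin (suc s) → ℕ) → ∑ (allFin (suc s)) f ≡ f zero + ∑ (allFin s) (f ∘ suc)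
  ∑-allFin-suc {s} f = cong (f zero +_) (trans (cong (λ xs → ∑ xs f) (sym (map-tabulate id suc))) (∑-map suc (allFin s) f))

  ∑-allFin-const : ∀ s c → ∑ (allFin s) (λ _ → c) ≡ s * c
  ∑-allFin-const s c = trans (∑-const (allFin s) c) (cong (_* c) (length-tabulate {n = s} id))

  ≟-suc : ∀ {s} (i y : Fin s) → ⟦ suc i ≟ suc y ⟧ ≡ ⟦ i ≟ y ⟧
  ≟-suc i y = ⟦⟧-cong (suc i ≟ suc y) (i ≟ y) (λ { refl → refl }) (cong suc)

  ∑-≟ : ∀ {s} (y : Fin s) → ∑ (allFin s) (λ i → ⟦ i ≟ y ⟧) ≡ 1
  ∑-≟ {suc s} zero = trans (∑-allFin-suc {s} (λ i → ⟦ i ≟ zero ⟧)) (cong suc (∑-zero (allFin s)))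
  ∑-≟ {suc s} (suc y) = trans (∑-allFin-suc {s} (λ i → ⟦ i ≟ suc y ⟧))
    (trans (∑-cong (allFin s) (λ i → ≟-suc i y)) (∑-≟ y))

  ∏ : ∀ s → (Fin s → ℕ) → ℕ
  ∏ zero f = 1
  ∏ (suc s) f = f zero * ∏ s (f ∘ suc)

  ∏-cong : ∀ s {f g} → (∀ i → f i ≡ g i) → ∏ s f ≡ ∏ s g
  ∏-cong zero eq = refl
  ∏-cong (suc s) eq = cong₂ _*_ (eq zero) (∏-cong s (eq ∘ suc))

  ∏-const : ∀ s c → ∏ s (λ _ → c) ≡ c ^ s
  ∏-const zero c = refl
  ∏-const (suc s) c = cong (c *_) (∏-const s c)

  ∏-* : ∀ s f g → ∏ s (λ i → f i * g i) ≡ ∏ s f * ∏ s g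
  ∏-* zero f g = refl
  ∏-* (suc s) f g = trans (cong (f zero * g zero *_) (∏-* s (f ∘ suc) (g ∘ suc)))
    (solve 4 (λ a b c d → (a :* b) :* (c :* d) := (a :* c) :* (b :* d)) refl (f zero) (g zero) (∏ s (f ∘ suc)) (∏ s (g ∘ suc)))

  ∏-^ : ∀ s d f → ∏ s (λ i → d ^ f i) ≡ d ^ ∑ (allFin s) f
  ∏-^ zero d f = refl
  ∏-^ (suc s) d f = trans (cong (d ^ f zero *_) (∏-^ s d (f ∘ suc)))
    (trans (sym (ℕₚ.^-distribˡ-+-* d (f zero) (∑ (allFin s) (f ∘ suc)))) (cong (d ^_) (sym (∑-allFin-suc f))))

  ∏-update : ∀ s {f g} x k → f x ≡ k * g x → (∀ i → i ≢ x → f i ≡ g i) → ∏ s f ≡ k * ∏ s g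
  ∏-update (suc s) {f} {g} zero k eq rest = trans (cong₂ _*_ eq (∏-cong s (λ i → rest (suc i) λ ())))
    (ℕₚ.*-assoc k (g zero) (∏ s (g ∘ suc)))
  ∏-update (suc s) {f} {g} (suc x) k eq rest = trans
    (cong₂ _*_ (rest zero λ ()) (∏-update s {f ∘ suc} {g ∘ suc} x k eq (λ i i≢x → rest (suc i) (λ { refl → i≢x refl }))))
    (solve 3 (λ a k b → a :* (k :* b) := k :* (a :* b)) refl (g zero) k (∏ s (g ∘ suc)))

  #_∈_ : ∀ {s n} → Fin s → Vec (Fin s) n → ℕ
  # i ∈ v = count (i ≟_) v

  #-∷ : ∀ {s n} i x (v : Vec (Fin s) n) → # i ∈ (x ∷ v) ≡ ⟦ i ≟ x ⟧ + # i ∈ v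
  #-∷ i x v with does (i ≟ x)
  ... | true = refl
  ... | false = refl

  #-++ : ∀ {s m n} i (u : Vec (Fin s) m) (v : Vec (Fin s) n) → # i ∈ (u ++ v) ≡ # i ∈ u + # i ∈ v
  #-++ i [] v = refl
  #-++ i (x ∷ u) v = trans (#-∷ i x (u ++ v)) (trans (cong (⟦ i ≟ x ⟧ +_) (#-++ i u v))
    (trans (sym (ℕₚ.+-assoc ⟦ i ≟ x ⟧ (# i ∈ u) (# i ∈ v))) (cong (_+ # i ∈ v) (sym (#-∷ i x u)))))

  #-insertAt : ∀ {s m} i (w : Vec (Fin s) m) j x → # i ∈ insertAt w j x ≡ ⟦ i ≟ x ⟧ + # i ∈ w
  #-insertAt i w zero x = #-∷ i x w
  #-insertAt i (y ∷ w) (suc j) x = trans (#-∷ i y (insertAt w j x)) (trans (cong (⟦ i ≟ y ⟧ +_) (#-insertAt i w j x))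
    (trans (solve 3 (λ a b c → a :+ (b :+ c) := b :+ (a :+ c)) refl ⟦ i ≟ y ⟧ ⟦ i ≟ x ⟧ (# i ∈ w)) (cong (⟦ i ≟ x ⟧ +_) (sym (#-∷ i y w)))))

  #-insertEach : ∀ {s m r} i (W : Vec (Vec (Fin s) m) r) σ v → # i ∈ concat (insertEach W σ v) ≡ # i ∈ v + # i ∈ concat W
  #-insertEach i [] [] [] = refl
  #-insertEach i (w ∷ W) (j ∷ σ) (x ∷ v) = begin
    # i ∈ (insertAt w j x ++ concat (insertEach W σ v))         ≡⟨ #-++ i (insertAt w j x) (concat (insertEach W σ v)) ⟩
    # i ∈ insertAt w j x + # i ∈ concat (insertEach W σ v)      ≡⟨ cong₂ _+_ (#-insertAt i w j x) (#-insertEach i W σ v) ⟩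
    (⟦ i ≟ x ⟧ + # i ∈ w) + (# i ∈ v + # i ∈ concat W)          ≡⟨ solve 4 (λ a b c d → (a :+ b) :+ (c :+ d) := (a :+ c) :+ (b :+ d)) refl ⟦ i ≟ x ⟧ (# i ∈ w) (# i ∈ v) (# i ∈ concat W) ⟩
    (⟦ i ≟ x ⟧ + # i ∈ v) + (# i ∈ w + # i ∈ concat W)          ≡⟨ cong₂ _+_ (#-∷ i x v) (#-++ i w (concat W)) ⟨
    # i ∈ (x ∷ v) + # i ∈ (w ++ concat W)                       ∎

  ∑-# : ∀ {s n} (v : Vec (Fin s) n) → ∑ (allFin s) (λ i → # i ∈ v) ≡ n
  ∑-# {s} [] = ∑-zero (allFin s)
  ∑-# {s} (x ∷ v) = trans (∑-cong (allFin s) (λ i → #-∷ i x v))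
    (trans (∑-+ (allFin s) (λ i → ⟦ i ≟ x ⟧) (λ i → # i ∈ v)) (cong₂ _+_ (∑-≟ x) (∑-# v)))

  fresh? : ∀ {s n} (x : Fin s) (v : Vec (Fin s) n) → Dec (All (x ≢_) v)
  fresh? x v = All.all? (λ y → ¬? (x ≟ y)) v

  fresh⇒#≡0 : ∀ {s n x} {v : Vec (Fin s) n} → All (x ≢_) v → # x ∈ v ≡ 0
  fresh⇒#≡0 [] = refl
  fresh⇒#≡0 {x = x} {v = y ∷ v} (x≢y ∷ fr) = trans (#-∷ x y v) (cong₂ _+_ (⟦⟧-no (x ≟ y) x≢y) (fresh⇒#≡0 fr))

  fresh+# : ∀ {s n} x {v : Vec (Fin s) n} → Unique v → ⟦ fresh? x v ⟧ + # x ∈ v ≡ 1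
  fresh+# x [] = refl
  fresh+# x {y ∷ v} (fr ∷ u) with x ≟ y
  ... | yes refl = cong suc (fresh⇒#≡0 fr)
  ... | no _ = fresh+# x u

  #≤1 : ∀ {s n} x {v : Vec (Fin s) n} → Unique v → # x ∈ v ≤ 1
  #≤1 x {v} u = subst (# x ∈ v ≤_) (fresh+# x u) (ℕₚ.m≤n+m (# x ∈ v) ⟦ fresh? x v ⟧)

  -- Every color is either fresh or occurs exactly once in an injective word, and the multiplicities
  -- add up to n.
  count-fresh : ∀ {s n} {v : Vec (Fin s) n} → Unique v → ∑ (allFin s) (λ x → ⟦ fresh? x v ⟧) ≡ s ∸ n
  count-fresh {s} {n} {v} u = trans (sym (ℕₚ.m+n∸n≡m _ n)) (cong (_∸ n) (begin
    ∑ (allFin s) (λ x → ⟦ fresh? x v ⟧) + n                                  ≡⟨ cong (∑ (allFin s) (λ x → ⟦ fresh? x v ⟧) +_) (∑-# v) ⟨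
    ∑ (allFin s) (λ x → ⟦ fresh? x v ⟧) + ∑ (allFin s) (λ x → # x ∈ v)       ≡⟨ ∑-+ (allFin s) (λ x → ⟦ fresh? x v ⟧) (λ x → # x ∈ v) ⟨
    ∑ (allFin s) (λ x → ⟦ fresh? x v ⟧ + # x ∈ v)                            ≡⟨ ∑-cong (allFin s) (λ x → fresh+# x u) ⟩
    ∑ (allFin s) (λ _ → 1)                                                   ≡⟨ ∑-allFin-const s 1 ⟩
    s * 1                                                                    ≡⟨ ℕₚ.*-identityʳ s ⟩
    s                                                                        ∎))

  infix 8 _↓_

  -- The falling factorial s (s - 1) ⋯ (s - n + 1). Its new factor s - n counts the fresh colors
  -- that can be put in front of an injective word of length n; truncated subtraction makes the
  -- product 0 for n > s.
  _↓_ : ℕ → ℕ → ℕ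
  s ↓ zero = 1
  s ↓ suc n = (s ∸ n) * s ↓ n

  ∑-unique : ∀ s n → ∑ (vectors (allFin s) n) (λ v → ⟦ unique? v ⟧) ≡ s ↓ n
  ∑-unique s zero = refl
  ∑-unique s (suc n) = begin
    ∑ (vectors (allFin s) (suc n)) (λ v → ⟦ unique? v ⟧)
      ≡⟨ ∑-product _∷_ (allFin s) (vectors (allFin s) n) (λ v → ⟦ unique? v ⟧) ⟩
    ∑ (allFin s) (λ x → ∑ (vectors (allFin s) n) (λ v → ⟦ unique? (x ∷ v) ⟧))
      ≡⟨ ∑-swap (allFin s) (vectors (allFin s) n) _ ⟩
    ∑ (vectors (allFin s) n) (λ v → ∑ (allFin s) (λ x → ⟦ unique? (x ∷ v) ⟧))
      ≡⟨ ∑-cong (vectors (allFin s) n) (λ v → trans (∑-cong (allFin s) (λ x → ∧-* (does (fresh? x v)) (does (unique? v))))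
           (trans (∑-*ʳ (allFin s) ⟦ unique? v ⟧ (λ x → ⟦ fresh? x v ⟧)) (extensions v (unique? v)))) ⟩
    ∑ (vectors (allFin s) n) (λ v → (s ∸ n) * ⟦ unique? v ⟧)
      ≡⟨ ∑-*ˡ (vectors (allFin s) n) (s ∸ n) (λ v → ⟦ unique? v ⟧) ⟩
    (s ∸ n) * ∑ (vectors (allFin s) n) (λ v → ⟦ unique? v ⟧)
      ≡⟨ cong ((s ∸ n) *_) (∑-unique s n) ⟩
    (s ∸ n) * s ↓ n
      ∎
    where
    extensions : ∀ (v : Vec (Fin s) n) (u? : Dec (Unique v)) → ∑ (allFin s) (λ x → ⟦ fresh? x v ⟧) * ⟦ u? ⟧ ≡ (s ∸ n) * ⟦ u? ⟧
    extensions v (yes u) = cong (_* 1) (count-fresh u)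
    extensions v (no _) = trans (ℕₚ.*-zeroʳ (∑ (allFin s) (λ x → ⟦ fresh? x v ⟧))) (sym (ℕₚ.*-zeroʳ (s ∸ n)))

  content? : ∀ {s n} (b : Fin s → ℕ) (w : Vec (Fin s) n) → Dec (∀ i → # i ∈ w ≡ b i)
  content? b w = all? (λ i → # i ∈ w ℕₚ.≟ b i)

  -- The multinomial coefficient with cleared denominators, by induction on the length. A first
  -- letter x lowers b x by one, and (b x)! = b x · (b x - 1)!, so x contributes b x · (N - 1)! for
  -- words of length N; letters with b x = 0 contribute nothing, and the sum is N!.
  multinomial : ∀ {s} N (b : Fin s → ℕ) → ∑ (allFin s) b ≡ N →
    ∏ s (λ i → b i !) * ∑ (vectors (allFin s) N) (λ w → ⟦ content? b w ⟧) ≡ N !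
  multinomial {s} zero b ∑b≡0 = begin
    ∏ s (λ i → b i !) * (⟦ content? b [] ⟧ + 0)     ≡⟨ cong₂ _*_ (trans (∏-cong s (λ i → cong _! (b≡0 b ∑b≡0 i))) (trans (∏-const s 1) (ℕₚ.^-zeroˡ s)))
                                                        (cong (_+ 0) (⟦⟧-yes (content? b []) (λ i → sym (b≡0 b ∑b≡0 i)))) ⟩
    1                                               ∎
    where
    b≡0 : ∀ {s} (b : Fin s → ℕ) → ∑ (allFin s) b ≡ 0 → ∀ i → b i ≡ 0
    b≡0 {suc s} b eq zero = ℕₚ.m+n≡0⇒m≡0 (b zero) eq
    b≡0 {suc s} b eq (suc i) = b≡0 (b ∘ suc) (ℕₚ.m+n≡0⇒n≡0 (b zero) (trans (sym (∑-allFin-suc b)) eq)) i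
  multinomial {s} (suc N) b ∑b≡ = begin
    ∏b * ∑ (vectors (allFin s) (suc N)) (λ w → ⟦ content? b w ⟧)
      ≡⟨ cong (∏b *_) (∑-product _∷_ (allFin s) (vectors (allFin s) N) (λ w → ⟦ content? b w ⟧)) ⟩
    ∏b * ∑ (allFin s) (λ x → ∑ (vectors (allFin s) N) (λ w → ⟦ content? b (x ∷ w) ⟧))
      ≡⟨ ∑-*ˡ (allFin s) ∏b _ ⟨
    ∑ (allFin s) (λ x → ∏b * ∑ (vectors (allFin s) N) (λ w → ⟦ content? b (x ∷ w) ⟧))
      ≡⟨ ∑-cong (allFin s) (λ x → first x (b x) refl) ⟩
    ∑ (allFin s) (λ x → b x * N !)
      ≡⟨ ∑-*ʳ (allFin s) (N !) b ⟩
    ∑ (allFin s) b * N !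
      ≡⟨ cong (_* N !) ∑b≡ ⟩
    suc N !
      ∎
    where
    ∏b = ∏ s (λ i → b i !)
    first : ∀ x c → b x ≡ c → ∏b * ∑ (vectors (allFin s) N) (λ w → ⟦ content? b (x ∷ w) ⟧) ≡ c * N !
    first x zero bx≡0 = trans (cong (∏b *_) (trans (∑-cong (vectors (allFin s) N) impossible) (∑-zero (vectors (allFin s) N)))) (ℕₚ.*-zeroʳ ∏b)
      where
      impossible : ∀ w → ⟦ content? b (x ∷ w) ⟧ ≡ 0
      impossible w = ⟦⟧-no (content? b (x ∷ w)) (λ h → ℕₚ.0≢1+n (trans (sym bx≡0) (trans (sym (h x))
        (trans (#-∷ x x w) (cong (_+ # x ∈ w) (⟦⟧-yes (x ≟ x) refl))))))
    first x (suc c) bx≡ = begin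
      ∏b * ∑ (vectors (allFin s) N) (λ w → ⟦ content? b (x ∷ w) ⟧)
        ≡⟨ cong₂ _*_ (∏-update s x (suc c) (trans (cong _! bx≡) (cong (λ a → suc c * a !) (sym b′x)))
             (λ i i≢x → cong _! (trans (b-split i) (cong (_+ b′ i) (⟦⟧-no (i ≟ x) i≢x)))))
             (∑-cong (vectors (allFin s) N) (λ w → ⟦⟧-cong (content? b (x ∷ w)) (content? b′ w)
               (λ h i → ℕₚ.+-cancelˡ-≡ ⟦ i ≟ x ⟧ (# i ∈ w) (b′ i) (trans (sym (#-∷ i x w)) (trans (h i) (b-split i))))
               (λ h i → trans (#-∷ i x w) (trans (cong (⟦ i ≟ x ⟧ +_) (h i)) (sym (b-split i)))))) ⟩
      suc c * ∏ s (λ i → b′ i !) * ∑ (vectors (allFin s) N) (λ w → ⟦ content? b′ w ⟧)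
        ≡⟨ ℕₚ.*-assoc (suc c) (∏ s (λ i → b′ i !)) _ ⟩
      suc c * (∏ s (λ i → b′ i !) * ∑ (vectors (allFin s) N) (λ w → ⟦ content? b′ w ⟧))
        ≡⟨ cong (suc c *_) (multinomial N b′ (ℕₚ.suc-injective (trans (sym (cong (_+ ∑ (allFin s) b′) (∑-≟ x)))
             (trans (sym (∑-+ (allFin s) (λ i → ⟦ i ≟ x ⟧) b′)) (trans (sym (∑-cong (allFin s) b-split)) ∑b≡))))) ⟩
      suc c * N !
        ∎
      where
      b′ : Fin s → ℕ
      b′ i = b i ∸ ⟦ i ≟ x ⟧
      b′x : b′ x ≡ c
      b′x = cong₂ _∸_ bx≡ (⟦⟧-yes (x ≟ x) refl)
      b-split : ∀ i → b i ≡ ⟦ i ≟ x ⟧ + b′ i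
      b-split i with i ≟ x
      ... | yes refl = trans bx≡ (sym (cong (λ a → suc (a ∸ 1)) bx≡))
      ... | no _ = refl

-- The embedding of ℕ into ℚ.

module FromNat where

  open ℤ using (+_)
  open ℚ using (_+_; _*_)
  open Defs.Sequence using (fromNat; fromNat-suc; fromNat-mono; /-toℚᵘ)

  fromNat-+ : ∀ m n → fromNat (m ℕ.+ n) ≡ fromNat m + fromNat n
  fromNat-+ zero n = sym (ℚₚ.+-identityˡ (fromNat n))
  fromNat-+ (suc m) n = trans (fromNat-suc (m ℕ.+ n)) (trans (cong (λ a → 1ℚ + a) (fromNat-+ m n))
    (trans (sym (ℚₚ.+-assoc 1ℚ (fromNat m) (fromNat n))) (cong (_+ fromNat n) (sym (fromNat-suc m)))))

  fromNat-* : ∀ m n → fromNat (m ℕ.* n) ≡ fromNat m * fromNat n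
  fromNat-* zero n = sym (ℚₚ.*-zeroˡ (fromNat n))
  fromNat-* (suc m) n = trans (fromNat-+ n (m ℕ.* n)) (trans (cong (λ a → fromNat n + a) (fromNat-* m n))
    (trans (cong (_+ fromNat m * fromNat n) (sym (ℚₚ.*-identityˡ (fromNat n))))
      (trans (sym (ℚₚ.*-distribʳ-+ (fromNat n) 1ℚ (fromNat m))) (cong (_* fromNat n) (sym (fromNat-suc m))))))

  fromNat-pos : ∀ {n} → 0 ℕ.< n → 0ℚ ℚ.< fromNat n
  fromNat-pos {n} 0<n = ℚₚ.<-≤-trans (ℚₚ.positive⁻¹ 1ℚ) (fromNat-mono 0<n)

  /-fromNat : ∀ a b .{{_ : ℕ.NonZero b}} → + a / b ≡ fromNat a * (+ 1 / b)
  /-fromNat a b@(suc b′) = ℚₚ.toℚᵘ-injective (begin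
    ℚ.toℚᵘ (+ a / b)                                 ≈⟨ /-toℚᵘ (+ a) b ⟩
    + a ℚᵘ./ b                                       ≈⟨ ℚᵘ.*≡* (cong₂ ℤ._*_ (sym (ℤₚ.*-identityʳ (+ a))) (cong +_ (ℕₚ.*-identityˡ b))) ⟩
    (+ a ℚᵘ./ 1) ℚᵘ.* (+ 1 ℚᵘ./ b)                   ≈⟨ ℚᵘₚ.*-cong (/-toℚᵘ (+ a) 1) (/-toℚᵘ (+ 1) b) ⟨
    ℚ.toℚᵘ (fromNat a) ℚᵘ.* ℚ.toℚᵘ (+ 1 / b)         ≈⟨ ℚₚ.toℚᵘ-homo-* (fromNat a) (+ 1 / b) ⟨
    ℚ.toℚᵘ (fromNat a * (+ 1 / b))                   ∎)
    where open ℚᵘₚ.≃-Reasoning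

-- Exact rainbow probabilities in both models.

module Probability where

  open Fin using (zero; suc)
  open ℤ using (+_)
  open ℕ using (_+_; _*_; _∸_; _^_; _≤_; _<_)
  open ℕ-Solver using (solve; _:=_; _:+_; _:*_; con)
  open ≡-Reasoning
  open Defs using (regular?; unique?; rainbow?; vectors; colorings; regularColorings; perfectMatchings; Pr; uniformPr; regularPr)
  open Defs.Sequence using (fromNat) renaming (fromNat-* to fromNat-recip)
  open Counting

  ↓-! : ∀ {N k} → k ≤ N → N ↓ k * (N ∸ k) ! ≡ N !
  ↓-! {N} {zero} _ = ℕₚ.+-identityʳ (N !)
  ↓-! {N} {suc k} k<N = begin
    (N ∸ k) * N ↓ k * (N ∸ suc k) !              ≡⟨ solve 3 (λ a b c → a :* b :* c := b :* (a :* c)) refl (N ∸ k) (N ↓ k) ((N ∸ suc k) !) ⟩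
    N ↓ k * ((N ∸ k) * (N ∸ suc k) !)            ≡⟨ cong (λ a → N ↓ k * (a * (N ∸ suc k) !)) (ℕₚ.+-∸-assoc 1 k<N) ⟩
    N ↓ k * ((suc (N ∸ suc k)) * (N ∸ suc k) !)  ≡⟨ cong (λ a → N ↓ k * a !) (ℕₚ.+-∸-assoc 1 k<N) ⟨
    N ↓ k * (N ∸ k) !                            ≡⟨ ↓-! (ℕₚ.<⇒≤ k<N) ⟩
    N !                                          ∎

  ^-distribʳ-* : ∀ a b n → (a * b) ^ n ≡ a ^ n * b ^ n
  ^-distribʳ-* a b zero = refl
  ^-distribʳ-* a b (suc n) = trans (cong (a * b *_) (^-distribʳ-* a b n))
    (solve 4 (λ a b x y → (a :* b) :* (x :* y) := (a :* x) :* (b :* y)) refl a b (a ^ n) (b ^ n))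

  length-vectors : ∀ {A : Set} (xs : List A) r → length (vectors xs r) ≡ length xs ^ r
  length-vectors xs zero = refl
  length-vectors xs (suc r) = begin
    length (vectors xs (suc r))                       ≡⟨ length-∑ (vectors xs (suc r)) ⟩
    ∑ (vectors xs (suc r)) (λ _ → 1)                  ≡⟨ ∑-product _∷_ xs (vectors xs r) (λ _ → 1) ⟩
    ∑ xs (λ _ → ∑ (vectors xs r) (λ _ → 1))           ≡⟨ ∑-const xs (∑ (vectors xs r) (λ _ → 1)) ⟩
    length xs * ∑ (vectors xs r) (λ _ → 1)            ≡⟨ cong (length xs *_) (trans (sym (length-∑ (vectors xs r))) (length-vectors xs r)) ⟩
    length xs ^ suc r                                 ∎

  length-perfectMatchings : ∀ n → 0 < length (perfectMatchings n)
  length-perfectMatchings n = subst (0 <_) (sym (begin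
    length (perfectMatchings n)          ≡⟨ length-filter-∑ unique? (vectors (allFin n) n) ⟩
    ∑ (vectors (allFin n) n) (λ v → ⟦ unique? v ⟧)   ≡⟨ ∑-unique n n ⟩
    n ↓ n                                ≡⟨ ℕₚ.*-identityʳ (n ↓ n) ⟨
    n ↓ n * 1                            ≡⟨ cong (λ a → n ↓ n * a !) (ℕₚ.n∸n≡0 n) ⟨
    n ↓ n * (n ∸ n) !                    ≡⟨ ↓-! {n} {n} ℕₚ.≤-refl ⟩
    n !                                  ∎)) (ℕₚ.1≤n! n)

  module _ (m s : ℕ) (σ : Vec (Fin (suc m)) (suc m)) where

    private
      n = suc m
      V = vectors (allFin s) n
      W = vectors (vectors (allFin s) m) n

    rainbow-insertEach : ∀ (v : Vec (Fin s) n) (w : Vec (Vec (Fin s) m) n) → ⟦ rainbow? (insertEach w σ v , σ) ⟧ ≡ ⟦ unique? v ⟧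
    rainbow-insertEach v w = cong (λ u → ⟦ unique? u ⟧) (lookup-insertEach w σ v)

    -- The matched entries run through all words of length n, and the other entries contribute a
    -- constant factor. The proportion on the right is free of σ, which is the symmetry that makes
    -- the random matching irrelevant.
    count-uniform : ∑ (colorings n s) (λ χ → ⟦ rainbow? (χ , σ) ⟧) * s ^ n ≡ s ↓ n * length (colorings n s)
    count-uniform = begin
      ∑ (colorings n s) (λ χ → ⟦ rainbow? (χ , σ) ⟧) * s ^ n
        ≡⟨ cong (_* s ^ n) (trans (∑-insertEach (allFin s) σ (λ χ → ⟦ rainbow? (χ , σ) ⟧)) (∑-cong V (λ v → trans (∑-cong W (rainbow-insertEach v)) (∑-const W ⟦ unique? v ⟧)))) ⟩
      ∑ V (λ v → length W * ⟦ unique? v ⟧) * s ^ n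
        ≡⟨ cong₂ _*_ (trans (∑-*ˡ V (length W) (λ v → ⟦ unique? v ⟧)) (cong (length W *_) (∑-unique s n)))
             (sym (trans (length-vectors (allFin s) n) (cong (_^ n) (length-tabulate {n = s} id)))) ⟩
      length W * s ↓ n * length V
        ≡⟨ solve 3 (λ w f v → w :* f :* v := f :* (v :* (w :* con 1))) refl (length W) (s ↓ n) (length V) ⟩
      s ↓ n * (length V * (length W * 1))
        ≡⟨ cong (s ↓ n *_) (trans (length-∑ (colorings n s)) (trans (∑-insertEach (allFin s) σ (λ _ → 1))
             (trans (∑-cong V (λ v → ∑-const W 1)) (∑-const V (length W * 1))))) ⟨
      s ↓ n * length (colorings n s)
        ∎

    module _ (d : ℕ) (ds≡nn : d * s ≡ n * n) where

      private
        instance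
          ds≢0 : ℕ.NonZero (d * s)
          ds≢0 = subst ℕ.NonZero (sym ds≡nn) _
          s≢0 : ℕ.NonZero s
          s≢0 = ℕₚ.m*n≢0⇒n≢0 d
          d≢0 : ℕ.NonZero d
          d≢0 = ℕₚ.m*n≢0⇒m≢0 d

        0<d : 0 < d
        0<d = ℕ.>-nonZero⁻¹ d

      regular-content : ∀ χ → ⟦ regular? {n} {s} χ ⟧ ≡ ⟦ content? (λ _ → d) (concat χ) ⟧
      regular-content χ = ⟦⟧-cong (regular? χ) (content? (λ _ → d) (concat χ))
        (λ reg i → ℕₚ.*-cancelʳ-≡ (# i ∈ concat χ) d s (trans (reg i) (sym ds≡nn)))
        (λ con i → trans (cong (_* s) (con i)) ds≡nn)

      count-regular : (d !) ^ s * length (regularColorings n s) ≡ (n * n) !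
      count-regular = begin
        (d !) ^ s * length (regularColorings n s)
          ≡⟨ cong₂ _*_ (sym (∏-const s (d !))) (trans (length-filter-∑ regular? (colorings n s)) (trans (∑-cong (colorings n s) regular-content)
               (∑-concat (allFin s) n n (λ w → ⟦ content? (λ _ → d) w ⟧)))) ⟩
        ∏ s (λ _ → d !) * ∑ (vectors (allFin s) (n * n)) (λ w → ⟦ content? (λ _ → d) w ⟧)
          ≡⟨ multinomial {s} (n * n) (λ _ → d) (trans (∑-allFin-const s d) (trans (ℕₚ.*-comm s d) ds≡nn)) ⟩
        (n * n) !
          ∎

      -- A falling factorial of length at most 1 is a power. Distinct matched colors have
      -- multiplicity at most 1, which is why the regular model produces the pure power d^n.
      !-split : ∀ c → c ≤ 1 → d ! ≡ (d ∸ c) ! * d ^ c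
      !-split zero _ = sym (ℕₚ.*-identityʳ (d !))
      !-split (suc (suc _)) (ℕ.s≤s ())
      !-split (suc zero) _ = go d 0<d
        where
        go : ∀ d → 0 < d → d ! ≡ (d ∸ 1) ! * (d * 1)
        go (suc d) _ = solve 2 (λ d f → (con 1 :+ d) :* f := f :* ((con 1 :+ d) :* con 1)) refl d (d !)

      module _ {v : Vec (Fin s) n} (u : Unique v) where

        private
          rest : Fin s → ℕ
          rest i = d ∸ # i ∈ v

          rest+# : ∀ i → rest i + # i ∈ v ≡ d
          rest+# i = ℕₚ.m∸n+n≡m (ℕₚ.≤-trans (#≤1 i u) 0<d)

          ∑-rest : ∑ (allFin s) rest ≡ n * m
          ∑-rest = ℕₚ.+-cancelʳ-≡ n _ _ (begin
            ∑ (allFin s) rest + n                                   ≡⟨ cong (λ a → ∑ (allFin s) rest + a) (∑-# v) ⟨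
            ∑ (allFin s) rest + ∑ (allFin s) (λ i → # i ∈ v)        ≡⟨ ∑-+ (allFin s) rest (λ i → # i ∈ v) ⟨
            ∑ (allFin s) (λ i → rest i + # i ∈ v)                   ≡⟨ ∑-cong (allFin s) rest+# ⟩
            ∑ (allFin s) (λ _ → d)                                  ≡⟨ ∑-allFin-const s d ⟩
            s * d                                                   ≡⟨ trans (ℕₚ.*-comm s d) ds≡nn ⟩
            n * n                                                   ≡⟨ trans (ℕₚ.*-suc n m) (ℕₚ.+-comm n (n * m)) ⟩
            n * m + n                                               ∎)

          d!^s : (d !) ^ s ≡ ∏ s (λ i → rest i !) * d ^ n
          d!^s = begin
            (d !) ^ s                                                 ≡⟨ ∏-const s (d !) ⟨
            ∏ s (λ _ → d !)                                         ≡⟨ ∏-cong s (λ i → !-split (# i ∈ v) (#≤1 i u)) ⟩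
            ∏ s (λ i → rest i ! * d ^ (# i ∈ v))                    ≡⟨ ∏-* s (λ i → rest i !) (λ i → d ^ (# i ∈ v)) ⟩
            ∏ s (λ i → rest i !) * ∏ s (λ i → d ^ (# i ∈ v))        ≡⟨ cong (∏ s (λ i → rest i !) *_) (trans (∏-^ s d (λ i → # i ∈ v)) (cong (d ^_) (∑-# v))) ⟩
            ∏ s (λ i → rest i !) * d ^ n                            ∎

        -- Once the matched colors are distinct, the other n · m entries must have content d minus
        -- the multiplicities, which is a multinomial count; its denominator differs from (d !)^s by
        -- exactly the factor d^n.
        count-extensions : (d !) ^ s * ∑ W (λ w → ⟦ content? (λ _ → d) (concat (insertEach w σ v)) ⟧) ≡ d ^ n * (n * m) !
        count-extensions = begin
          (d !) ^ s * ∑ W (λ w → ⟦ content? (λ _ → d) (concat (insertEach w σ v)) ⟧)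
            ≡⟨ cong₂ _*_ d!^s (trans (∑-cong W (λ w → ⟦⟧-cong (content? (λ _ → d) (concat (insertEach w σ v))) (content? rest (concat w))
                 (λ h i → ℕₚ.+-cancelˡ-≡ (# i ∈ v) _ _ (trans (sym (#-insertEach i w σ v)) (trans (h i) (trans (sym (rest+# i)) (ℕₚ.+-comm (rest i) (# i ∈ v))))))
                 (λ h i → trans (#-insertEach i w σ v) (trans (ℕₚ.+-comm (# i ∈ v) (# i ∈ concat w)) (trans (cong (_+ # i ∈ v) (h i)) (rest+# i))))))
                 (∑-concat (allFin s) m n (λ w → ⟦ content? rest w ⟧))) ⟩
          ∏ s (λ i → rest i !) * d ^ n * ∑ (vectors (allFin s) (n * m)) (λ w → ⟦ content? rest w ⟧)
            ≡⟨ solve 3 (λ a b c → a :* b :* c := b :* (a :* c)) refl (∏ s (λ i → rest i !)) (d ^ n) (∑ (vectors (allFin s) (n * m)) (λ w → ⟦ content? rest w ⟧)) ⟩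
          d ^ n * (∏ s (λ i → rest i !) * ∑ (vectors (allFin s) (n * m)) (λ w → ⟦ content? rest w ⟧))
            ≡⟨ cong (d ^ n *_) (multinomial (n * m) rest ∑-rest) ⟩
          d ^ n * (n * m) !
            ∎

      private
        rainbows = ∑ (regularColorings n s) (λ χ → ⟦ rainbow? (χ , σ) ⟧)

      count-rainbow : (d !) ^ s * rainbows ≡ s ↓ n * (d ^ n * (n * m) !)
      count-rainbow = begin
        (d !) ^ s * rainbows
          ≡⟨ cong ((d !) ^ s *_) (trans (∑-filter regular? (colorings n s) (λ χ → ⟦ rainbow? (χ , σ) ⟧))
               (trans (∑-insertEach (allFin s) σ (λ χ → ⟦ regular? χ ⟧ * ⟦ rainbow? (χ , σ) ⟧)) (∑-cong V (λ v → trans (∑-cong W (λ w →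
                 cong₂ _*_ (regular-content (insertEach w σ v)) (rainbow-insertEach v w))) (∑-*ʳ W ⟦ unique? v ⟧ (extended v)))))) ⟩
        (d !) ^ s * ∑ V (λ v → ∑ W (extended v) * ⟦ unique? v ⟧)
          ≡⟨ ∑-*ˡ V ((d !) ^ s) (λ v → ∑ W (extended v) * ⟦ unique? v ⟧) ⟨
        ∑ V (λ v → (d !) ^ s * (∑ W (extended v) * ⟦ unique? v ⟧))
          ≡⟨ ∑-cong V (λ v → extensions v (unique? v)) ⟩
        ∑ V (λ v → ⟦ unique? v ⟧ * (d ^ n * (n * m) !))
          ≡⟨ ∑-*ʳ V (d ^ n * (n * m) !) (λ v → ⟦ unique? v ⟧) ⟩
        ∑ V (λ v → ⟦ unique? v ⟧) * (d ^ n * (n * m) !)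
          ≡⟨ cong (_* (d ^ n * (n * m) !)) (∑-unique s n) ⟩
        s ↓ n * (d ^ n * (n * m) !)
          ∎
        where
        extended : Vec (Fin s) n → Vec (Vec (Fin s) m) n → ℕ
        extended v w = ⟦ content? (λ _ → d) (concat (insertEach w σ v)) ⟧
        extensions : ∀ v (u? : Dec (Unique v)) → (d !) ^ s * (∑ W (extended v) * ⟦ u? ⟧) ≡ ⟦ u? ⟧ * (d ^ n * (n * m) !)
        extensions v (yes u) = trans (cong ((d !) ^ s *_) (ℕₚ.*-identityʳ (∑ W (extended v))))
          (trans (count-extensions u) (sym (ℕₚ.*-identityˡ (d ^ n * (n * m) !))))
        extensions v (no _) = trans (cong ((d !) ^ s *_) (ℕₚ.*-zeroʳ (∑ W (extended v)))) (ℕₚ.*-zeroʳ ((d !) ^ s))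

      -- The proportion of rainbow colorings is (s ↓ n) · d^n · (n² - n)! / (n²)!. By d s = n² the
      -- power d^n equals (n²)^n / s^n, and the factorials leave (n²) ↓ n in the denominator, so d
      -- disappears.
      count-regular-rainbow : rainbows * ((n * n) ↓ n * s ^ n) ≡ s ↓ n * (n * n) ^ n * length (regularColorings n s)
      count-regular-rainbow = ℕₚ.*-cancelˡ-≡ _ _ D {{ℕₚ.m^n≢0 (d !) s {{d ℕₚ.!≢0}}}} (begin
        D * (rainbows * (P * s ^ n))                      ≡⟨ solve 4 (λ D r p q → D :* (r :* (p :* q)) := D :* r :* (p :* q)) refl D rainbows P (s ^ n) ⟩
        D * rainbows * (P * s ^ n)                        ≡⟨ cong (_* (P * s ^ n)) count-rainbow ⟩
        s ↓ n * (d ^ n * (n * m) !) * (P * s ^ n)         ≡⟨ solve 5 (λ f d g p q → f :* (d :* g) :* (p :* q) := f :* (d :* q) :* (p :* g)) refl (s ↓ n) (d ^ n) ((n * m) !) P (s ^ n) ⟩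
        s ↓ n * (d ^ n * s ^ n) * (P * (n * m) !)         ≡⟨ cong₂ (λ a b → s ↓ n * a * b) (trans (sym (^-distribʳ-* d s n)) (cong (_^ n) ds≡nn)) P! ⟩
        s ↓ n * (n * n) ^ n * (n * n) !                   ≡⟨ cong (s ↓ n * (n * n) ^ n *_) count-regular ⟨
        s ↓ n * (n * n) ^ n * (D * R)                     ≡⟨ solve 4 (λ a b D R → a :* b :* (D :* R) := D :* (a :* b :* R)) refl (s ↓ n) ((n * n) ^ n) D R ⟩
        D * (s ↓ n * (n * n) ^ n * R)                     ∎)
        where
        D = (d !) ^ s
        P = (n * n) ↓ n
        R = length (regularColorings n s)
        P! : P * (n * m) ! ≡ (n * n) !
        P! = trans (cong (λ a → P * a !) (sym (trans (cong (_∸ n) (ℕₚ.*-suc n m)) (ℕₚ.m+n∸m≡n n (n * m)))))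
          (↓-! {n * n} {n} (ℕₚ.m≤m*n n n))

      -- The length times (d !)^s is (n²)!, hence nonzero. This excludes the default value 0 of
      -- `Pr`.
      regularColorings-nonempty : 0 < length (regularColorings n s)
      regularColorings-nonempty = ℕ.>-nonZero⁻¹ _ {{ℕₚ.m*n≢0⇒n≢0 ((d !) ^ s) {{subst ℕ.NonZero (sym count-regular) ((n * n) ℕₚ.!≢0)}}}}

  module _ {A : Set} {P : Pred A 0ℓ} (P? : Decidable P) where

    Pr-value : ∀ Ω X Y → length (filter P? Ω) * X ≡ Y * length Ω → 0 < length Ω → Pr Ω P? ℚ.* fromNat X ≡ fromNat Y
    Pr-value Ω X Y eq 0<Ω with length Ω
    Pr-value Ω X Y eq () | zero
    ... | suc m = begin
      (+ N / suc m) ℚ.* fromNat X                            ≡⟨ cong (ℚ._* fromNat X) (FromNat./-fromNat N (suc m)) ⟩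
      fromNat N ℚ.* i ℚ.* fromNat X                          ≡⟨ trans (ℚₚ.*-assoc (fromNat N) i (fromNat X)) (trans (cong (fromNat N ℚ.*_) (ℚₚ.*-comm i (fromNat X))) (sym (ℚₚ.*-assoc (fromNat N) (fromNat X) i))) ⟩
      fromNat N ℚ.* fromNat X ℚ.* i                          ≡⟨ cong (ℚ._* i) (trans (sym (FromNat.fromNat-* N X)) (trans (cong fromNat eq) (FromNat.fromNat-* Y (suc m)))) ⟩
      fromNat Y ℚ.* fromNat (suc m) ℚ.* i                    ≡⟨ ℚₚ.*-assoc (fromNat Y) (fromNat (suc m)) i ⟩
      fromNat Y ℚ.* (fromNat (suc m) ℚ.* i)                  ≡⟨ cong (fromNat Y ℚ.*_) (fromNat-recip m) ⟩
      fromNat Y ℚ.* 1ℚ                                       ≡⟨ ℚₚ.*-identityʳ (fromNat Y) ⟩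
      fromNat Y                                              ∎
      where
      N = length (filter P? Ω)
      i = + 1 / suc m

  -- The proportion of suitable x is the same Y / X for each y, so averaging over y does not change
  -- it.
  Pr-product : ∀ {A B : Set} {P : Pred (A × B) 0ℓ} (P? : Decidable P) (xs : List A) (ys : List B) X Y →
    (∀ y → ∑ xs (λ x → ⟦ P? (x , y) ⟧) * X ≡ Y * length xs) → 0 < length xs → 0 < length ys →
    Pr (cartesianProduct xs ys) P? ℚ.* fromNat X ≡ fromNat Y
  Pr-product P? xs ys X Y count 0<xs 0<ys = Pr-value P? Ω X Y (begin
    length (filter P? Ω) * X                                  ≡⟨ cong (_* X) (trans (length-filter-∑ P? Ω) (trans (∑-product _,_ xs ys (λ z → ⟦ P? z ⟧)) (∑-swap xs ys (λ x y → ⟦ P? (x , y) ⟧)))) ⟩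
    ∑ ys (λ y → ∑ xs (λ x → ⟦ P? (x , y) ⟧)) * X              ≡⟨ ∑-*ʳ ys X (λ y → ∑ xs (λ x → ⟦ P? (x , y) ⟧)) ⟨
    ∑ ys (λ y → ∑ xs (λ x → ⟦ P? (x , y) ⟧) * X)              ≡⟨ ∑-cong ys count ⟩
    ∑ ys (λ _ → Y * length xs)                                ≡⟨ ∑-const ys (Y * length xs) ⟩
    length ys * (Y * length xs)                               ≡⟨ solve 3 (λ y Y x → y :* (Y :* x) := Y :* (x :* y)) refl (length ys) Y (length xs) ⟩
    Y * (length xs * length ys)                               ≡⟨ cong (Y *_) length-Ω ⟨
    Y * length Ω                                              ∎)
    (subst (0 <_) (sym length-Ω) (ℕₚ.*-mono-≤ 0<xs 0<ys))
    where
    Ω = cartesianProduct xs ys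
    length-Ω : length Ω ≡ length xs * length ys
    length-Ω = trans (length-∑ Ω) (trans (∑-product _,_ xs ys (λ _ → 1))
      (trans (∑-const xs (∑ ys (λ _ → 1))) (cong (length xs *_) (sym (length-∑ ys)))))

  uniformPr-formula : ∀ n s .{{_ : ℕ.NonZero n}} → n ≤ s → uniformPr n s ℚ.* fromNat (s ^ n) ≡ fromNat (s ↓ n)
  uniformPr-formula (suc m) s n≤s = Pr-product rainbow? (colorings (suc m) s) (perfectMatchings (suc m)) (s ^ suc m) (s ↓ suc m)
    (count-uniform m s) (ℕ.>-nonZero⁻¹ _ {{subst ℕ.NonZero (sym size) (ℕₚ.m^n≢0 (s ^ suc m) (suc m) {{ℕₚ.m^n≢0 s (suc m)}})}}) (length-perfectMatchings (suc m))
    where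
    instance
      s≢0 : ℕ.NonZero s
      s≢0 = ℕ.>-nonZero (ℕₚ.≤-trans (ℕ.s≤s ℕ.z≤n) n≤s)
    size : length (colorings (suc m) s) ≡ (s ^ suc m) ^ suc m
    size = trans (length-vectors (vectors (allFin s) (suc m)) (suc m))
      (cong (_^ suc m) (trans (length-vectors (allFin s) (suc m)) (cong (_^ suc m) (length-tabulate {n = s} id))))

  regularPr-formula : ∀ n s .{{_ : ℕ.NonZero n}} → s ∣ n * n →
    regularPr n s ℚ.* fromNat ((n * n) ↓ n * s ^ n) ≡ fromNat (s ↓ n * (n * n) ^ n)
  regularPr-formula (suc m) s (divides d nn≡ds) = Pr-product rainbow? (regularColorings n s) (perfectMatchings n) ((n * n) ↓ n * s ^ n) (s ↓ n * (n * n) ^ n)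
    -- Nonemptiness does not depend on σ; the constant vector merely fills the parameter.
    (λ σ → count-regular-rainbow m s σ d (sym nn≡ds)) (regularColorings-nonempty m s (Vec.replicate n zero) d (sym nn≡ds)) (length-perfectMatchings n)
    where n = suc m

-- Harmonic sums.

module Harmonic where

  open ℤ using (+_)
  open Rational
  open ℚ using (_+_; _*_; -_; _-_; _≤_; _<_)
  open Defs.Sequence using (0<*; 0≤*; *-monoˡ; *-monoʳ; *-mono; fromNat; fromNat≥0; fromNat-suc; fromNat-mono; 0≤1/; archimedean; reciprocal)
  open FromNat
  open +-*-Solver

  zero⊎positive : ∀ n → n ≡ 0 ⊎ 0 ℕ.< n
  zero⊎positive zero = inj₁ refl
  zero⊎positive (suc n) = inj₂ (ℕ.s≤s ℕ.z≤n)

  -- The convention 1 / 0 = 0 makes `ratio s (s ∸ m)` total; at m = s its logarithm is multiplied by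
  -- 0 in `integral`.
  recip : ℕ → ℚ
  recip zero = 0ℚ
  recip (suc n) = + 1 / suc n

  recip-nonneg : ∀ n → 0ℚ ≤ recip n
  recip-nonneg zero = ℚₚ.≤-refl
  recip-nonneg (suc n) = 0≤1/ (suc n)

  *-recip : ∀ {n} → 0 ℕ.< n → fromNat n * recip n ≡ 1ℚ
  *-recip {suc n} _ = Defs.Sequence.fromNat-* n

  recip≤1 : ∀ n → recip n ≤ 1ℚ
  recip≤1 zero = 0≤1
  recip≤1 (suc n) = subst₂ _≤_ (ℚₚ.*-identityˡ (recip (suc n))) (*-recip {suc n} (ℕ.s≤s ℕ.z≤n))
    (*-monoʳ (recip-nonneg (suc n)) (fromNat-mono {1} {suc n} (ℕ.s≤s ℕ.z≤n)))

  ratio : ℕ → ℕ → ℚ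
  ratio a b = fromNat a * recip b

  ratio-mono : ∀ {a b} c → a ℕ.≤ b → ratio a c ≤ ratio b c
  ratio-mono c a≤b = *-monoʳ (recip-nonneg c) (fromNat-mono a≤b)

  1≤ratio : ∀ {a b} → 0 ℕ.< b → b ℕ.≤ a → 1ℚ ≤ ratio a b
  1≤ratio {a} {b} 0<b b≤a = subst (_≤ ratio a b) (*-recip 0<b) (ratio-mono b b≤a)

  *-ratio : ∀ {a b} → 0 ℕ.< b → fromNat b * ratio a b ≡ fromNat a
  *-ratio {a} {b} 0<b = trans (solve 3 (λ a b r → b :* (a :* r) := a :* (b :* r)) refl (fromNat a) (fromNat b) (recip b))
    (trans (cong (fromNat a *_) (*-recip 0<b)) (ℚₚ.*-identityʳ (fromNat a)))

  -- The sum of 1 / y over s - m < y ≤ s.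
  harmonic : ℕ → ℕ → ℚ
  harmonic s zero = 0ℚ
  harmonic s (suc m) = recip (s ℕ.∸ m) + harmonic s m

  harmonic-nonneg : ∀ s m → 0ℚ ≤ harmonic s m
  harmonic-nonneg s zero = ℚₚ.≤-refl
  harmonic-nonneg s (suc m) = 0≤+ (recip-nonneg (s ℕ.∸ m)) (harmonic-nonneg s m)

  -- The recursion of `harmonic` adds the smallest y, whereas here the largest is split off. On the
  -- diagonal this gives the usual H (n + 1) = H n + 1 / (n + 1).
  harmonic-suc : ∀ n m → harmonic (suc n) (suc m) ≡ recip (suc n) + harmonic n m
  harmonic-suc n zero = refl
  harmonic-suc n (suc m) = trans (cong (λ a → recip (n ℕ.∸ m) + a) (harmonic-suc n m))
    (solve 3 (λ a b c → a :+ (b :+ c) := b :+ (a :+ c)) refl (recip (n ℕ.∸ m)) (recip (suc n)) (harmonic n m))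

  -- Termwise s / (s - i) ≤ n / (n - i), because s (n - i) ≤ n (s - i) for n ≤ s. This reduces the
  -- error for every s to the case s = n.
  harmonic-scale : ∀ {n s} → n ℕ.≤ s → ∀ m → m ℕ.≤ n → fromNat s * harmonic s m ≤ fromNat n * harmonic n m
  harmonic-scale {n} {s} n≤s zero _ = ℚₚ.≤-reflexive (trans (ℚₚ.*-zeroʳ (fromNat s)) (sym (ℚₚ.*-zeroʳ (fromNat n))))
  harmonic-scale {n} {s} n≤s (suc m) m<n = begin
    fromNat s * (recip (s ℕ.∸ m) + harmonic s m)                ≡⟨ ℚₚ.*-distribˡ-+ (fromNat s) (recip (s ℕ.∸ m)) (harmonic s m) ⟩
    ratio s (s ℕ.∸ m) + fromNat s * harmonic s m                ≤⟨ ℚₚ.+-mono-≤ term (harmonic-scale n≤s m (ℕₚ.<⇒≤ m<n)) ⟩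
    ratio n (n ℕ.∸ m) + fromNat n * harmonic n m                ≡⟨ ℚₚ.*-distribˡ-+ (fromNat n) (recip (n ℕ.∸ m)) (harmonic n m) ⟨
    fromNat n * (recip (n ℕ.∸ m) + harmonic n m)                ∎
    where
    open ℚₚ.≤-Reasoning
    0<s-m : 0 ℕ.< s ℕ.∸ m
    0<s-m = ℕₚ.m<n⇒0<n∸m (ℕₚ.<-≤-trans m<n n≤s)
    0<n-m : 0 ℕ.< n ℕ.∸ m
    0<n-m = ℕₚ.m<n⇒0<n∸m m<n
    cross : s ℕ.* (n ℕ.∸ m) ℕ.≤ n ℕ.* (s ℕ.∸ m)
    cross = subst₂ ℕ._≤_ (sym (ℕₚ.*-distribˡ-∸ s n m)) (sym (ℕₚ.*-distribˡ-∸ n s m))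
      (ℕₚ.∸-mono (ℕₚ.≤-reflexive (ℕₚ.*-comm s n)) (ℕₚ.*-monoˡ-≤ m n≤s))
    term : ratio s (s ℕ.∸ m) ≤ ratio n (n ℕ.∸ m)
    term = cancelˡ-≤ (0<* (fromNat-pos 0<s-m) (fromNat-pos 0<n-m)) (begin
      fromNat (s ℕ.∸ m) * fromNat (n ℕ.∸ m) * ratio s (s ℕ.∸ m)      ≡⟨ solve 3 (λ a b r → a :* b :* r := (a :* r) :* b) refl (fromNat (s ℕ.∸ m)) (fromNat (n ℕ.∸ m)) (ratio s (s ℕ.∸ m)) ⟩
      fromNat (s ℕ.∸ m) * ratio s (s ℕ.∸ m) * fromNat (n ℕ.∸ m)      ≡⟨ cong (_* fromNat (n ℕ.∸ m)) (*-ratio {s} 0<s-m) ⟩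
      fromNat s * fromNat (n ℕ.∸ m)                                  ≡⟨ fromNat-* s (n ℕ.∸ m) ⟨
      fromNat (s ℕ.* (n ℕ.∸ m))                                      ≤⟨ fromNat-mono cross ⟩
      fromNat (n ℕ.* (s ℕ.∸ m))                                      ≡⟨ fromNat-* n (s ℕ.∸ m) ⟩
      fromNat n * fromNat (s ℕ.∸ m)                                  ≡⟨ cong (_* fromNat (s ℕ.∸ m)) (*-ratio {n} 0<n-m) ⟨
      fromNat (n ℕ.∸ m) * ratio n (n ℕ.∸ m) * fromNat (s ℕ.∸ m)      ≡⟨ solve 3 (λ a b r → (b :* r) :* a := a :* b :* r) refl (fromNat (s ℕ.∸ m)) (fromNat (n ℕ.∸ m)) (ratio n (n ℕ.∸ m)) ⟩
      fromNat (s ℕ.∸ m) * fromNat (n ℕ.∸ m) * ratio n (n ℕ.∸ m)      ∎)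

  harmonic≤n : ∀ n → harmonic n n ≤ fromNat n
  harmonic≤n zero = ℚₚ.≤-refl
  harmonic≤n (suc n) = subst₂ _≤_ (sym (harmonic-suc n n)) (sym (fromNat-suc n)) (ℚₚ.+-mono-≤ (recip≤1 (suc n)) (harmonic≤n n))

  -- Since H n ≤ n, one step raises the square by 2 H n / (n + 1) + 1 / (n + 1)² ≤ 3.
  harmonic² : ∀ n → harmonic n n * harmonic n n ≤ fromNat 3 * fromNat n
  harmonic² zero = ℚₚ.≤-refl
  harmonic² (suc n) = begin
    harmonic (suc n) (suc n) * harmonic (suc n) (suc n)   ≡⟨ cong (λ a → a * a) (harmonic-suc n n) ⟩
    (r + h) * (r + h)                                     ≡⟨ solve 2 (λ r h → (r :+ h) :* (r :+ h) := h :* h :+ (r :* h :+ r :* h :+ r :* r)) refl r h ⟩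
    h * h + (r * h + r * h + r * r)                       ≤⟨ ℚₚ.+-mono-≤ (harmonic² n) (ℚₚ.+-mono-≤ (ℚₚ.+-mono-≤ rh≤1 rh≤1) (*-mono (recip-nonneg (suc n)) 0≤1 (recip≤1 (suc n)) (recip≤1 (suc n)))) ⟩
    fromNat 3 * fromNat n + (1ℚ + 1ℚ + 1ℚ * 1ℚ)           ≡⟨ solve 1 (λ n → con (fromNat 3) :* n :+ con (fromNat 3) := con (fromNat 3) :* (con 1ℚ :+ n)) refl (fromNat n) ⟩
    fromNat 3 * (1ℚ + fromNat n)                          ≡⟨ cong (fromNat 3 *_) (fromNat-suc n) ⟨
    fromNat 3 * fromNat (suc n)                           ∎
    where
    open ℚₚ.≤-Reasoning
    r = recip (suc n)
    h = harmonic n n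
    rh≤1 : r * h ≤ 1ℚ
    rh≤1 = subst (r * h ≤_) (trans (ℚₚ.*-comm r (fromNat (suc n))) (*-recip {suc n} (ℕ.s≤s ℕ.z≤n)))
      (*-monoˡ (recip-nonneg (suc n)) (ℚₚ.≤-trans (harmonic≤n n) (fromNat-mono (ℕₚ.n≤1+n n))))

  ²-cancel-≤ : ∀ {a b} → 0ℚ ≤ b → a * a ≤ b * b → a ≤ b
  ²-cancel-≤ {a} {b} 0≤b aa≤bb with a ℚₚ.≤? b
  ... | yes a≤b = a≤b
  ... | no a≰b = ⊥-elim (ℚₚ.<-irrefl refl (ℚₚ.≤-<-trans aa≤bb (ℚₚ.≤-<-trans (*-monoʳ 0≤b (ℚₚ.<⇒≤ b<a))
                   (ℚₚ.*-monoʳ-<-pos a {{ℚ.positive (ℚₚ.≤-<-trans 0≤b b<a)}} b<a))))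
    where b<a = ℚₚ.≰⇒> a≰b

  harmonic-small : ∀ ε → 0ℚ < ε → ∃[ N ] (∀ n → N ℕ.≤ n → harmonic n n ≤ ε * fromNat n)
  harmonic-small ε 0<ε = proj₁ arch , λ n N≤n → ²-cancel-≤ (0≤* 0≤ε (fromNat≥0 n)) (begin
    harmonic n n * harmonic n n                    ≤⟨ harmonic² n ⟩
    fromNat 3 * fromNat n                          ≡⟨ ℚₚ.*-identityˡ (fromNat 3 * fromNat n) ⟨
    1ℚ * (fromNat 3 * fromNat n)                   ≡⟨ cong (_* (fromNat 3 * fromNat n)) (proj₂ (proj₂ rec)) ⟨
    ε * ε * r * (fromNat 3 * fromNat n)            ≡⟨ solve 4 (λ e r t n → e :* e :* r :* (t :* n) := e :* e :* n :* (t :* r)) refl ε r (fromNat 3) (fromNat n) ⟩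
    ε * ε * fromNat n * (fromNat 3 * r)            ≤⟨ *-monoˡ (0≤* (0≤* 0≤ε 0≤ε) (fromNat≥0 n)) (ℚₚ.≤-trans (proj₂ arch) (fromNat-mono N≤n)) ⟩
    ε * ε * fromNat n * fromNat n                  ≡⟨ solve 2 (λ e n → e :* e :* n :* n := e :* n :* (e :* n)) refl ε (fromNat n) ⟩
    ε * fromNat n * (ε * fromNat n)                ∎)
    where
    open ℚₚ.≤-Reasoning
    0≤ε = ℚₚ.<⇒≤ 0<ε
    rec = reciprocal (ε * ε) (0<* 0<ε 0<ε)
    r = proj₁ rec
    arch = archimedean (fromNat 3 * r)

-- The sum of logarithms against its integral.

module LogSum where

  open Rational
  open Real
  open Exponential using (exp-cong)
  open Logarithm using (ln; ln-1; ln-upper; ln-lower)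
  open ExpLog
  open FromNat
  open Harmonic
  open Counting using (_↓_)
  open ℚ using (_+_; _*_; -_; _-_; _≤_; _<_)
  open Defs.Sequence using (0<*; 0≤*; *-monoˡ; fromNat; fromNat≥0; fromNat-suc; fromNat-mono)
  open +-*-Solver

  logSum : ℕ → ℕ → ℝ
  logSum s zero = fromℚ 0ℚ
  logSum s (suc m) = ln (ratio s (s ℕ.∸ m)) +ᴿ logSum s m

  -- `exp-ln` trades the summand log (s / (s - m)) of the exponent for the factor (s - m) / s, with
  -- the remaining summands in the role of its free real. Here a is kept free in turn: it will be 0
  -- in the uniform model and minus a second such sum in the regular one.
  exp-logSum : ∀ s m → m ℕ.≤ s → ∀ a →
    fromℚ (fromNat (s ℕ.^ m)) *ᴿ exp (-ᴿ (logSum s m +ᴿ a)) ≃ fromℚ (fromNat (s ↓ m)) *ᴿ exp (-ᴿ a)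
  exp-logSum s zero _ a = scale-cong 1ℚ {exp (-ᴿ (fromℚ 0ℚ +ᴿ a))} {exp (-ᴿ a)}
    (exp-cong { -ᴿ (fromℚ 0ℚ +ᴿ a)} { -ᴿ a} (≃-pointwise { -ᴿ (fromℚ 0ℚ +ᴿ a)} { -ᴿ a} (λ n → cong -_ (ℚₚ.+-identityˡ (seq a n)))))
  exp-logSum s (suc m) m<s a =
    ≃-trans {fromℚ (fromNat (s ℕ.^ suc m)) *ᴿ E} {fromℚ (y * S) *ᴿ (fromℚ p *ᴿ E)} {fromℚ (fromNat (s ↓ suc m)) *ᴿ A}
      (≃-pointwise {fromℚ (fromNat (s ℕ.^ suc m)) *ᴿ E} {fromℚ (y * S) *ᴿ (fromℚ p *ᴿ E)} (λ n → split (seq E n)))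
    (≃-trans {fromℚ (y * S) *ᴿ (fromℚ p *ᴿ E)} {fromℚ (y * S) *ᴿ E₁} {fromℚ (fromNat (s ↓ suc m)) *ᴿ A}
      (scale-cong (y * S) {fromℚ p *ᴿ E} {E₁} (≃-trans {fromℚ p *ᴿ E} {fromℚ p *ᴿ E₂} {E₁} (scale-cong p {E} {E₂} assoc) (exp-ln (logSum s m +ᴿ a) (1≤ratio 0<y (ℕₚ.m∸n≤m s m)))))
    (≃-trans {fromℚ (y * S) *ᴿ E₁} {fromℚ y *ᴿ (fromℚ S *ᴿ E₁)} {fromℚ (fromNat (s ↓ suc m)) *ᴿ A}
      (≃-pointwise {fromℚ (y * S) *ᴿ E₁} {fromℚ y *ᴿ (fromℚ S *ᴿ E₁)} (λ n → ℚₚ.*-assoc y S (seq E₁ n)))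
    (≃-trans {fromℚ y *ᴿ (fromℚ S *ᴿ E₁)} {fromℚ y *ᴿ (fromℚ (fromNat (s ↓ m)) *ᴿ A)} {fromℚ (fromNat (s ↓ suc m)) *ᴿ A}
      (scale-cong y {fromℚ S *ᴿ E₁} {fromℚ (fromNat (s ↓ m)) *ᴿ A} (exp-logSum s m (ℕₚ.<⇒≤ m<s) a))
      (≃-pointwise {fromℚ y *ᴿ (fromℚ (fromNat (s ↓ m)) *ᴿ A)} {fromℚ (fromNat (s ↓ suc m)) *ᴿ A} (λ n →
        trans (sym (ℚₚ.*-assoc y (fromNat (s ↓ m)) (seq A n))) (cong (_* seq A n) (sym (fromNat-* (s ℕ.∸ m) (s ↓ m)))))))))
    where
    y = fromNat (s ℕ.∸ m)
    S = fromNat (s ℕ.^ m)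
    p = ratio s (s ℕ.∸ m)
    A = exp (-ᴿ a)
    E = exp (-ᴿ ((ln p +ᴿ logSum s m) +ᴿ a))
    E₁ = exp (-ᴿ (logSum s m +ᴿ a))
    E₂ = exp (-ᴿ (ln p +ᴿ (logSum s m +ᴿ a)))
    0<y : 0 ℕ.< s ℕ.∸ m
    0<y = ℕₚ.m<n⇒0<n∸m m<s
    assoc : E ≃ E₂
    assoc = exp-cong { -ᴿ ((ln p +ᴿ logSum s m) +ᴿ a)} { -ᴿ (ln p +ᴿ (logSum s m +ᴿ a))}
      (≃-pointwise { -ᴿ ((ln p +ᴿ logSum s m) +ᴿ a)} { -ᴿ (ln p +ᴿ (logSum s m +ᴿ a))} (λ n → cong -_ (ℚₚ.+-assoc (seq (ln p) n) (seq (logSum s m) n) (seq a n))))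
    split : ∀ e → fromNat (s ℕ.^ suc m) * e ≡ y * S * (p * e)
    split e = trans (cong (_* e) (trans (fromNat-* s (s ℕ.^ m)) (cong (_* S) (sym (*-ratio {s} 0<y)))))
      (solve 4 (λ y p S e → (y :* p) :* S :* e := y :* S :* (p :* e)) refl y p S e)

  -- The integral of - log (1 - x / s) over 0 ≤ x ≤ m, in closed form.
  integral : ℕ → ℕ → ℝ
  integral s m = fromℚ (fromNat m) -ᴿ fromℚ (fromNat (s ℕ.∸ m)) *ᴿ ln (ratio s (s ℕ.∸ m))

  excess : ℕ → ℕ → ℝ
  excess s m = integral s m -ᴿ logSum s m

  module Step {s m : ℕ} (m<s : m ℕ.< s) where

    -- Here y stands for s ∸ m, written as a successor so that y = y′ + 1 holds by computation.
    y y′ : ℕ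
    y = suc (s ℕ.∸ suc m)
    y′ = s ℕ.∸ suc m

    y≡ : s ℕ.∸ m ≡ y
    y≡ = ℕₚ.+-∸-assoc 1 m<s

    y≤s : y ℕ.≤ s
    y≤s = subst (ℕ._≤ s) y≡ (ℕₚ.m∸n≤m s m)

    λᴿ : ℝ
    λᴿ = ln (ratio s y′) -ᴿ ln (ratio s y)

    Δ : ℝ
    Δ = fromℚ 1ℚ -ᴿ fromℚ (fromNat y′) *ᴿ λᴿ

    -- From m to m + 1 the integral changes by 1 - y′ log (s / y′) + y log (s / y) and the sum by
    -- log (s / y). By y = y′ + 1 the difference is 1 - y′ (log (s / y′) - log (s / y)).
    excess-suc : ∀ n → seq (excess s (suc m)) n ≡ seq (excess s m +ᴿ Δ) n
    excess-suc n = trans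
      (cong₂ (λ a b → (a - fromNat y′ * seq (ln (ratio s y′)) n) - (seq (ln (ratio s b)) n + seq (logSum s m) n)) (fromNat-suc m) y≡)
      (trans (solve 5 (λ m y′ l′ l S → ((con 1ℚ :+ m) :- y′ :* l′) :- (l :+ S) := ((m :- (con 1ℚ :+ y′) :* l) :- S) :+ (con 1ℚ :- y′ :* (l′ :- l)))
          refl (fromNat m) (fromNat y′) (seq (ln (ratio s y′)) n) (seq (ln (ratio s y)) n) (seq (logSum s m) n))
        (cong₂ (λ a b → ((fromNat m - a * seq (ln (ratio s b)) n) - seq (logSum s m) n) + seq Δ n)
          (trans (sym (fromNat-suc y′)) (cong fromNat (sym y≡))) (sym y≡)))

    module _ (0<y′ : 0 ℕ.< y′) where

      private
        S = fromNat s
        Y = fromNat y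
        Y′ = fromNat y′
        p = ratio s y′
        q = ratio s y
        is = recip s

        0<s : 0 ℕ.< s
        0<s = ℕₚ.≤-trans (ℕ.s≤s ℕ.z≤n) m<s

        S·is : S * is ≡ 1ℚ
        S·is = *-recip 0<s
        Yq : Y * q ≡ S
        Yq = *-ratio {s} {y} (ℕ.s≤s ℕ.z≤n)
        Y′p : Y′ * p ≡ S
        Y′p = *-ratio {s} 0<y′

        1≤q : 1ℚ ≤ q
        1≤q = 1≤ratio {s} {y} (ℕ.s≤s ℕ.z≤n) y≤s

        q≤p : q ≤ p
        q≤p = cancelˡ-≤ (0<* (fromNat-pos {y} (ℕ.s≤s ℕ.z≤n)) (fromNat-pos 0<y′)) (≤-by S (fromNat≥0 s)
          (trans (solve 4 (λ Y Y′ p q → Y :* Y′ :* p :- Y :* Y′ :* q := Y :* (Y′ :* p) :- Y′ :* (Y :* q)) refl Y Y′ p q)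
          (trans (cong₂ (λ a b → Y * a - Y′ * b) Y′p Yq)
          (trans (cong (λ a → a * S - Y′ * S) (fromNat-suc y′)) (solve 2 (λ y s → (con 1ℚ :+ y) :* s :- y :* s := s) refl Y′ S)))))

      -- `ln-upper` for p = s / y′ and q = s / y, multiplied by y y′ / s: the left side becomes y′
      -- times `λᴿ`, the right side y - y′ = 1.
      Y′λ≤1 : ∀ n → Y′ * seq λᴿ n ≤ 1ℚ
      Y′λ≤1 n = subst₂ _≤_
        (trans (solve 5 (λ Y Y′ i q l → Y :* Y′ :* i :* (q :* l) := (Y :* q) :* i :* (Y′ :* l)) refl Y Y′ is q (seq λᴿ n))
          (trans (cong (λ a → a * is * (Y′ * seq λᴿ n)) Yq) (trans (cong (_* (Y′ * seq λᴿ n)) S·is) (ℚₚ.*-identityˡ (Y′ * seq λᴿ n)))))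
        (trans (solve 5 (λ Y Y′ i p q → Y :* Y′ :* i :* (p :- q) := Y :* ((Y′ :* p) :* i) :- Y′ :* ((Y :* q) :* i)) refl Y Y′ is p q)
          (trans (cong₂ (λ a b → Y * (a * is) - Y′ * (b * is)) Y′p Yq) (trans (cong (λ a → Y * a - Y′ * a) S·is)
            (trans (cong (λ a → a * 1ℚ - Y′ * 1ℚ) (fromNat-suc y′)) (solve 1 (λ y → (con 1ℚ :+ y) :* con 1ℚ :- y :* con 1ℚ := con 1ℚ) refl Y′)))))
        (*-monoˡ (0≤* (0≤* (fromNat≥0 y) (fromNat≥0 y′)) (recip-nonneg s)) (ln-upper 1≤q q≤p n))

      -- `ln-lower` multiplied by y′² / s: y′ times `λᴿ` is at least y′² (1 / y′ - 1 / y) = y′ / y =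
      -- 1 - 1 / y.
      Δ≤ : Δ ≤ᴿ fromℚ (recip y)
      Δ≤ = ≤-rearrange {fromℚ k *ᴿ fromℚ (p - q)} {fromℚ k *ᴿ (fromℚ p *ᴿ λᴿ)} {Δ} {fromℚ (recip y)}
        (scale-mono {k} {fromℚ (p - q)} {fromℚ p *ᴿ λᴿ} (0≤* (0≤* (fromNat≥0 y′) (fromNat≥0 y′)) (recip-nonneg s)) (ln-lower 1≤q q≤p))
        (λ n → sym (trans (cong₂ _-_ (kp (seq λᴿ n)) k[p-q]) (solve 2 (λ l r → l :- (con 1ℚ :- r) := r :- (con 1ℚ :- l)) refl (Y′ * seq λᴿ n) (recip y))))
        where
        k = Y′ * Y′ * is
        kp : ∀ l → k * (p * l) ≡ Y′ * l
        kp l = trans (solve 4 (λ Y′ i p l → Y′ :* Y′ :* i :* (p :* l) := (Y′ :* p) :* i :* (Y′ :* l)) refl Y′ is p l)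
          (trans (cong (λ a → a * is * (Y′ * l)) Y′p) (trans (cong (_* (Y′ * l)) S·is) (ℚₚ.*-identityˡ (Y′ * l))))
        k[p-q] : k * (p - q) ≡ 1ℚ - recip y
        k[p-q] = trans (solve 5 (λ Y′ i p S r → Y′ :* Y′ :* i :* (p :- S :* r) := Y′ :* ((Y′ :* p) :* i) :- Y′ :* Y′ :* (S :* i) :* r) refl Y′ is p S (recip y))
          (trans (cong₂ (λ a b → Y′ * (a * is) - Y′ * Y′ * b * recip y) Y′p S·is) (trans (cong (λ a → Y′ * a - Y′ * Y′ * 1ℚ * recip y) S·is)
          (trans (cong (λ a → Y′ * a - Y′ * Y′ * a * recip y) (sym Y·iy))
          (trans (solve 3 (λ Y′ Y r → Y′ :* (Y :* r) :- Y′ :* Y′ :* (Y :* r) :* r := Y′ :* (Y :* r) :* (con 1ℚ :- Y′ :* r)) refl Y′ Y (recip y))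
          (trans (cong (λ a → Y′ * a * (1ℚ - Y′ * recip y)) Y·iy)
          (trans (cong (λ a → Y′ * 1ℚ * (a - Y′ * recip y)) (sym Y·iy))
          (trans (cong (λ a → Y′ * 1ℚ * (a * recip y - Y′ * recip y)) (fromNat-suc y′))
          (trans (solve 2 (λ Y′ r → Y′ :* con 1ℚ :* ((con 1ℚ :+ Y′) :* r :- Y′ :* r) := (con 1ℚ :+ Y′) :* r :- r) refl Y′ (recip y))
            (cong (_- recip y) (trans (cong (_* recip y) (sym (fromNat-suc y′))) Y·iy))))))))))
          where
          Y·iy : Y * recip y ≡ 1ℚ
          Y·iy = *-recip {y} (ℕ.s≤s ℕ.z≤n)

    0≤Δ : fromℚ 0ℚ ≤ᴿ Δ
    0≤Δ = ≤-pointwise {fromℚ 0ℚ} {Δ} (λ n → 0≤q-p (bound n (ℕ.s≤s ℕ.z≤n)))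
      where
      bound : ∀ n → 0 ℕ.< y → fromNat y′ * seq λᴿ n ≤ 1ℚ
      bound n _ with zero⊎positive y′
      ... | inj₁ y′≡0 = ℚₚ.≤-trans (ℚₚ.≤-reflexive (trans (cong (λ a → fromNat a * seq λᴿ n) y′≡0) (ℚₚ.*-zeroˡ (seq λᴿ n)))) 0≤1
      ... | inj₂ 0<y′ = Y′λ≤1 0<y′ n

    Δ≤recip : Δ ≤ᴿ fromℚ (recip y)
    Δ≤recip = cases (zero⊎positive y′)
      where
      cases : y′ ≡ 0 ⊎ 0 ℕ.< y′ → Δ ≤ᴿ fromℚ (recip y)
      -- The final step m + 1 = s, where s / y′ does not exist: y = 1, so `Δ` and `recip y` are both
      -- 1.
      cases (inj₁ y′≡0) = ≤-pointwise {Δ} {fromℚ (recip y)} (λ n → ℚₚ.≤-reflexive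
        (trans (cong (λ a → 1ℚ - fromNat a * seq λᴿ n) y′≡0)
        (trans (solve 1 (λ l → con 1ℚ :- con 0ℚ :* l := con 1ℚ) refl (seq λᴿ n)) (cong (λ a → recip (suc a)) (sym y′≡0)))))
      cases (inj₂ 0<y′) = Δ≤ 0<y′

  module _ {s : ℕ} (0<s : 0 ℕ.< s) where

    excess-zero : ∀ n → seq (excess s 0) n ≡ 0ℚ
    excess-zero n = trans (cong (λ a → (0ℚ - fromNat s * a) - 0ℚ) (trans (cong (λ a → seq (ln a) n) (*-recip 0<s)) (ln-1 n)))
      (solve 1 (λ s → (con 0ℚ :- s :* con 0ℚ) :- con 0ℚ := con 0ℚ) refl (fromNat s))

    0≤excess : ∀ m → m ℕ.≤ s → fromℚ 0ℚ ≤ᴿ excess s m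
    0≤excess zero _ = ≤-pointwise {fromℚ 0ℚ} {excess s 0} (λ n → ℚₚ.≤-reflexive (sym (excess-zero n)))
    0≤excess (suc m) m<s = ≤-trans {fromℚ 0ℚ} {excess s m +ᴿ Δ} {excess s (suc m)}
      (+-mono {fromℚ 0ℚ} {excess s m} {fromℚ 0ℚ} {Δ} (0≤excess m (ℕₚ.<⇒≤ m<s)) 0≤Δ)
      (≤-pointwise {excess s m +ᴿ Δ} {excess s (suc m)} (λ n → ℚₚ.≤-reflexive (sym (excess-suc n))))
      where open Step m<s

    excess≤ : ∀ m → m ℕ.≤ s → excess s m ≤ᴿ fromℚ (harmonic s m)
    excess≤ zero _ = ≤-pointwise {excess s 0} {fromℚ 0ℚ} (λ n → ℚₚ.≤-reflexive (excess-zero n))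
    excess≤ (suc m) m<s = ≤-trans {excess s (suc m)} {excess s m +ᴿ Δ} {fromℚ (harmonic s (suc m))}
      (≤-pointwise {excess s (suc m)} {excess s m +ᴿ Δ} (λ n → ℚₚ.≤-reflexive (excess-suc n)))
      (≤-trans {excess s m +ᴿ Δ} {fromℚ (harmonic s m) +ᴿ fromℚ (recip y)} {fromℚ (harmonic s (suc m))}
        (+-mono {excess s m} {fromℚ (harmonic s m)} {Δ} {fromℚ (recip y)} (excess≤ m (ℕₚ.<⇒≤ m<s)) Δ≤recip)
        (fromℚ-mono (ℚₚ.≤-reflexive (trans (ℚₚ.+-comm (harmonic s m) (recip y)) (cong (λ a → recip a + harmonic s m) (sym y≡))))))
      where open Step m<s

    -- Each summand satisfies log (s / (s - i)) ≥ i / s, which is `ln-lower` at q = 1, and the i / s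
    -- add up to m (m - 1) / 2s. This will keep c(k) away from 0.
    logSum-lower : ∀ m → m ℕ.≤ s → fromℚ (½ * (fromNat m * (fromNat m - 1ℚ)) * recip s) ≤ᴿ logSum s m
    logSum-lower zero _ = fromℚ-mono (ℚₚ.≤-reflexive (solve 1 (λ i → con ½ :* (con 0ℚ :* (con 0ℚ :- con 1ℚ)) :* i := con 0ℚ) refl (recip s)))
    logSum-lower (suc m) m<s = ≤-trans {fromℚ (T (fromNat (suc m)))} {fromℚ (fromNat m * i) +ᴿ fromℚ (T (fromNat m))} {logSum s (suc m)}
      (fromℚ-mono (ℚₚ.≤-reflexive (trans (cong T (fromNat-suc m))
        (solve 2 (λ m i → con ½ :* ((con 1ℚ :+ m) :* ((con 1ℚ :+ m) :- con 1ℚ)) :* i := m :* i :+ con ½ :* (m :* (m :- con 1ℚ)) :* i) refl (fromNat m) i))))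
      (+-mono {fromℚ (fromNat m * i)} {ln p} {fromℚ (T (fromNat m))} {logSum s m} first (logSum-lower m (ℕₚ.<⇒≤ m<s)))
      where
      i = recip s
      T : ℚ → ℚ
      T m = ½ * (m * (m - 1ℚ)) * i
      y = s ℕ.∸ m
      p = ratio s y
      0<y : 0 ℕ.< y
      0<y = ℕₚ.m<n⇒0<n∸m m<s
      1≤p : 1ℚ ≤ p
      1≤p = 1≤ratio 0<y (ℕₚ.m∸n≤m s m)
      k = fromNat y * i
      kp : k * p ≡ 1ℚ
      kp = trans (solve 3 (λ y i p → y :* i :* p := (y :* p) :* i) refl (fromNat y) i p) (trans (cong (_* i) (*-ratio {s} 0<y)) (*-recip 0<s))
      1-k : 1ℚ - k ≡ fromNat m * i
      1-k = trans (cong (_- k) (trans (sym (*-recip 0<s)) (cong (_* i) (trans (cong fromNat (sym (ℕₚ.m+[n∸m]≡n (ℕₚ.<⇒≤ m<s)))) (fromNat-+ m y)))))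
        (solve 3 (λ m y i → (m :+ y) :* i :- y :* i := m :* i) refl (fromNat m) (fromNat y) i)
      first : fromℚ (fromNat m * i) ≤ᴿ ln p
      first = ≤-rearrange {fromℚ k *ᴿ fromℚ (p - 1ℚ)} {fromℚ k *ᴿ (fromℚ p *ᴿ (ln p -ᴿ ln 1ℚ))} {fromℚ (fromNat m * i)} {ln p}
        (scale-mono {k} {fromℚ (p - 1ℚ)} {fromℚ p *ᴿ (ln p -ᴿ ln 1ℚ)} (0≤* (fromNat≥0 y) (recip-nonneg s)) (ln-lower ℚₚ.≤-refl 1≤p))
        (λ n → sym (trans (cong (λ a → k * (p * (seq (ln p) n - a)) - k * (p - 1ℚ)) (ln-1 n))
          (trans (solve 3 (λ k p l → k :* (p :* (l :- con 0ℚ)) :- k :* (p :- con 1ℚ) := k :* p :* l :- (k :* p :- k)) refl k p (seq (ln p) n))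
          (trans (cong (λ a → a * seq (ln p) n - (a - k)) kp) (cong₂ _-_ (ℚₚ.*-identityˡ (seq (ln p) n)) 1-k)))))

  logSum-nonneg : ∀ s m → m ℕ.≤ s → ∀ n → 0ℚ ≤ seq (logSum s m) n
  logSum-nonneg s zero _ n = ℚₚ.≤-refl
  logSum-nonneg s (suc m) m<s n = 0≤+ (ln-nonneg (1≤ratio (ℕₚ.m<n⇒0<n∸m m<s) (ℕₚ.m∸n≤m s m)) n) (logSum-nonneg s m (ℕₚ.<⇒≤ m<s) n)

  -- For i < n one has log (n² / (n² - i)) ≤ i / (n² - i) ≤ 1 / n, because n i + i ≤ n²; there are n
  -- such summands.
  logSum-square≤1 : ∀ {n} → 0 ℕ.< n → ∀ j → seq (logSum (n ℕ.* n) n) j ≤ 1ℚ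
  logSum-square≤1 {n} 0<n j = subst (seq (logSum N n) j ≤_) (*-recip 0<n) (partial n ℕₚ.≤-refl)
    where
    N = n ℕ.* n
    open ℚₚ.≤-Reasoning
    partial : ∀ m → m ℕ.≤ n → seq (logSum N m) j ≤ fromNat m * recip n
    partial zero _ = ℚₚ.≤-reflexive (sym (ℚₚ.*-zeroˡ (recip n)))
    partial (suc m) m<n = begin
      seq (ln p) j + seq (logSum N m) j     ≤⟨ ℚₚ.+-mono-≤ (ℚₚ.≤-trans (ln≤t-1 (1≤ratio 0<y (ℕₚ.m∸n≤m N m)) j) term) (partial m (ℕₚ.<⇒≤ m<n)) ⟩
      recip n + fromNat m * recip n         ≡⟨ solve 2 (λ m r → r :+ m :* r := (con 1ℚ :+ m) :* r) refl (fromNat m) (recip n) ⟩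
      (1ℚ + fromNat m) * recip n            ≡⟨ cong (_* recip n) (fromNat-suc m) ⟨
      fromNat (suc m) * recip n             ∎
      where
      y = N ℕ.∸ m
      p = ratio N y
      nm+m≤N : n ℕ.* m ℕ.+ m ℕ.≤ N
      nm+m≤N = ℕₚ.≤-trans (ℕₚ.+-monoʳ-≤ (n ℕ.* m) (ℕₚ.<⇒≤ m<n)) (ℕₚ.≤-trans (ℕₚ.≤-reflexive (trans (ℕₚ.+-comm (n ℕ.* m) n) (sym (ℕₚ.*-suc n m)))) (ℕₚ.*-monoʳ-≤ n m<n))
      m≤N : m ℕ.≤ N
      m≤N = ℕₚ.≤-trans (ℕₚ.m≤n+m m (n ℕ.* m)) nm+m≤N
      nm≤y : n ℕ.* m ℕ.≤ y
      nm≤y = subst (ℕ._≤ y) (ℕₚ.m+n∸n≡m (n ℕ.* m) m) (ℕₚ.∸-monoˡ-≤ m nm+m≤N)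
      0<y : 0 ℕ.< y
      0<y = ℕₚ.m<n⇒0<n∸m (ℕₚ.<-≤-trans m<n (ℕₚ.m≤m*n n n {{ℕ.>-nonZero 0<n}}))
      term : p - 1ℚ ≤ recip n
      term = cancelˡ-≤ (0<* (fromNat-pos 0<n) (fromNat-pos 0<y)) (begin
        fromNat n * fromNat y * (p - 1ℚ)               ≡⟨ solve 3 (λ n y p → n :* y :* (p :- con 1ℚ) := n :* (y :* p :- y)) refl (fromNat n) (fromNat y) p ⟩
        fromNat n * (fromNat y * p - fromNat y)        ≡⟨ cong (λ a → fromNat n * (a - fromNat y)) (trans (*-ratio {N} 0<y) (trans (cong fromNat (sym (ℕₚ.m+[n∸m]≡n m≤N))) (fromNat-+ m y))) ⟩
        fromNat n * ((fromNat m + fromNat y) - fromNat y)   ≡⟨ solve 3 (λ n m y → n :* ((m :+ y) :- y) := n :* m) refl (fromNat n) (fromNat m) (fromNat y) ⟩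
        fromNat n * fromNat m                          ≡⟨ fromNat-* n m ⟨
        fromNat (n ℕ.* m)                              ≤⟨ fromNat-mono nm≤y ⟩
        fromNat y                                      ≡⟨ ℚₚ.*-identityʳ (fromNat y) ⟨
        fromNat y * 1ℚ                                 ≡⟨ cong (fromNat y *_) (*-recip 0<n) ⟨
        fromNat y * (fromNat n * recip n)              ≡⟨ solve 3 (λ y n r → y :* (n :* r) := n :* y :* r) refl (fromNat y) (fromNat n) (recip n) ⟩
        fromNat n * fromNat y * recip n                ∎)

-- Division by a real bounded away from 0, and the correction term.

module Division where

  open ℤ using (+_)
  open Rational
  open Real
  open ℚ using (_+_; _*_; -_; _-_; _≤_; _<_; ∣_∣)
  open Defs.Sequence using (IsCauchy; dominated; 0≤*; *-monoˡ; *-monoʳ; *-mono; reciprocal)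
  open +-*-Solver

  ¼ : ℚ
  ¼ = + 1 / 4

  4ℚ : ℚ
  4ℚ = + 4 / 1

  0≤4 : 0ℚ ≤ 4ℚ
  0≤4 = ℚₚ.≤ᵇ⇒≤ _

  ⊔-contraction : ∀ c p q → (p ℚ.⊔ c) - (q ℚ.⊔ c) ≤ ∣ p - q ∣
  ⊔-contraction c p q = ≤-by (m - (p ℚ.⊔ c)) (0≤q-p (ℚₚ.⊔-lub p≤m c≤m))
    (solve 3 (λ a b d → d :- (a :- b) := (b :+ d) :- a) refl (p ℚ.⊔ c) (q ℚ.⊔ c) ∣ p - q ∣)
    where
    m = (q ℚ.⊔ c) + ∣ p - q ∣
    p≤m : p ≤ m
    p≤m = ℚₚ.≤-trans (ℚₚ.≤-reflexive (solve 2 (λ p q → p := q :+ (p :- q)) refl p q)) (ℚₚ.+-mono-≤ (ℚₚ.p≤p⊔q q c) (Defs.Sequence.p≤∣p∣ (p - q)))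
    c≤m : c ≤ m
    c≤m = ℚₚ.≤-trans (ℚₚ.≤-reflexive (sym (ℚₚ.+-identityʳ c))) (ℚₚ.+-mono-≤ (ℚₚ.p≤q⊔p q c) (ℚₚ.0≤∣p∣ (p - q)))

  private
    floor : ℚ → ℚ
    floor x = x ℚ.⊔ ¼

    0<floor : ∀ x → 0ℚ < floor x
    0<floor x = ℚₚ.<-≤-trans (ℚₚ.positive⁻¹ ¼) (ℚₚ.p≤q⊔p x ¼)

    r : ℚ → ℚ
    r x = proj₁ (reciprocal (floor x) (0<floor x))

    0≤r : ∀ x → 0ℚ ≤ r x
    0≤r x = ℚₚ.<⇒≤ (proj₁ (proj₂ (reciprocal (floor x) (0<floor x))))

    *-r : ∀ x → floor x * r x ≡ 1ℚ
    *-r x = proj₂ (proj₂ (reciprocal (floor x) (0<floor x)))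

    r≤4 : ∀ x → r x ≤ 4ℚ
    r≤4 x = begin
      r x                        ≡⟨ solve 1 (λ r → r := con 4ℚ :* (con ¼ :* r)) refl (r x) ⟩
      4ℚ * (¼ * r x)             ≤⟨ *-monoˡ 0≤4 (*-monoʳ (0≤r x) (ℚₚ.p≤q⊔p x ¼)) ⟩
      4ℚ * (floor x * r x)       ≡⟨ cong (4ℚ *_) (*-r x) ⟩
      4ℚ * 1ℚ                    ∎
      where open ℚₚ.≤-Reasoning

    -- This ties the two constants together: a real that is at least ½ eventually has approximations
    -- with ½ ≤ x + ¼, that is x ≥ ¼, and there the truncation has no effect.
    r-inverse : ∀ x → ½ ≤ x + ¼ → x * r x ≡ 1ℚ
    r-inverse x ½≤ = trans (cong (_* r x) (sym (ℚₚ.p≥q⇒p⊔q≡p {x} {¼} (≤-by {¼} {x} ((x + ¼) - ½) (0≤q-p ½≤)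
      (solve 1 (λ x → x :- con ¼ := (x :+ con ¼) :- con ½) refl x))))) (*-r x)

    -- From 1 / a - 1 / b = (b - a) / (a b) with both reciprocals at most 4: the truncated
    -- reciprocal is Lipschitz with constant 16, hence preserves Cauchy sequences.
    r-difference : ∀ x y → r x - r y ≤ 4ℚ * 4ℚ * ∣ x - y ∣
    r-difference x y = begin
      r x - r y                                          ≡⟨ cong₂ _-_ (ℚₚ.*-identityʳ (r x)) (ℚₚ.*-identityʳ (r y)) ⟨
      r x * 1ℚ - r y * 1ℚ                                ≡⟨ cong₂ (λ a b → r x * a - r y * b) (*-r y) (*-r x) ⟨
      r x * (floor y * r y) - r y * (floor x * r x)      ≡⟨ solve 4 (λ a b x y → a :* (y :* b) :- b :* (x :* a) := (a :* b) :* (y :- x)) refl (r x) (r y) (floor x) (floor y) ⟩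
      r x * r y * (floor y - floor x)                    ≤⟨ *-monoˡ (0≤* (0≤r x) (0≤r y)) (ℚₚ.≤-trans (⊔-contraction ¼ y x) (ℚₚ.≤-reflexive (Defs.Sequence.∣-∣-sym y x))) ⟩
      r x * r y * ∣ x - y ∣                              ≤⟨ *-monoʳ (ℚₚ.0≤∣p∣ (x - y)) (*-mono (0≤r x) 0≤4 (r≤4 x) (r≤4 y)) ⟩
      4ℚ * 4ℚ * ∣ x - y ∣                                ∎
      where open ℚₚ.≤-Reasoning

    r-cauchy : ∀ x → IsCauchy x → IsCauchy (λ n → r (x n))
    r-cauchy x cx = dominated x x (λ n → r (x n)) cx cx (4ℚ * 4ℚ) (ℚₚ.positive⁻¹ (4ℚ * 4ℚ)) 0 (λ m n _ _ →
      ℚₚ.≤-trans (∣∣≤ (r-difference (x m) (x n)) (flip (x m) (x n)))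
        (*-monoˡ {4ℚ * 4ℚ} {∣ x m - x n ∣} {∣ x m - x n ∣ + ∣ x m - x n ∣} (ℚₚ.≤ᵇ⇒≤ {0ℚ} {4ℚ * 4ℚ} _) (≤-by {∣ x m - x n ∣} {∣ x m - x n ∣ + ∣ x m - x n ∣} ∣ x m - x n ∣ (ℚₚ.0≤∣p∣ (x m - x n)) (solve 1 (λ d → (d :+ d) :- d := d) refl ∣ x m - x n ∣))))
      where
      flip : ∀ p q → - (r p - r q) ≤ 4ℚ * 4ℚ * ∣ p - q ∣
      flip p q = subst₂ _≤_ (solve 2 (λ a b → b :- a := :- (a :- b)) refl (r p) (r q))
        (cong (4ℚ * 4ℚ *_) (Defs.Sequence.∣-∣-sym q p)) (r-difference q p)

  abstract
    -- The reciprocal of max (x , ¼).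
    inv : ℝ → ℝ
    inv x = real (λ n → r (seq x n)) (r-cauchy (seq x) (isCauchy x))

    inv-bounded : ∀ x n → ∣ seq (inv x) n ∣ ≤ 4ℚ
    inv-bounded x n = ℚₚ.≤-trans (ℚₚ.≤-reflexive (ℚₚ.0≤p⇒∣p∣≡p (0≤r (seq x n)))) (r≤4 (seq x n))

    inv-inverse : ∀ x → fromℚ ½ ≤ᴿ x → Eventually (λ n → seq x n * seq (inv x) n ≡ 1ℚ)
    inv-inverse x ½≤x = eventually-map (λ n → r-inverse (seq x n)) (½≤x ¼ (ℚₚ.positive⁻¹ ¼))

  ≃-eventually : ∀ {x y} → Eventually (λ n → seq x n ≡ seq y n) → x ≃ y
  ≃-eventually {x} {y} (N , eq) ε 0<ε = N , λ n N≤n → ℚₚ.≤-trans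
    (ℚₚ.≤-reflexive (cong ∣_∣ (trans (cong (_- seq y n) (eq n N≤n)) (ℚₚ.+-inverseʳ (seq y n))))) (ℚₚ.<⇒≤ 0<ε)

  module Estimates {C S : ℝ} {M W H : ℚ} (0≤W : 0ℚ ≤ W) (0≤H : 0ℚ ≤ H) (MW : M * W ≡ 1ℚ)
    (gap : S -ᴿ fromℚ M *ᴿ C ⊢≤ H) where

    W⊢≤ : fromℚ W ⊢≤ W
    W⊢≤ = ⊢≤-pointwise {fromℚ W} {W} (λ _ → ℚₚ.≤-reflexive (ℚₚ.0≤p⇒∣p∣≡p 0≤W))

    module _ (½≤C : fromℚ ½ ≤ᴿ C) where

      quotient-* : C *ᴿ (S *ᴿ inv C) ≃ S
      quotient-* = ≃-eventually {C *ᴿ (S *ᴿ inv C)} {S} (eventually-map (λ n cv → trans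
        (solve 3 (λ c s v → c :* (s :* v) := s :* (c :* v)) refl (seq C n) (seq S n) (seq (inv C) n))
        (trans (cong (seq S n *_) cv) (ℚₚ.*-identityʳ (seq S n)))) (inv-inverse C ½≤C))

      -- By M W = 1 the left side is (1 / C) · W · (S - M C), and the truncated reciprocal of C is
      -- at most 4.
      quotient-close : (S *ᴿ inv C) *ᴿ fromℚ W -ᴿ fromℚ 1ℚ ⊢≤ 4ℚ * (W * H)
      quotient-close = ⊢≤-resp {inv C *ᴿ (fromℚ W *ᴿ (S -ᴿ fromℚ M *ᴿ C))} {(S *ᴿ inv C) *ᴿ fromℚ W -ᴿ fromℚ 1ℚ} {4ℚ * (W * H)}
        (≃-eventually {inv C *ᴿ (fromℚ W *ᴿ (S -ᴿ fromℚ M *ᴿ C))} {(S *ᴿ inv C) *ᴿ fromℚ W -ᴿ fromℚ 1ℚ} (eventually-map (λ n cv → trans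
          (solve 5 (λ v w s m c → v :* (w :* (s :- m :* c)) := s :* v :* w :- (m :* w) :* (c :* v)) refl (seq (inv C) n) W (seq S n) M (seq C n))
          (cong₂ (λ a b → seq S n * seq (inv C) n * W - a * b) MW cv)) (inv-inverse C ½≤C)))
        (⊢≤-* {inv C} {fromℚ W *ᴿ (S -ᴿ fromℚ M *ᴿ C)} {4ℚ} {W * H} 0≤4 (0≤* 0≤W 0≤H)
          (⊢≤-pointwise {inv C} {4ℚ} (inv-bounded C))
          (⊢≤-* {fromℚ W} {S -ᴿ fromℚ M *ᴿ C} {W} {H} 0≤W 0≤H W⊢≤ gap))

    module _ (S′ : ℝ) (0≤S′ : ∀ n → 0ℚ ≤ seq S′ n) (S′≤1 : ∀ n → seq S′ n ≤ 1ℚ) where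

      -- The solution δ of (C + δ) M = S - S′, with W = 1 / M.
      correction : ℝ
      correction = fromℚ W *ᴿ (S -ᴿ S′) -ᴿ C

      correction-* : (C +ᴿ correction) *ᴿ fromℚ M ≃ S -ᴿ S′
      correction-* = ≃-pointwise {(C +ᴿ correction) *ᴿ fromℚ M} {S -ᴿ S′} (λ n → trans
        (solve 5 (λ c w s s′ m → (c :+ (w :* (s :- s′) :- c)) :* m := (m :* w) :* (s :- s′)) refl (seq C n) W (seq S n) (seq S′ n) M)
        (trans (cong (_* (seq S n - seq S′ n)) MW) (ℚₚ.*-identityˡ (seq S n - seq S′ n))))

      -- The correction is W (S - M C) - W S′. The first part is the scaled error of the Riemann
      -- sum; the second is at most W and is what requires n² / s to grow.
      correction-small : correction -ᴿ fromℚ 0ℚ ⊢≤ W * H + W * 1ℚ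
      correction-small = ⊢≤-resp {fromℚ W *ᴿ (S -ᴿ fromℚ M *ᴿ C) +ᴿ fromℚ W *ᴿ (-ᴿ S′)} {correction -ᴿ fromℚ 0ℚ} {W * H + W * 1ℚ}
        (≃-pointwise {fromℚ W *ᴿ (S -ᴿ fromℚ M *ᴿ C) +ᴿ fromℚ W *ᴿ (-ᴿ S′)} {correction -ᴿ fromℚ 0ℚ} (λ n → trans
          (solve 5 (λ c w s s′ m → w :* (s :- m :* c) :+ w :* (:- s′) := w :* (s :- s′) :- (m :* w) :* c) refl (seq C n) W (seq S n) (seq S′ n) M)
          (trans (cong (λ a → W * (seq S n - seq S′ n) - a * seq C n) MW)
            (solve 2 (λ x c → x :- con 1ℚ :* c := (x :- c) :- con 0ℚ) refl (W * (seq S n - seq S′ n)) (seq C n)))))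
        (⊢≤-+ {fromℚ W *ᴿ (S -ᴿ fromℚ M *ᴿ C)} {fromℚ W *ᴿ (-ᴿ S′)} {W * H} {W * 1ℚ}
          (⊢≤-* {fromℚ W} {S -ᴿ fromℚ M *ᴿ C} {W} {H} 0≤W 0≤H W⊢≤ gap)
          (⊢≤-* {fromℚ W} { -ᴿ S′} {W} {1ℚ} 0≤W 0≤1 W⊢≤
            (⊢≤-pointwise { -ᴿ S′} {1ℚ} (λ n → ℚₚ.≤-trans (ℚₚ.≤-reflexive (trans (ℚₚ.∣-p∣≡∣p∣ (seq S′ n)) (ℚₚ.0≤p⇒∣p∣≡p (0≤S′ n)))) (S′≤1 n)))))

-- The coefficient c(k) as a normalized integral.

module Coefficient where

  open ℤ using (+_)
  open Rational
  open Real
  open Logarithm using (2ℚ; ln; ln≃log)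
  open FromNat
  open Harmonic
  open LogSum
  open ℚ using (_+_; _*_; -_; _-_; _≤_; _<_)
  open Defs using (c)
  open Defs.Sequence using (0<*; 0≤*; 0<1; *-monoˡ; *-monoʳ; fromNat; fromNat≥0; fromNat-mono)
  open +-*-Solver

  c-one : ∀ {k} → ¬ (1ℚ < k) → ∀ j → seq (c k) j ≡ 2ℚ
  c-one {k} 1≮k j with 1ℚ ℚₚ.<? k
  ... | yes 1<k = ⊥-elim (1≮k 1<k)
  ... | no _ = refl

  c-formula : ∀ {k q} → 1ℚ < k → 1ℚ ≤ q → q * (k - 1ℚ) ≡ k → ∀ j →
    seq (c k) j ≡ 2ℚ * k * (1ℚ - (k - 1ℚ) * seq (ln q) j)
  c-formula {k} {q} 1<k 1≤q q· j with 1ℚ ℚₚ.<? k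
  ... | no 1≮k = ⊥-elim (1≮k 1<k)
  ... | yes _ = cong (λ l → 2ℚ * k * (1ℚ - (k - 1ℚ) * l)) (sym
        (trans (cong (λ q → seq (ln q) j) q≡) (ln≃log {k ℚ.÷ (k - 1ℚ)} {{quotient⁺}} (subst (1ℚ ≤_) q≡ 1≤q) j)))
    where
    instance
      k⁺ : ℚ.Positive k
      k⁺ = ℚ.positive (ℚₚ.<-trans 0<1 1<k)
      k-1⁺ : ℚ.Positive (k - 1ℚ)
      k-1⁺ = ℚ.positive (0<q-p 1<k)
      k-1≢0 : ℚ.NonZero (k - 1ℚ)
      k-1≢0 = ℚₚ.pos⇒nonZero (k - 1ℚ)
      1/k-1⁺ : ℚ.Positive (ℚ.1/ (k - 1ℚ))
      1/k-1⁺ = ℚₚ.1/pos⇒pos (k - 1ℚ)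
    quotient⁺ : ℚ.Positive (k ℚ.÷ (k - 1ℚ))
    quotient⁺ = ℚₚ.pos*pos⇒pos k (ℚ.1/ (k - 1ℚ))
    q≡ : q ≡ k ℚ.÷ (k - 1ℚ)
    q≡ = trans (sym (ℚₚ.*-identityʳ q)) (trans (cong (q *_) (sym (ℚₚ.*-inverseʳ (k - 1ℚ))))
      (trans (sym (ℚₚ.*-assoc q (k - 1ℚ) (ℚ.1/ (k - 1ℚ)))) (cong (_* ℚ.1/ (k - 1ℚ)) q·)))

  /-*-cancel : ∀ a b .{{_ : ℕ.NonZero b}} → (+ a / b) * fromNat b ≡ fromNat a
  /-*-cancel a b@(suc b′) = trans (cong (_* fromNat b) (/-fromNat a b))
    (trans (solve 3 (λ a i b → a :* i :* b := a :* (b :* i)) refl (fromNat a) (+ 1 / b) (fromNat b))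
      (trans (cong (fromNat a *_) (Defs.Sequence.fromNat-* b′)) (ℚₚ.*-identityʳ (fromNat a))))

  module Fixed (s n : ℕ) .{{n≢0 : ℕ.NonZero n}} (n≤s : n ℕ.≤ s) {M : ℚ} (0<M : 0ℚ < M)
    (M· : M * (2ℚ * fromNat s) ≡ fromNat n * fromNat n) where

    k N S : ℚ
    k = + s / n
    N = fromNat n
    S = fromNat s

    0<n : 0 ℕ.< n
    0<n = ℕ.>-nonZero⁻¹ n

    0<s : 0 ℕ.< s
    0<s = ℕₚ.<-≤-trans 0<n n≤s

    0<N : 0ℚ < N
    0<N = fromNat-pos 0<n

    kN : k * N ≡ S
    kN = /-*-cancel s n

    S-N : S - N ≡ fromNat (s ℕ.∸ n)
    S-N = trans (cong (_- N) (trans (cong fromNat (sym (ℕₚ.m+[n∸m]≡n n≤s))) (fromNat-+ n (s ℕ.∸ n))))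
      (solve 2 (λ n y → (n :+ y) :- n := y) refl N (fromNat (s ℕ.∸ n)))

    M2k : M * (2ℚ * k) ≡ N
    M2k = cancelˡ-≡ 0<N (trans (solve 3 (λ n m k → n :* (m :* (con 2ℚ :* k)) := m :* (con 2ℚ :* (k :* n))) refl N M k)
      (trans (cong (λ a → M * (2ℚ * a)) kN) M·))

    module _ (n<s : n ℕ.< s) where

      y = s ℕ.∸ n
      q = ratio s y

      0<y : 0 ℕ.< y
      0<y = ℕₚ.m<n⇒0<n∸m n<s

      1<k : 1ℚ < k
      1<k = ℚₚ.≰⇒> (λ k≤1 → ℚₚ.<-irrefl refl (ℚₚ.<-≤-trans (fromNat-pos 0<y)
        (≤-by (N - S) (0≤q-p (ℚₚ.≤-trans (ℚₚ.≤-reflexive (sym kN)) (ℚₚ.≤-trans (*-monoʳ (ℚₚ.<⇒≤ 0<N) k≤1) (ℚₚ.≤-reflexive (ℚₚ.*-identityˡ N)))))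
          (trans (cong (λ a → 0ℚ - a) (sym S-N)) (solve 2 (λ s n → con 0ℚ :- (s :- n) := n :- s) refl S N)))))

      q· : q * (k - 1ℚ) ≡ k
      q· = cancelˡ-≡ 0<N (trans (solve 3 (λ n q k → n :* (q :* (k :- con 1ℚ)) := q :* (k :* n :- n)) refl N q k)
        (trans (cong (λ a → q * (a - N)) kN) (trans (cong (q *_) S-N)
          (trans (ℚₚ.*-comm q (fromNat y)) (trans (*-ratio {s} 0<y) (trans (sym kN) (ℚₚ.*-comm k N)))))))

      c-below : ∀ j → M * seq (c k) j ≡ seq (integral s n) j
      c-below j = trans (cong (M *_) (c-formula 1<k (1≤ratio 0<y (ℕₚ.m∸n≤m s n)) q· j))
        (trans (solve 3 (λ m k l → m :* (con 2ℚ :* k :* (con 1ℚ :- (k :- con 1ℚ) :* l))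
            := m :* (con 2ℚ :* k) :- (k :* (m :* (con 2ℚ :* k)) :- m :* (con 2ℚ :* k)) :* l) refl M k (seq (ln q) j))
          (trans (cong (λ a → a - (k * a - a) * seq (ln q) j) M2k)
            (cong (λ a → N - a * seq (ln q) j) (trans (cong (_- N) kN) S-N))))

    c-equal : n ≡ s → ∀ j → M * seq (c k) j ≡ seq (integral s n) j
    c-equal n≡s j = trans (cong (M *_) (c-one (ℚₚ.<-irrefl (sym k≡1)) j))
      (trans (trans (cong (λ a → M * (2ℚ * a)) (sym k≡1)) M2k)
        (trans (solve 2 (λ n l → n := n :- con 0ℚ :* l) refl N (seq (ln (ratio s (s ℕ.∸ n))) j))
          (cong (λ a → N - fromNat a * seq (ln (ratio s (s ℕ.∸ n))) j) (sym (trans (cong (s ℕ.∸_) n≡s) (ℕₚ.n∸n≡0 s))))))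
      where
      k≡1 : k ≡ 1ℚ
      k≡1 = cancelˡ-≡ 0<N (trans (ℚₚ.*-comm N k) (trans kN (trans (cong fromNat (sym n≡s)) (sym (ℚₚ.*-identityʳ N)))))

    -- M · 2k = n, n (k - 1) = s - n and k / (k - 1) = s / (s - n) turn M c(k) into n - (s - n) log
    -- (s / (s - n)). For s = n both sides are n, by the value c(1) = 2. The equality holds for each
    -- approximation because both sides use the same series.
    c-integral : ∀ j → M * seq (c k) j ≡ seq (integral s n) j
    c-integral with ℕₚ.m≤n⇒m<n∨m≡n n≤s
    ... | inj₁ n<s = c-below n<s
    ... | inj₂ n≡s = c-equal n≡s

    gap : logSum s n -ᴿ fromℚ M *ᴿ c k ⊢≤ harmonic s n
    gap = ⊢≤-intro {logSum s n -ᴿ fromℚ M *ᴿ c k} {harmonic s n}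
      (≤-trans {logSum s n -ᴿ fromℚ M *ᴿ c k} {fromℚ 0ℚ} {fromℚ (harmonic s n)}
        (≤-rearrange {fromℚ 0ℚ} {excess s n} {logSum s n -ᴿ fromℚ M *ᴿ c k} {fromℚ 0ℚ} (0≤excess 0<s n n≤s)
          (λ j → trans (cong (λ a → 0ℚ - (seq (logSum s n) j - a)) (c-integral j))
            (solve 2 (λ l i → con 0ℚ :- (l :- i) := (i :- l) :- con 0ℚ) refl (seq (logSum s n) j) (seq (integral s n) j))))
        (fromℚ-mono (harmonic-nonneg s n)))
      (≤-rearrange {excess s n} {fromℚ (harmonic s n)} {fromℚ (- harmonic s n)} {logSum s n -ᴿ fromℚ M *ᴿ c k} (excess≤ 0<s n n≤s)
        (λ j → trans (cong (λ a → (seq (logSum s n) j - a) - - harmonic s n) (c-integral j))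
          (solve 3 (λ l i h → (l :- i) :- :- h := h :- (i :- l)) refl (seq (logSum s n) j) (seq (integral s n) j) (harmonic s n))))

    module _ {W : ℚ} (0≤W : 0ℚ ≤ W) (MW : M * W ≡ 1ℚ) where

      WNN : W * (N * N) ≡ 2ℚ * S
      WNN = trans (cong (W *_) (sym M·)) (trans (solve 3 (λ w m s → w :* (m :* s) := (m :* w) :* s) refl W M (2ℚ * S))
        (trans (cong (_* (2ℚ * S)) MW) (ℚₚ.*-identityˡ (2ℚ * S))))

      -- For n = 1 the lower bound Σ i / s used here is 0.
      ½≤c : 2 ℕ.≤ n → fromℚ ½ ≤ᴿ c k
      ½≤c 2≤n = ≤-trans {fromℚ ½} {fromℚ (W * T)} {c k} (fromℚ-mono ½≤WT)
        (≤-trans {fromℚ W *ᴿ fromℚ T} {fromℚ W *ᴿ (fromℚ M *ᴿ c k)} {c k}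
          (scale-mono {W} {fromℚ T} {fromℚ M *ᴿ c k} 0≤W
            (≤-trans {fromℚ T} {logSum s n} {fromℚ M *ᴿ c k} (logSum-lower 0<s n n≤s)
              (≤-rearrange {fromℚ 0ℚ} {excess s n} {logSum s n} {fromℚ M *ᴿ c k} (0≤excess 0<s n n≤s)
                (λ j → trans (cong (_- seq (logSum s n) j) (c-integral j)) (solve 2 (λ i l → i :- l := (i :- l) :- con 0ℚ) refl (seq (integral s n) j) (seq (logSum s n) j))))))
          (≤-pointwise {fromℚ W *ᴿ (fromℚ M *ᴿ c k)} {c k} (λ j → ℚₚ.≤-reflexive (trans
            (solve 3 (λ w m c → w :* (m :* c) := (m :* w) :* c) refl W M (seq (c k) j)) (trans (cong (_* seq (c k) j) MW) (ℚₚ.*-identityˡ (seq (c k) j)))))))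
        where
        T = ½ * (N * (N - 1ℚ)) * recip s
        WT· : N * N * (W * T) ≡ N * (N - 1ℚ)
        WT· = trans (solve 3 (λ n w r → n :* n :* (w :* (con ½ :* (n :* (n :- con 1ℚ)) :* r)) := w :* (n :* n) :* (con ½ :* (n :* (n :- con 1ℚ)) :* r)) refl N W (recip s))
          (trans (cong (_* T) WNN) (trans (solve 3 (λ s n r → con 2ℚ :* s :* (con ½ :* (n :* (n :- con 1ℚ)) :* r) := (s :* r) :* (n :* (n :- con 1ℚ))) refl S N (recip s))
            (trans (cong (_* (N * (N - 1ℚ))) (*-recip 0<s)) (ℚₚ.*-identityˡ (N * (N - 1ℚ))))))
        -- W T = (n - 1) / n, which is at least ½ for n ≥ 2.
        ½≤WT : ½ ≤ W * T
        ½≤WT = cancelˡ-≤ (0<* 0<N 0<N) (≤-by (½ * (N * (N - 2ℚ))) (0≤* (ℚₚ.≤ᵇ⇒≤ {0ℚ} {½} _) (0≤* (ℚₚ.<⇒≤ 0<N) (0≤q-p (fromNat-mono 2≤n))))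
          (trans (cong (_- N * N * ½) WT·) (solve 1 (λ n → n :* (n :- con 1ℚ) :- n :* n :* con ½ := con ½ :* (n :* (n :- con 2ℚ))) refl N)))

      -- W = 2s / n², and s times `harmonic s n` is at most n times `harmonic n n`, hence at most ε
      -- n²; the dependence on s cancels.
      WH≤ : ∀ {ε} → harmonic n n ≤ ε * N → W * harmonic s n ≤ 2ℚ * ε
      WH≤ {ε} h≤ = cancelˡ-≤ (0<* 0<N 0<N) (begin
        N * N * (W * harmonic s n)           ≡⟨ solve 3 (λ n w h → n :* n :* (w :* h) := w :* (n :* n) :* h) refl N W (harmonic s n) ⟩
        W * (N * N) * harmonic s n           ≡⟨ cong (_* harmonic s n) WNN ⟩
        2ℚ * S * harmonic s n                ≡⟨ ℚₚ.*-assoc 2ℚ S (harmonic s n) ⟩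
        2ℚ * (S * harmonic s n)              ≤⟨ *-monoˡ (fromNat≥0 2) (ℚₚ.≤-trans (harmonic-scale n≤s n ℕₚ.≤-refl) (*-monoˡ (ℚₚ.<⇒≤ 0<N) h≤)) ⟩
        2ℚ * (N * (ε * N))                   ≡⟨ solve 2 (λ n e → con 2ℚ :* (n :* (e :* n)) := n :* n :* (con 2ℚ :* e)) refl N ε ⟩
        N * N * (2ℚ * ε)                     ∎)
        where open ℚₚ.≤-Reasoning

      -- C is at least 1 / ε, so C s ≤ n² gives W = 2s / n² ≤ 2 / C ≤ 2ε.
      W≤ : ∀ {C ε} → 0ℚ ≤ ε → 1ℚ ≤ ε * fromNat C → C ℕ.* s ℕ.≤ n ℕ.* n → W ≤ 2ℚ * ε
      W≤ {C} {ε} 0≤ε 1≤εC Cs≤nn = cancelˡ-≤ (0<* 0<N 0<N) (begin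
        N * N * W                            ≡⟨ trans (ℚₚ.*-comm (N * N) W) WNN ⟩
        2ℚ * S                               ≤⟨ *-monoˡ (fromNat≥0 2) (ℚₚ.≤-trans (ℚₚ.≤-reflexive (sym (ℚₚ.*-identityˡ S))) (*-monoʳ (fromNat≥0 s) 1≤εC)) ⟩
        2ℚ * (ε * fromNat C * S)             ≡⟨ cong (2ℚ *_) (trans (ℚₚ.*-assoc ε (fromNat C) S) (cong (ε *_) (sym (fromNat-* C s)))) ⟩
        2ℚ * (ε * fromNat (C ℕ.* s))         ≤⟨ *-monoˡ (fromNat≥0 2) (*-monoˡ 0≤ε (fromNat-mono Cs≤nn)) ⟩
        2ℚ * (ε * fromNat (n ℕ.* n))         ≡⟨ cong (λ a → 2ℚ * (ε * a)) (fromNat-* n n) ⟩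
        2ℚ * (ε * (N * N))                   ≡⟨ solve 2 (λ n e → con 2ℚ :* (e :* n) := n :* (con 2ℚ :* e)) refl (N * N) ε ⟩
        N * N * (2ℚ * ε)                     ∎)
        where open ℚₚ.≤-Reasoning

-- Assembly of μ and δ from the probabilities and the estimates.

module Assembly where

  open import Algebra.Definitions.RawSemiring ℚ.+-*-rawSemiring using (_^_)
  open ℤ using (+_)
  open Rational
  open Real
  open Exponential using (exp-cong)
  open FromNat
  open Harmonic
  open LogSum
  open Division
  open Coefficient
  open Counting using (_↓_)
  open Probability using (uniformPr-formula; regularPr-formula)
  open ℚ using (_+_; _*_; -_; _-_; _≤_; _<_; ∣_∣)
  open Defs using (c; n²/2s; _∼_; _⟶_; uniformPr; regularPr)
  open Defs.Sequence using (0<*; *-monoˡ; fromNat; archimedean; reciprocal; sum; expTerm)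
  open +-*-Solver

  exp-0 : exp (-ᴿ fromℚ 0ℚ) ≃ fromℚ 1ℚ
  exp-0 = ≃-eventually {exp (-ᴿ fromℚ 0ℚ)} {fromℚ 1ℚ} (1 , λ { (suc n) _ → sum-0 n })
    where
    sum-0 : ∀ n → sum (expTerm 0ℚ) (suc n) ≡ 1ℚ
    sum-0 zero = refl
    sum-0 (suc n) = cong₂ _+_ (sum-0 n) (trans (cong (_* (+ 1 / (suc n !)) {{(suc n) ℕₚ.!≢0}}) (ℚₚ.*-zeroˡ (0ℚ ^ n))) (ℚₚ.*-zeroˡ ((+ 1 / (suc n !)) {{(suc n) ℕₚ.!≢0}})))

  -- The probability p is known through p a = b only, so it is compared with the exponential after
  -- multiplication by a, and the positive factor is cancelled.
  fromℚ-exp : ∀ {p a b x y} → 0ℚ < a → p * a ≡ b → fromℚ a *ᴿ exp x ≃ fromℚ b → x ≃ y → fromℚ p ≃ exp y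
  fromℚ-exp {p} {a} {b} {x} {y} 0<a pa≡b ax≃b x≃y = ≃-trans {fromℚ p} {exp x} {exp y}
    (scale-cancel {a} {fromℚ p} {exp x} 0<a (≃-trans {fromℚ a *ᴿ fromℚ p} {fromℚ b} {fromℚ a *ᴿ exp x}
      (≃-pointwise {fromℚ a *ᴿ fromℚ p} {fromℚ b} (λ _ → trans (ℚₚ.*-comm a p) pa≡b))
      (≃-sym {fromℚ a *ᴿ exp x} {fromℚ b} ax≃b)))
    (exp-cong {x} {y} x≃y)

  neg-cong : ∀ {x y} → x ≃ y → -ᴿ x ≃ -ᴿ y
  neg-cong {x} {y} x≃y ε 0<ε = eventually-map (λ n → subst (_≤ ε) (sym (trans
    (cong ∣_∣ (solve 2 (λ a b → (:- a) :- (:- b) := b :- a) refl (seq x n) (seq y n))) (Defs.Sequence.∣-∣-sym (seq y n) (seq x n))))) (x≃y ε 0<ε)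

  -- Sequences are indexed by all of ℕ, whereas s / n exists for n > 0 only; the value at 0 is a
  -- filler.
  onPositive : ((n : ℕ) → .{{ℕ.NonZero n}} → ℝ) → ℕ → ℝ
  onPositive f zero = fromℚ 0ℚ
  onPositive f (suc n) = f (suc n)

  onPositive-intro : ∀ {f : (n : ℕ) → .{{ℕ.NonZero n}} → ℝ} (P : (n : ℕ) → .{{ℕ.NonZero n}} → ℝ → Set) →
    (∀ n .{{n≢0 : ℕ.NonZero n}} → P n (f n)) → ∀ n .{{n≢0 : ℕ.NonZero n}} → P n (onPositive f n)
  onPositive-intro P h (suc n) = h (suc n)

  ^-pos : ∀ {s} n → 0 ℕ.< s → 0 ℕ.< s ℕ.^ n
  ^-pos {s} n 0<s = ℕₚ.m^n>0 s {{ℕ.>-nonZero 0<s}} n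

  ↓-pos : ∀ {N} k → k ℕ.≤ N → 0 ℕ.< N ↓ k
  ↓-pos zero _ = ℕ.s≤s ℕ.z≤n
  ↓-pos {N} (suc k) k<N = ℕₚ.*-mono-≤ (ℕₚ.m<n⇒0<n∸m k<N) (↓-pos k (ℕₚ.<⇒≤ k<N))

  exp-logSum₀ : ∀ s m → m ℕ.≤ s → fromℚ (fromNat (s ℕ.^ m)) *ᴿ exp (-ᴿ (logSum s m +ᴿ fromℚ 0ℚ)) ≃ fromℚ (fromNat (s ↓ m))
  exp-logSum₀ s m m≤s = ≃-trans {fromℚ (fromNat (s ℕ.^ m)) *ᴿ exp (-ᴿ (logSum s m +ᴿ fromℚ 0ℚ))} {fromℚ (fromNat (s ↓ m)) *ᴿ exp (-ᴿ fromℚ 0ℚ)} {fromℚ (fromNat (s ↓ m))}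
    (exp-logSum s m m≤s (fromℚ 0ℚ))
    (≃-trans {fromℚ (fromNat (s ↓ m)) *ᴿ exp (-ᴿ fromℚ 0ℚ)} {fromℚ (fromNat (s ↓ m)) *ᴿ fromℚ 1ℚ} {fromℚ (fromNat (s ↓ m))}
      (scale-cong (fromNat (s ↓ m)) {exp (-ᴿ fromℚ 0ℚ)} {fromℚ 1ℚ} exp-0)
      (≃-pointwise {fromℚ (fromNat (s ↓ m)) *ᴿ fromℚ 1ℚ} {fromℚ (fromNat (s ↓ m))} (λ _ → ℚₚ.*-identityʳ (fromNat (s ↓ m)))))

  -- `exp-logSum` for s with a = - `logSum N m` leaves the exponential of plus `logSum N m`. The
  -- same lemma for N with this a has exponent 0 on its left side, so read backwards it evaluates
  -- that exponential as N^m / (N ↓ m).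
  exp-logSum-difference : ∀ s N m → m ℕ.≤ s → m ℕ.≤ N →
    fromℚ (fromNat (N ↓ m ℕ.* s ℕ.^ m)) *ᴿ exp (-ᴿ (logSum s m -ᴿ logSum N m)) ≃ fromℚ (fromNat (s ↓ m ℕ.* N ℕ.^ m))
  exp-logSum-difference s N m m≤s m≤N =
    ≃-trans {fromℚ (fromNat (N ↓ m ℕ.* s ℕ.^ m)) *ᴿ E} {fromℚ (fromNat (N ↓ m)) *ᴿ (fromℚ (fromNat (s ℕ.^ m)) *ᴿ E)} {fromℚ (fromNat (s ↓ m ℕ.* N ℕ.^ m))}
      (≃-pointwise {fromℚ (fromNat (N ↓ m ℕ.* s ℕ.^ m)) *ᴿ E} {fromℚ (fromNat (N ↓ m)) *ᴿ (fromℚ (fromNat (s ℕ.^ m)) *ᴿ E)} (λ j →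
        trans (cong (_* seq E j) (fromNat-* (N ↓ m) (s ℕ.^ m))) (ℚₚ.*-assoc (fromNat (N ↓ m)) (fromNat (s ℕ.^ m)) (seq E j))))
    (≃-trans {fromℚ (fromNat (N ↓ m)) *ᴿ (fromℚ (fromNat (s ℕ.^ m)) *ᴿ E)} {fromℚ (fromNat (N ↓ m)) *ᴿ (fromℚ (fromNat (s ↓ m)) *ᴿ A)} {fromℚ (fromNat (s ↓ m ℕ.* N ℕ.^ m))}
      (scale-cong (fromNat (N ↓ m)) {fromℚ (fromNat (s ℕ.^ m)) *ᴿ E} {fromℚ (fromNat (s ↓ m)) *ᴿ A} (exp-logSum s m m≤s (-ᴿ logSum N m)))
    (≃-trans {fromℚ (fromNat (N ↓ m)) *ᴿ (fromℚ (fromNat (s ↓ m)) *ᴿ A)} {fromℚ (fromNat (s ↓ m)) *ᴿ (fromℚ (fromNat (N ↓ m)) *ᴿ A)} {fromℚ (fromNat (s ↓ m ℕ.* N ℕ.^ m))}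
      (≃-pointwise {fromℚ (fromNat (N ↓ m)) *ᴿ (fromℚ (fromNat (s ↓ m)) *ᴿ A)} {fromℚ (fromNat (s ↓ m)) *ᴿ (fromℚ (fromNat (N ↓ m)) *ᴿ A)} (λ j →
        solve 3 (λ a b c → a :* (b :* c) := b :* (a :* c)) refl (fromNat (N ↓ m)) (fromNat (s ↓ m)) (seq A j)))
    (≃-trans {fromℚ (fromNat (s ↓ m)) *ᴿ (fromℚ (fromNat (N ↓ m)) *ᴿ A)} {fromℚ (fromNat (s ↓ m)) *ᴿ fromℚ (fromNat (N ℕ.^ m))} {fromℚ (fromNat (s ↓ m ℕ.* N ℕ.^ m))}
      (scale-cong (fromNat (s ↓ m)) {fromℚ (fromNat (N ↓ m)) *ᴿ A} {fromℚ (fromNat (N ℕ.^ m))} cancelled)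
      (≃-pointwise {fromℚ (fromNat (s ↓ m)) *ᴿ fromℚ (fromNat (N ℕ.^ m))} {fromℚ (fromNat (s ↓ m ℕ.* N ℕ.^ m))} (λ _ → sym (fromNat-* (s ↓ m) (N ℕ.^ m)))))))
    where
    E = exp (-ᴿ (logSum s m -ᴿ logSum N m))
    A = exp (-ᴿ (-ᴿ logSum N m))
    Z = exp (-ᴿ (logSum N m -ᴿ logSum N m))
    Z≃1 : Z ≃ fromℚ 1ℚ
    Z≃1 = ≃-trans {Z} {exp (-ᴿ fromℚ 0ℚ)} {fromℚ 1ℚ}
      (exp-cong { -ᴿ (logSum N m -ᴿ logSum N m)} { -ᴿ fromℚ 0ℚ} (≃-pointwise { -ᴿ (logSum N m -ᴿ logSum N m)} { -ᴿ fromℚ 0ℚ}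
        (λ j → cong -_ (ℚₚ.+-inverseʳ (seq (logSum N m) j))))) exp-0
    cancelled : fromℚ (fromNat (N ↓ m)) *ᴿ A ≃ fromℚ (fromNat (N ℕ.^ m))
    cancelled = ≃-sym {fromℚ (fromNat (N ℕ.^ m))} {fromℚ (fromNat (N ↓ m)) *ᴿ A}
      (≃-trans {fromℚ (fromNat (N ℕ.^ m))} {fromℚ (fromNat (N ℕ.^ m)) *ᴿ fromℚ 1ℚ} {fromℚ (fromNat (N ↓ m)) *ᴿ A}
        (≃-pointwise {fromℚ (fromNat (N ℕ.^ m))} {fromℚ (fromNat (N ℕ.^ m)) *ᴿ fromℚ 1ℚ} (λ _ → sym (ℚₚ.*-identityʳ (fromNat (N ℕ.^ m)))))
      (≃-trans {fromℚ (fromNat (N ℕ.^ m)) *ᴿ fromℚ 1ℚ} {fromℚ (fromNat (N ℕ.^ m)) *ᴿ Z} {fromℚ (fromNat (N ↓ m)) *ᴿ A}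
        (scale-cong (fromNat (N ℕ.^ m)) {fromℚ 1ℚ} {Z} (≃-sym {Z} {fromℚ 1ℚ} Z≃1))
        (exp-logSum N m m≤N (-ᴿ logSum N m))))

  module _ (s : ℕ → ℕ) (n≤s : ∀ n → n ℕ.≤ s n) where

    M : (n : ℕ) → .{{ℕ.NonZero n}} → ℚ
    M n = n²/2s s n≤s n

    module At (n : ℕ) .{{n≢0 : ℕ.NonZero n}} where

      k : ℚ
      k = + s n / n

      private
        instance
          s≢0 : ℕ.NonZero (s n)
          s≢0 = ℕ.>-nonZero (ℕₚ.<-≤-trans (ℕ.>-nonZero⁻¹ n) (n≤s n))
          2s≢0 : ℕ.NonZero (2 ℕ.* s n)
          2s≢0 = ℕₚ.m*n≢0 2 (s n)
          nn≢0 : ℕ.NonZero (n ℕ.* n)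
          nn≢0 = ℕₚ.m*n≢0 n n

      M-positive : ℚ.Positive (M n)
      M-positive = ℚₚ.normalize-pos (n ℕ.* n) (2 ℕ.* s n)

      M≢0 : ℚ.NonZero (M n)
      M≢0 = ℚₚ.pos⇒nonZero (M n) {{M-positive}}

      0<M : 0ℚ < M n
      0<M = ℚₚ.positive⁻¹ (M n) {{M-positive}}

      W : ℚ
      W = (ℚ.1/ M n) {{M≢0}}

      MW : M n * W ≡ 1ℚ
      MW = ℚₚ.*-inverseʳ (M n) {{M≢0}}

      0≤W : 0ℚ ≤ W
      0≤W = ℚₚ.<⇒≤ (ℚₚ.positive⁻¹ W {{ℚₚ.1/pos⇒pos (M n) {{M-positive}}}})

      M· : M n * (Logarithm.2ℚ * fromNat (s n)) ≡ fromNat n * fromNat n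
      M· = trans (cong (M n *_) (sym (fromNat-* 2 (s n)))) (trans (/-*-cancel (n ℕ.* n) (2 ℕ.* s n)) (fromNat-* n n))

      open Fixed (s n) n (n≤s n) 0<M M· public using (gap; ½≤c; WH≤; W≤; 0<n; 0<s)

      S : ℝ
      S = logSum (s n) n

      open Estimates {c k} {S} {M n} {W} {harmonic (s n) n} 0≤W (harmonic-nonneg (s n) n) MW gap public

      -- The probability formula is claimed for every n ≥ 1, but c(k) ≥ ½ is available for n ≥ 2.
      -- For n = 1 the only summand of `S` is log 1 = 0, so both sides vanish whatever `inv`
      -- returns.
      c·quotient : c k *ᴿ (S *ᴿ inv (c k)) ≃ S
      c·quotient = small (ℕₚ.m≤n⇒m<n∨m≡n 0<n)
        where
        small : 1 ℕ.< n ⊎ 1 ≡ n → c k *ᴿ (S *ᴿ inv (c k)) ≃ S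
        small (inj₁ 2≤n) = quotient-* (½≤c 0≤W MW 2≤n)
        small (inj₂ 1≡n) = ≃-pointwise {c k *ᴿ (S *ᴿ inv (c k))} {S} (λ j → trans
          (cong (λ a → seq (c k) j * (a * seq (inv (c k)) j)) (S≡0 j))
          (trans (solve 2 (λ c v → c :* (con 0ℚ :* v) := con 0ℚ) refl (seq (c k) j) (seq (inv (c k)) j)) (sym (S≡0 j))))
          where
          S≡0 : ∀ j → seq S j ≡ 0ℚ
          S≡0 j = trans (cong (λ m → seq (logSum (s n) m) j) (sym 1≡n)) (trans (cong (λ a → seq (Logarithm.ln a) j + 0ℚ) (*-recip 0<s))
            (cong (_+ 0ℚ) (Logarithm.ln-1 j)))

      uniformPr-exp : fromℚ (uniformPr n (s n)) ≃ exp (-ᴿ (c k *ᴿ (S *ᴿ inv (c k))))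
      uniformPr-exp = fromℚ-exp {uniformPr n (s n)} {fromNat (s n ℕ.^ n)} {fromNat (s n ↓ n)} { -ᴿ (S +ᴿ fromℚ 0ℚ)} { -ᴿ (c k *ᴿ (S *ᴿ inv (c k)))}
        (fromNat-pos (^-pos n 0<s)) (uniformPr-formula n (s n) (n≤s n)) (exp-logSum₀ (s n) n (n≤s n))
        (neg-cong {S +ᴿ fromℚ 0ℚ} {c k *ᴿ (S *ᴿ inv (c k))} (≃-trans {S +ᴿ fromℚ 0ℚ} {S} {c k *ᴿ (S *ᴿ inv (c k))}
          (≃-pointwise {S +ᴿ fromℚ 0ℚ} {S} (λ j → ℚₚ.+-identityʳ (seq S j))) (≃-sym {c k *ᴿ (S *ᴿ inv (c k))} {S} c·quotient)))

      S′ : ℝ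
      S′ = logSum (n ℕ.* n) n

      n≤nn : n ℕ.≤ n ℕ.* n
      n≤nn = ℕₚ.m≤m*n n n

      δ : ℝ
      δ = correction S′ (logSum-nonneg (n ℕ.* n) n n≤nn) (logSum-square≤1 0<n)

      regularPr-exp : s n ∣ n ℕ.* n → fromℚ (regularPr n (s n)) ≃ exp (-ᴿ ((c k +ᴿ δ) *ᴿ fromℚ (M n)))
      regularPr-exp s∣nn = fromℚ-exp {regularPr n (s n)} {fromNat ((n ℕ.* n) ↓ n ℕ.* s n ℕ.^ n)} {fromNat (s n ↓ n ℕ.* (n ℕ.* n) ℕ.^ n)} { -ᴿ (S -ᴿ S′)} { -ᴿ ((c k +ᴿ δ) *ᴿ fromℚ (M n))}
        (fromNat-pos (ℕₚ.*-mono-≤ (↓-pos n n≤nn) (^-pos n 0<s))) (regularPr-formula n (s n) s∣nn) (exp-logSum-difference (s n) (n ℕ.* n) n (n≤s n) n≤nn)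
        (neg-cong {S -ᴿ S′} {(c k +ᴿ δ) *ᴿ fromℚ (M n)} (≃-sym {(c k +ᴿ δ) *ᴿ fromℚ (M n)} {S -ᴿ S′}
          (correction-* S′ (logSum-nonneg (n ℕ.* n) n n≤nn) (logSum-square≤1 0<n))))

    μ : ℕ → ℝ
    μ = onPositive (λ n → At.S n *ᴿ inv (c (At.k n)))

    μ-asymptotic : μ ∼ n²/2s s n≤s
    μ-asymptotic ε 0<ε = 2 ℕ.⊔ proj₁ small , λ n N≤n →
      At.M≢0 n , onPositive-intro (λ n x → 2 ℕ.⊔ proj₁ small ℕ.≤ n → x *ᴿ fromℚ (At.W n) -ᴿ fromℚ 1ℚ ⊢≤ ε) close n N≤n
      where
      -- 8 = 4 · 2, where 4 bounds the truncated reciprocal and 2 comes from W = 2s / n².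
      η = (+ 1 / 8) * ε
      0<η : 0ℚ < η
      0<η = 0<* (ℚₚ.positive⁻¹ (+ 1 / 8)) 0<ε
      small = harmonic-small η 0<η
      close : ∀ n .{{n≢0 : ℕ.NonZero n}} → 2 ℕ.⊔ proj₁ small ℕ.≤ n → (At.S n *ᴿ inv (c (At.k n))) *ᴿ fromℚ (At.W n) -ᴿ fromℚ 1ℚ ⊢≤ ε
      close n N≤n = ⊢≤-weaken {(S *ᴿ inv (c k)) *ᴿ fromℚ W -ᴿ fromℚ 1ℚ} {4ℚ * (W * harmonic (s n) n)} {ε}
        (ℚₚ.≤-trans (*-monoˡ 0≤4 (WH≤ 0≤W MW {η} (proj₂ small n (ℕₚ.m⊔n≤o⇒n≤o 2 (proj₁ small) N≤n))))
          (ℚₚ.≤-reflexive (solve 1 (λ e → con 4ℚ :* (con Logarithm.2ℚ :* (con (+ 1 / 8) :* e)) := e) refl ε)))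
        (quotient-close (½≤c 0≤W MW (ℕₚ.m⊔n≤o⇒m≤o 2 (proj₁ small) N≤n)))
        where open At n

    uniform : ∀ n .{{_ : ℕ.NonZero n}} → fromℚ (uniformPr n (s n)) ≃ exp (-ᴿ (c (+ s n / n) *ᴿ μ n))
    uniform = onPositive-intro (λ n x → fromℚ (uniformPr n (s n)) ≃ exp (-ᴿ (c (+ s n / n) *ᴿ x))) At.uniformPr-exp

    μ′ : ℕ → ℝ
    μ′ = onPositive (λ n → fromℚ (M n))

    μ′-asymptotic : μ′ ∼ n²/2s s n≤s
    μ′-asymptotic ε 0<ε = 0 , λ n _ → At.M≢0 n , onPositive-intro (λ n x → x *ᴿ fromℚ (At.W n) -ᴿ fromℚ 1ℚ ⊢≤ ε) (λ n →
      ⊢≤-pointwise {fromℚ (M n) *ᴿ fromℚ (At.W n) -ᴿ fromℚ 1ℚ} {ε} (λ _ → ℚₚ.≤-trans (ℚₚ.≤-reflexive (cong (λ a → ∣ a - 1ℚ ∣) (At.MW n))) (ℚₚ.<⇒≤ 0<ε))) n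

    -- δ has to vanish along all n, but the growth hypothesis speaks only of those n for which s
    -- divides n². At the others δ is set to 0.
    whenever : ∀ {P : Set} → Dec P → ℝ → ℝ
    whenever (yes _) x = x
    whenever (no _) _ = fromℚ 0ℚ

    δ : ℕ → ℝ
    δ = onPositive (λ n → whenever (s n ∣? n ℕ.* n) (At.δ n))

    regular : ∀ n .{{_ : ℕ.NonZero n}} → s n ∣ n ℕ.* n → fromℚ (regularPr n (s n)) ≃ exp (-ᴿ ((c (+ s n / n) +ᴿ δ n) *ᴿ μ′ n))
    regular (suc n) s∣nn = divisible (s (suc n) ∣? suc n ℕ.* suc n)
      where
      divisible : ∀ d → fromℚ (regularPr (suc n) (s (suc n))) ≃ exp (-ᴿ ((c (+ s (suc n) / suc n) +ᴿ whenever d (At.δ (suc n))) *ᴿ fromℚ (M (suc n))))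
      divisible (yes _) = At.regularPr-exp (suc n) s∣nn
      divisible (no s∤nn) = ⊥-elim (s∤nn s∣nn)

    δ-vanishes : (∀ C → ∃[ N ] (∀ n → N ℕ.≤ n → s n ∣ n ℕ.* n → C ℕ.* s n ℕ.≤ n ℕ.* n)) → δ ⟶ fromℚ 0ℚ
    δ-vanishes sparse ε 0<ε = N , bound
      where
      -- `correction-small` has two summands, and each will be at most 2η.
      η = (+ 1 / 4) * ε
      0<η : 0ℚ < η
      0<η = 0<* (ℚₚ.positive⁻¹ (+ 1 / 4)) 0<ε
      0≤η = ℚₚ.<⇒≤ 0<η
      small = harmonic-small η 0<η
      rec = reciprocal η 0<η
      -- C ≥ 1 / η, so the growth hypothesis for this C gives W ≤ 2η.
      C = proj₁ (archimedean (proj₁ rec))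
      1≤ηC : 1ℚ ≤ η * fromNat C
      1≤ηC = subst (_≤ η * fromNat C) (proj₂ (proj₂ rec)) (*-monoˡ 0≤η (proj₂ (archimedean (proj₁ rec))))
      N = proj₁ small ℕ.⊔ proj₁ (sparse C)
      zero≤ : fromℚ 0ℚ -ᴿ fromℚ 0ℚ ⊢≤ ε
      zero≤ = ⊢≤-pointwise {fromℚ 0ℚ -ᴿ fromℚ 0ℚ} {ε} (λ _ → ℚₚ.<⇒≤ 0<ε)
      bound : ∀ n → N ℕ.≤ n → δ n -ᴿ fromℚ 0ℚ ⊢≤ ε
      bound zero _ = zero≤
      bound (suc n) N≤n = divisible (s (suc n) ∣? suc n ℕ.* suc n)
        where
        open At (suc n) hiding (δ)
        divisible : ∀ d → whenever d (At.δ (suc n)) -ᴿ fromℚ 0ℚ ⊢≤ ε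
        divisible (no _) = zero≤
        divisible (yes s∣nn) = ⊢≤-weaken {At.δ (suc n) -ᴿ fromℚ 0ℚ} {W * harmonic (s (suc n)) (suc n) + W * 1ℚ} {ε}
          (ℚₚ.≤-trans (ℚₚ.+-mono-≤ (WH≤ 0≤W MW {η} (proj₂ small (suc n) (ℕₚ.m⊔n≤o⇒m≤o (proj₁ small) (proj₁ (sparse C)) N≤n)))
              (ℚₚ.≤-trans (ℚₚ.≤-reflexive (ℚₚ.*-identityʳ W)) (W≤ 0≤W MW {C} {η} 0≤η 1≤ηC (proj₂ (sparse C) (suc n) (ℕₚ.m⊔n≤o⇒n≤o (proj₁ small) (proj₁ (sparse C)) N≤n) s∣nn))))
            (ℚₚ.≤-reflexive (solve 1 (λ e → con Logarithm.2ℚ :* (con (+ 1 / 4) :* e) :+ con Logarithm.2ℚ :* (con (+ 1 / 4) :* e) := e) refl ε)))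
          (correction-small S′ (logSum-nonneg (suc n ℕ.* suc n) (suc n) n≤nn) (logSum-square≤1 0<n))

open import Data.Integer.Base using (+_)
open import Defs

theorem4 : (s : ℕ → ℕ) (n≤s : ∀ n → n ℕ.≤ s n) →
    (∃[ μ ] (μ ∼ n²/2s s n≤s) ×
    (∀ n .{{_ : ℕ.NonZero n}} →
    fromℚ (uniformPr n (s n)) ≃ exp (- (c (+ s n / n) * μ n))))
    ×
    ((∀ C → ∃[ N ] (∀ n → N ℕ.≤ n → s n ∣ n ℕ.* n → C ℕ.* s n ℕ.≤ n ℕ.* n)) →
    ∃[ μ ] ∃[ δ ] (μ ∼ n²/2s s n≤s) × (δ ⟶ fromℚ 0ℚ) ×
    (∀ n .{{_ : ℕ.NonZero n}} → s n ∣ n ℕ.* n →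
    fromℚ (regularPr n (s n)) ≃ exp (- ((c (+ s n / n) + δ n) * μ n))))
theorem4 s n≤s = (μ s n≤s , μ-asymptotic s n≤s , uniform s n≤s) , λ sparse →
  μ′ s n≤s , δ s n≤s , μ′-asymptotic s n≤s , δ-vanishes s n≤s sparse , regular s n≤s
  where open Assembly
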